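{- Let $G$ be a minimum imperfect graph. Then $G$ admits no balanced skew partition, and no skew partition of $G$ is loose.
   Context: Graphs are finite and simple. Berge: every hole (induced cycle of length $\ge4$) and antihole (induced subgraph whose complement is a hole) has even length. Perfect: every induced subgraph has chromatic number equal to its maximum clique size. A minimum imperfect graph is a Berge graph that is not perfect and has the minimum number of vertices among all Berge graphs that are not perfect. Paths/antipaths are induced subgraphs that are paths / whose complements are paths; lengths count edges (of the complement for antipaths). $X$ connected: $G|X$ connected; anticonnected: $\overline G|X$ connected; components/anticomponents are maximal connected/anticonnected subsets. A skew partition is a partition $(A,B)$ of $V(G)$ with $A$ not connected and $B$ not anticonnected; it is balanced if there is no odd path between nonadjacent vertices of $B$ with interior in $A$ and no odd antipath between adjacent vertices of $A$ with interior in $B$; it is loose if some vertex of $B$ has no neighbour in some component of $A$, or some vertex of $A$ is adjacent to all vertices of some anticomponent of $B$. -}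

module Defs where

open import Data.Nat using (ℕ; suc; _≤_; ∣_-_∣)
open import Data.Nat.Divisibility using (_∣_)
open import Data.Fin using (Fin; zero; suc; toℕ; fromℕ; _≟_)
open import Data.Fin.Subset using (Subset; _∈_; _⊆_; _∪_; _∩_; ⊤; ⊥; ∣_∣)
open import Data.Product using (Σ-syntax; ∃-syntax; _×_; _,_)
open import Data.Sum using (_⊎_)
open import Function.Bundles using (_↣_; _⇔_; module Injection)
open import Level using (0ℓ)
open import Relation.Binary using (Rel; Symmetric; Irreflexive; Decidable)
open import Relation.Binary.Construct.Closure.ReflexiveTransitive using (Star)
open import Relation.Binary.PropositionalEquality using (_≡_; _≢_; sym; cong)
open import Relation.Nullary using (¬_; ¬?; _×-dec_)

record Graph (n : ℕ) : Set₁ where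
  field
    Adj        : Rel (Fin n) 0ℓ
    adj-sym    : Symmetric Adj
    adj-irrefl : Irreflexive _≡_ Adj
    adj?       : Decidable Adj

open Graph public

complement : ∀ {n} → Graph n → Graph n
complement G = record
  { Adj        = λ u v → u ≢ v × ¬ Adj G u v
  ; adj-sym    = λ (u≢v , ¬uv) → (λ v≡u → u≢v (sym v≡u)) , (λ vu → ¬uv (adj-sym G vu))
  ; adj-irrefl = λ u≡v (u≢v , _) → u≢v u≡v
  ; adj?       = λ u v → ¬? (u ≟ v) ×-dec ¬? (adj? G u v)
  }

-- The subgraph induced on the image of an injection f, with its vertices
-- relabelled along f.  Up to isomorphism every induced subgraph has this form.
induced : ∀ {m n} → Graph n → Fin m ↣ Fin n → Graph m
induced G f = record
  { Adj        = λ i j → Adj G (to i) (to j)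
  ; adj-sym    = adj-sym G
  ; adj-irrefl = λ i≡j → adj-irrefl G (cong to i≡j)
  ; adj?       = λ i j → adj? G (to i) (to j)
  }
  where open Injection f using (to)

Even : ℕ → Set
Even k = 2 ∣ k

Odd : ℕ → Set
Odd k = ¬ Even k

-- H is the path 0 – 1 – ⋯ – k; its length, in edges, is k.
IsPath : ∀ {k} → Graph (suc k) → Set
IsPath H = ∀ i j → Adj H i j ⇔ ∣ toℕ i - toℕ j ∣ ≡ 1

-- H is the cycle 0 – 1 – ⋯ – (k − 1) – 0.  The second alternative is the
-- closing edge: it forces {i , j} = {0 , k − 1}.  Only used for 4 ≤ k.
IsCycle : ∀ {k} → Graph k → Set
IsCycle {k} H = ∀ i j → Adj H i j ⇔ (∣ toℕ i - toℕ j ∣ ≡ 1 ⊎ suc ∣ toℕ i - toℕ j ∣ ≡ k)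

Hole : ∀ {n} → Graph n → ℕ → Set
Hole {n} G k = 4 ≤ k × Σ[ f ∈ Fin k ↣ Fin n ] IsCycle (induced G f)

Antihole : ∀ {n} → Graph n → ℕ → Set
Antihole {n} G k = 4 ≤ k × Σ[ f ∈ Fin k ↣ Fin n ] IsCycle (complement (induced G f))

Berge : ∀ {n} → Graph n → Set
Berge G = (∀ k → Hole G k → Even k) × (∀ k → Antihole G k → Even k)

Colourable : ∀ {n} → Graph n → ℕ → Set
Colourable {n} G k = Σ[ c ∈ (Fin n → Fin k) ] (∀ u v → Adj G u v → c u ≢ c v)

IsChromaticNumber : ∀ {n} → Graph n → ℕ → Set
IsChromaticNumber G k = Colourable G k × (∀ j → Colourable G j → k ≤ j)

IsClique : ∀ {n} → Graph n → Subset n → Set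
IsClique G K = ∀ u v → u ∈ K → v ∈ K → u ≢ v → Adj G u v

IsCliqueNumber : ∀ {n} → Graph n → ℕ → Set
IsCliqueNumber {n} G k =
  (Σ[ K ∈ Subset n ] IsClique G K × ∣ K ∣ ≡ k) × (∀ K → IsClique G K → ∣ K ∣ ≤ k)

Perfect : ∀ {n} → Graph n → Set
Perfect {n} G = ∀ m (f : Fin m ↣ Fin n) →
  ∃[ k ] IsChromaticNumber (induced G f) k × IsCliqueNumber (induced G f) k

MinimumImperfect : ∀ {n} → Graph n → Set₁
MinimumImperfect {n} G =
  Berge G × ¬ Perfect G × (∀ m (H : Graph m) → Berge H → ¬ Perfect H → n ≤ m)

-- Any two vertices of X are joined by a walk inside X; in particular the
-- empty set is connected.
Connected : ∀ {n} → Graph n → Subset n → Set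
Connected G X = ∀ u v → u ∈ X → v ∈ X →
  Star (λ x y → x ∈ X × y ∈ X × Adj G x y) u v

Anticonnected : ∀ {n} → Graph n → Subset n → Set
Anticonnected G = Connected (complement G)

IsComponent : ∀ {n} → Graph n → Subset n → Subset n → Set
IsComponent G X C =
  C ⊆ X × Connected G C × (∀ D → D ⊆ X → Connected G D → C ⊆ D → D ≡ C)

IsAnticomponent : ∀ {n} → Graph n → Subset n → Subset n → Set
IsAnticomponent G X C =
  C ⊆ X × Anticonnected G C × (∀ D → D ⊆ X → Anticonnected G D → C ⊆ D → D ≡ C)

SkewPartition : ∀ {n} → Graph n → Subset n → Subset n → Set
SkewPartition G A B =
  (A ∪ B ≡ ⊤ × A ∩ B ≡ ⊥) × ¬ Connected G A × ¬ Anticonnected G B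

-- The vertices of an induced path (or antipath) enumerated by f, other than
-- its two ends f 0 and f k, all lie in X.
InteriorIn : ∀ {k n} → Fin (suc k) ↣ Fin n → Subset n → Set
InteriorIn {k} f X = ∀ i → i ≢ zero → i ≢ fromℕ k → Injection.to f i ∈ X

OddPathBetweenNonadjacent : ∀ {n} → Graph n → Subset n → Subset n → Set
OddPathBetweenNonadjacent {n} G A B =
  ∃[ k ] Σ[ f ∈ Fin (suc k) ↣ Fin n ]
    (let open Injection f using (to) in
      IsPath (induced G f) × Odd k
    × to zero ∈ B × to (fromℕ k) ∈ B × ¬ Adj G (to zero) (to (fromℕ k))
    × InteriorIn f A)

OddAntipathBetweenAdjacent : ∀ {n} → Graph n → Subset n → Subset n → Set
OddAntipathBetweenAdjacent {n} G A B =
  ∃[ k ] Σ[ f ∈ Fin (suc k) ↣ Fin n ]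
    (let open Injection f using (to) in
      IsPath (complement (induced G f)) × Odd k
    × to zero ∈ A × to (fromℕ k) ∈ A × Adj G (to zero) (to (fromℕ k))
    × InteriorIn f B)

Balanced : ∀ {n} → Graph n → Subset n → Subset n → Set
Balanced G A B =
  ¬ OddPathBetweenNonadjacent G A B × ¬ OddAntipathBetweenAdjacent G A B

Loose : ∀ {n} → Graph n → Subset n → Subset n → Set
Loose G A B =
    (∃[ b ] b ∈ B × (∃[ C ] IsComponent G A C × (∀ c → c ∈ C → ¬ Adj G b c)))
  ⊎ (∃[ a ] a ∈ A × (∃[ D ] IsAnticomponent G B D × (∀ d → d ∈ D → Adj G a d)))

-- A balanced skew partition gives B = D ∪ (B ─ D) with D complete to B ─ D,
-- and A = S ∪ (A ─ S) with S anticomplete to A ─ S.  To each half of A, together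
-- with B, attach a vertex z whose neighbourhood in it is D.  If no odd path
-- between nonadjacent vertices of D runs through A, and no odd antipath between
-- adjacent vertices of A runs through D, then these two graphs are Berge, and
-- being smaller than G they are perfect.  Replicating z until the
-- colours of D and of z together exhaust the ω(G) colours, one finds ω(D)
-- colours whose classes meet B exactly in D.  The two sides thus fit together:
-- G splits into two proper induced subgraphs with clique numbers at most ω(D)
-- and ω(G) − ω(D), so G is ω(G)-colourable.  The smaller graphs have fewer
-- vertices than G unless half of A is a single vertex; then the complement of G
-- has a star cutset, which is impossible by Chvátal's argument and the perfect
-- graph theorem.
--
-- The argument uses the balance condition only for the pair (A , D).  Let a
-- vertex b of B have no neighbour in the component C of A, and let D be part of
-- B, complete to the rest of B, with b outside D.  Closing paths and antipaths by
-- b shows that (C , D) is balanced.  If a vertex of D has no neighbour in C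
-- either, then (C , B) is balanced, and the argument applies to the complement.
-- Otherwise (A ─ C , D) is balanced too: odd paths close through C to odd
-- holes, and odd antipaths are excluded by the lemma of Roussel and Rubio.

module Submission where

open import Defs
open import Data.Bool using (Bool; true; false; not; _xor_; _∧_; _∨_)
open import Data.Bool.Properties as 𝔹ₚ using (xor-assoc; xor-comm; xor-same)
open import Data.Empty using (⊥-elim) renaming (⊥ to 𝟘)
open import Data.Fin using (Fin; zero; suc; toℕ; fromℕ; fromℕ<; inject₁; lower₁; punchIn; _≟_)
open import Data.Fin.Properties using (any?; all?; toℕ-injective; toℕ<n; toℕ-fromℕ; toℕ-fromℕ<; toℕ-inject₁; toℕ-lower₁; suc-injective)
open import Data.Fin.Subset using (Subset; _∈_; _∉_; _⊆_; _∪_; _∩_; ⊤; ⊥; ∣_∣; ⁅_⁆; Nonempty; inside; outside; ∁; _─_) renaming (_-_ to infixl 5 _⊖_)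
open import Data.Fin.Subset.Properties
open import Data.List using (List; []; _∷_; _++_; length; lookup; filter; allFin)
open import Data.List.Properties using (length-++; ++-assoc)
open import Data.List.Membership.Propositional.Properties using (∈-lookup; ∈-filter⁺; ∈-filter⁻; ∈-allFin)
open import Data.List.Relation.Unary.All as All using (All; []; _∷_)
open import Data.List.Relation.Unary.All.Properties using (++⁺; ++⁻; ++⁻ˡ; ++⁻ʳ)
open import Data.List.Relation.Unary.Any as AnyDec using (Any; here; there)
open import Data.Nat using (ℕ; zero; suc; >-nonZero; _+_; _*_; _∸_; _≤_; _<_; z≤n; s≤s; ∣_-_∣; _≤?_; _<?_)
open import Data.Nat.Divisibility using (_∣_; _∣?_; divides; ∣m∣n⇒∣m+n; ∣-refl)
open import Data.Nat.Properties as ℕₚ hiding (_≟_; suc-injective)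
open import Data.Product using (Σ-syntax; ∃; ∃-syntax; ∃₂; _×_; _,_; proj₁; proj₂)
open import Data.Product.Properties using (≡-dec)
open import Data.Sum using (_⊎_; inj₁; inj₂; [_,_]′)
open import Data.Unit using (tt) renaming (⊤ to 𝟙)
open import Data.Vec using ([]; _∷_; tabulate; here; there)
open import Data.Vec.Properties using (lookup∘tabulate; []=⇒lookup; lookup⇒[]=)
open import Function.Base using (_∘_; id; case_of_)
open import Function.Bundles using (_↣_; _⇔_; mk⇔; mk↣; module Injection; module Equivalence)
open import Function.Construct.Composition using (_⇔-∘_)
open import Function.Construct.Symmetry using (⇔-sym)
open import Relation.Binary.Construct.Closure.ReflexiveTransitive as Star using (Star; ε; _◅_; _◅◅_)
open import Relation.Binary.PropositionalEquality using (_≡_; _≢_; refl; sym; trans; cong; cong₂; subst; subst₂; module ≡-Reasoning)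
open import Relation.Nullary using (¬_; Dec; yes; no; does; ¬?; contradiction; _×-dec_; _⊎-dec_; _→-dec_)
open import Relation.Nullary.Decidable using (decidable-stable; dec-true; dec-false; map′; does-⇔)
open import Algebra.Properties.CommutativeMonoid.Sum ℕₚ.+-0-commutativeMonoid using (sum; ∑-comm; ∑-distrib-+; sum-remove; sum-cong-≗)

-- Weighted colourings

-- The hardest case is an odd antipath with interior in `D` and ends in `A` outside the component
-- `C`, all of whose inner vertices have neighbours in `C`. That last condition does not pass to
-- subsets of `C`, so an induction on `C` needs a stronger statement: for every nonempty connected
-- `F` inside `C`, the number of antipath edges with both ends free of neighbours in `F` has the
-- parity of the length of the antipath. For `C` itself this number is zero. Cliques are settled by
-- inclusion-exclusion, other sets by deleting vertices of a nonadjacent pair. Colourings carry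
-- weights because the apex has to be replicated; the same replication lemma yields the perfect
-- graph theorem, without which the complement of a minimum imperfect graph would be out of reach.
-- Minimality only refutes the imperfection of a smaller graph. As the goal is always a
-- contradiction, doubly negated perfection suffices.

⟪_⟫ : ∀ {n} {P : Fin n → Set} → (∀ x → Dec (P x)) → Subset n
⟪ P? ⟫ = tabulate (does ∘ P?)

∈⟪⟫⁺ : ∀ {n} {P : Fin n → Set} (P? : ∀ x → Dec (P x)) {x} → P x → x ∈ ⟪ P? ⟫
∈⟪⟫⁺ P? {x} px = lookup⇒[]= x _ (trans (lookup∘tabulate (does ∘ P?) x) (dec-true (P? x) px))

∈⟪⟫⁻ : ∀ {n} {P : Fin n → Set} (P? : ∀ x → Dec (P x)) {x} → x ∈ ⟪ P? ⟫ → P x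
∈⟪⟫⁻ P? {x} x∈ with P? x | trans (sym (lookup∘tabulate (does ∘ P?) x)) ([]=⇒lookup x∈)
... | yes px | _ = px

∈─⁻ : ∀ {n} (p q : Subset n) {x} → x ∈ p ─ q → x ∈ p × x ∉ q
∈─⁻ (s ∷ p) (outside ∷ q) here = here , λ ()
∈─⁻ (s ∷ p) (inside ∷ q) (there x∈) with ∈─⁻ p q x∈
... | a , b = there a , λ { (there c) → b c }
∈─⁻ (s ∷ p) (outside ∷ q) (there x∈) with ∈─⁻ p q x∈
... | a , b = there a , λ { (there c) → b c }

∈-⁻ : ∀ {n} (p : Subset n) y {x} → x ∈ p ⊖ y → x ∈ p × x ≢ y
∈-⁻ p y x∈ with ∈─⁻ p ⁅ y ⁆ x∈
... | a , b = a , λ { refl → b (x∈⁅x⁆ y) }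

disjoint-⊥ : ∀ {n} {p q : Subset n} {x} → p ∩ q ≡ ⊥ → x ∈ p → x ∉ q
disjoint-⊥ {x = x} eq xp xq = ∉⊥ (subst (x ∈_) eq (x∈p∩q⁺ (xp , xq)))

*-swapˡ : ∀ a b c → a * (b * c) ≡ b * (a * c)
*-swapˡ a b c = trans (sym (*-assoc a b c)) (trans (cong (_* c) (*-comm a b)) (*-assoc b a c))

indicator : {P : Set} → Dec P → ℕ
indicator (yes _) = 1
indicator (no _)  = 0

indicator-yes : {P : Set} (d : Dec P) → P → indicator d ≡ 1
indicator-yes (yes _) _ = refl
indicator-yes (no ¬p) p = contradiction p ¬p

indicator-no : {P : Set} (d : Dec P) → ¬ P → indicator d ≡ 0
indicator-no (yes p) ¬p = contradiction p ¬p
indicator-no (no _)  _  = refl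

χ : ∀ {n} → Subset n → Fin n → ℕ
χ K v = indicator (v ∈? K)

χ-in : ∀ {n} {K : Subset n} {v} → v ∈ K → χ K v ≡ 1
χ-in {K = K} {v} = indicator-yes (v ∈? K)

χ-out : ∀ {n} {K : Subset n} {v} → v ∉ K → χ K v ≡ 0
χ-out {K = K} {v} = indicator-no (v ∈? K)

χ≤1 : ∀ {n} (K : Subset n) v → χ K v ≤ 1
χ≤1 K v with v ∈? K
... | yes _ = s≤s z≤n
... | no _  = z≤n

χ-pos : ∀ {n} {K : Subset n} {v} → 1 ≤ χ K v → v ∈ K
χ-pos {K = K} {v} p with v ∈? K
... | yes v∈K = v∈K
... | no _ = contradiction p λ ()

χ-≤ : ∀ {n} {K L : Subset n} {v} → (v ∈ K → v ∈ L) → χ K v ≤ χ L v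
χ-≤ {K = K} {L} {v} f with v ∈? K | v ∈? L
... | no _  | _     = z≤n
... | yes _ | yes _ = s≤s z≤n
... | yes a | no b  = contradiction (f a) b

sum-mono : ∀ {n} {f g : Fin n → ℕ} → (∀ i → f i ≤ g i) → sum f ≤ sum g
sum-mono {zero}  h = z≤n
sum-mono {suc n} h = +-mono-≤ (h zero) (sum-mono (h ∘ suc))

sum-mono-< : ∀ {n} {f g : Fin n → ℕ} → (∀ i → f i ≤ g i) → ∀ i → f i < g i → sum f < sum g
sum-mono-< {suc n} h zero    lt = +-mono-<-≤ lt (sum-mono (h ∘ suc))
sum-mono-< {suc n} h (suc i) lt = +-mono-≤-< (h zero) (sum-mono-< (h ∘ suc) i lt)

sum-const : ∀ n c → sum {n} (λ _ → c) ≡ n * c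
sum-const zero    c = refl
sum-const (suc n) c = cong (c +_) (sum-const n c)

sum-ones : ∀ n → sum {n} (λ _ → 1) ≡ n
sum-ones n = trans (sum-const n 1) (*-identityʳ n)

sum-* : ∀ {n} c (f : Fin n → ℕ) → c * sum f ≡ sum (λ i → c * f i)
sum-* {zero}  c f = *-zeroʳ c
sum-* {suc n} c f = trans (*-distribˡ-+ c (f zero) _) (cong (c * f zero +_) (sum-* c (f ∘ suc)))

sum-pos : ∀ {n} (f : Fin n → ℕ) → 1 ≤ sum f → ∃[ i ] 1 ≤ f i
sum-pos {suc n} f p with f zero in eq
... | suc _ = zero , subst (1 ≤_) (sym eq) (s≤s z≤n)
... | zero with sum-pos (f ∘ suc) p
... | i , q = suc i , q

term≤sum : ∀ {n} (f : Fin n → ℕ) i → f i ≤ sum f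
term≤sum {suc n} f zero    = m≤m+n _ _
term≤sum {suc n} f (suc i) = ≤-trans (term≤sum (f ∘ suc) i) (m≤n+m _ _)

sum≤1 : ∀ {n} (f : Fin n → ℕ) → (∀ i → f i ≤ 1) → (∀ i j → 1 ≤ f i → 1 ≤ f j → i ≡ j) → sum f ≤ 1
sum≤1 {zero}  f _ _ = z≤n
sum≤1 {suc n} f f≤1 f! with 1 ≤? f zero
... | no ¬p rewrite n≤0⇒n≡0 (≤-pred (≰⇒> ¬p)) =
  sum≤1 (f ∘ suc) (f≤1 ∘ suc) (λ i j p q → suc-injective (f! (suc i) (suc j) p q))
... | yes p with 1 ≤? sum (f ∘ suc)
...   | no ¬q rewrite n≤0⇒n≡0 (≤-pred (≰⇒> ¬q)) | +-identityʳ (f zero) = f≤1 zero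
...   | yes q with sum-pos (f ∘ suc) q
...     | i , r with f! zero (suc i) p r
...       | ()

∣∣≡sum-χ : ∀ {n} (K : Subset n) → ∣ K ∣ ≡ sum (χ K)
∣∣≡sum-χ [] = refl
∣∣≡sum-χ (s ∷ K) = trans (head s) (cong (χ (s ∷ K) zero +_) (trans (∣∣≡sum-χ K) (sum-cong-≗ tail)))
  where
  head : ∀ s → ∣ s ∷ K ∣ ≡ χ (s ∷ K) zero + ∣ K ∣
  head inside  = refl
  head outside = refl
  tail : ∀ v → χ K v ≡ χ (s ∷ K) (suc v)
  tail v with v ∈? K
  ... | yes _ = refl
  ... | no _  = refl

Weight : ℕ → Set
Weight n = Fin n → ℕ

weight : ∀ {n} → Weight n → Subset n → ℕ
weight w K = sum λ v → χ K v * w v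

weight-mono : ∀ {n} {w w′ : Weight n} (K : Subset n) → (∀ v → v ∈ K → w v ≤ w′ v) → weight w K ≤ weight w′ K
weight-mono {w = w} {w′} K h = sum-mono term
  where
  term : ∀ v → χ K v * w v ≤ χ K v * w′ v
  term v with v ∈? K
  ... | yes v∈K = +-monoˡ-≤ 0 (h v v∈K)
  ... | no _    = z≤n

weight-χ : ∀ {n} (T K : Subset n) → weight (χ T) K ≡ ∣ K ∩ T ∣
weight-χ T K = sym (trans (∣∣≡sum-χ (K ∩ T)) (sum-cong-≗ term))
  where
  term : ∀ v → χ (K ∩ T) v ≡ χ K v * χ T v
  term v with v ∈? K | v ∈? T
  ... | yes p | yes q = χ-in (x∈p∩q⁺ (p , q))
  ... | yes p | no ¬q = χ-out (λ r → ¬q (proj₂ (x∈p∩q⁻ K T r)))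
  ... | no ¬p | _     = χ-out (λ r → ¬p (proj₁ (x∈p∩q⁻ K T r)))

weight-χ-⊆ : ∀ {n} {T K : Subset n} → K ⊆ T → weight (χ T) K ≡ ∣ K ∣
weight-χ-⊆ {T = T} {K} K⊆T = trans (weight-χ T K) (cong ∣_∣ (⊆-antisym (p∩q⊆p K T) (λ x∈ → x∈p∩q⁺ (x∈ , K⊆T x∈))))

Stable : ∀ {n} → Graph n → Subset n → Set
Stable G X = ∀ u v → u ∈ X → v ∈ X → ¬ Adj G u v

-- A weighted colouring with `k` colours. The classes may overlap, and a vertex may get more colours
-- than its weight asks for, so lowering a weight never spoils a cover.
Cover : ∀ {n} → Graph n → Weight n → ℕ → Set
Cover {n} G w k = Σ[ F ∈ (Fin k → Subset n) ] (∀ i → Stable G (F i)) × (∀ v → w v ≤ sum λ i → χ (F i) v)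

CliqueBound : ∀ {n} → Graph n → Weight n → ℕ → Set
CliqueBound G w k = ∀ K → IsClique G K → weight w K ≤ k

-- The equality of chromatic and clique number for the subgraph on `T` alone, not for its subsets.
-- Any bound on the cliques takes the place of the clique number, and nothing is relabelled, as
-- `weight (χ T) K` is the size of `K ∩ T`.
PerfectOn : ∀ {n} → Graph n → Subset n → Set
PerfectOn G T = ∀ k → CliqueBound G (χ T) k → Cover G (χ T) k

module _ {n : ℕ} {G : Graph n} where

  clique∩stable≤1 : ∀ {K S} → IsClique G K → Stable G S → sum (λ v → χ K v * χ S v) ≤ 1
  clique∩stable≤1 {K} {S} cl st = sum≤1 _ (λ v → *-mono-≤ (χ≤1 K v) (χ≤1 S v)) uniq
    where
    both : ∀ v → 1 ≤ χ K v * χ S v → v ∈ K × v ∈ S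
    both v p with v ∈? K | v ∈? S
    ... | yes a | yes b = a , b
    uniq : ∀ u v → 1 ≤ χ K u * χ S u → 1 ≤ χ K v * χ S v → u ≡ v
    uniq u v p q with both u p | both v q | u ≟ v
    ... | _ | _ | yes u≡v = u≡v
    ... | uK , uS | vK , vS | no u≢v = contradiction (cl u v uK vK u≢v) (st u v uS vS)

  -- J selects, with multiplicity, the members of the family that are used.
  clique-weight≤ : ∀ {k} (F : Fin k → Subset n) → (∀ i → Stable G (F i)) → (J : Fin k → ℕ) →
    ∀ {w K} → IsClique G K → (∀ v → v ∈ K → w v ≤ sum λ i → J i * χ (F i) v) → weight w K ≤ sum J
  clique-weight≤ {k} F st J {w} {K} cl h = begin
    weight w K                                      ≤⟨ weight-mono K h ⟩
    sum (λ v → χ K v * sum (λ i → J i * χ (F i) v)) ≡⟨ sum-cong-≗ {n} (λ v → sum-* {k} (χ K v) _) ⟩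
    sum (λ v → sum (λ i → χ K v * (J i * χ (F i) v))) ≡⟨ ∑-comm {n} {k} (λ v i → χ K v * (J i * χ (F i) v)) ⟩
    sum (λ i → sum (λ v → χ K v * (J i * χ (F i) v))) ≡⟨ sum-cong-≗ {k} (λ i → sum-cong-≗ {n} λ v → *-swapˡ (χ K v) (J i) (χ (F i) v)) ⟩
    sum (λ i → sum (λ v → J i * (χ K v * χ (F i) v))) ≡⟨ sum-cong-≗ {k} (λ i → sym (sum-* {n} (J i) _)) ⟩
    sum (λ i → J i * sum (λ v → χ K v * χ (F i) v)) ≤⟨ sum-mono (λ i → *-monoʳ-≤ (J i) (clique∩stable≤1 cl (st i))) ⟩
    sum (λ i → J i * 1)                             ≡⟨ sum-cong-≗ {k} (λ i → *-identityʳ (J i)) ⟩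
    sum J                                           ∎
    where
    open ≤-Reasoning

  clique-weight≤-all : ∀ {k} (F : Fin k → Subset n) → (∀ i → Stable G (F i)) →
    ∀ {w K} → IsClique G K → (∀ v → v ∈ K → w v ≤ sum λ i → χ (F i) v) → weight w K ≤ k
  clique-weight≤-all {k} F st cl h = ≤-trans
    (clique-weight≤ F st (λ _ → 1) cl (λ v v∈K → ≤-trans (h v v∈K) (≤-reflexive (sum-cong-≗ {k} λ i → sym (*-identityˡ _)))))
    (≤-reflexive (sum-ones k))

  bound-mono : ∀ {w w′ k} → (∀ v → w v ≤ w′ v) → CliqueBound G w′ k → CliqueBound G w k
  bound-mono h b K cl = ≤-trans (weight-mono K (λ v _ → h v)) (b K cl)

  cover-cons : ∀ {w w′ k} (S : Subset n) → Stable G S → (∀ v → w v ≤ χ S v + w′ v) → Cover G w′ k → Cover G w (suc k)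
  cover-cons {w} {w′} {k} S st h (F , Fst , cv) = F′ , st′ , λ v → ≤-trans (h v) (+-monoʳ-≤ (χ S v) (cv v))
    where
    F′ : Fin (suc k) → Subset n
    F′ zero    = S
    F′ (suc i) = F i
    st′ : ∀ i → Stable G (F′ i)
    st′ zero    = st
    st′ (suc i) = Fst i

  -- Lovász's replication argument: a vertex x of weight at least 2 is first
  -- lowered by one, and then a stable set through x is removed.
  perfect⇒cover : ∀ (S : Subset n) → (∀ T → T ⊆ S → PerfectOn G T) →
    ∀ w k → (∀ v → v ∉ S → w v ≡ 0) → CliqueBound G w k → Cover G w k
  perfect⇒cover S pf = λ w k → go (sum w) w k ≤-refl
    where
    go : ∀ N w k → sum w ≤ N → (∀ v → v ∉ S → w v ≡ 0) → CliqueBound G w k → Cover G w k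
    go N w k sz supp bd with any? (λ v → 2 ≤? w v)
    -- All weights are 0 or 1 here, so `w` is the indicator of a subset of `S`.
    go N w k sz supp bd | no small = F , st , λ v → ≤-trans (w≤χ v) (cv v)
      where
      T? = λ v → 1 ≤? w v
      T : Subset n
      T = ⟪ T? ⟫
      T⊆S : T ⊆ S
      T⊆S {v} v∈T with v ∈? S
      ... | yes v∈S = v∈S
      ... | no v∉S = contradiction (subst (1 ≤_) (supp v v∉S) (∈⟪⟫⁻ T? v∈T)) λ ()
      χ≤w : ∀ v → χ T v ≤ w v
      χ≤w v with v ∈? T
      ... | yes v∈T = ∈⟪⟫⁻ T? v∈T
      ... | no _ = z≤n
      w≤χ : ∀ v → w v ≤ χ T v
      w≤χ v with v ∈? T
      ... | yes _ = ≤-pred (≰⇒> λ p → small (v , p))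
      ... | no v∉T = ≤-pred (≰⇒> λ p → v∉T (∈⟪⟫⁺ T? p))
      c = pf T T⊆S k (bound-mono χ≤w bd)
      F = proj₁ c
      st = proj₁ (proj₂ c)
      cv = proj₂ (proj₂ c)
    go zero w k sz supp bd | yes (x , 2≤wx) =
      contradiction (≤-trans 2≤wx (≤-trans (term≤sum w x) sz)) (λ ())
    go (suc N) w k sz supp bd | yes (x , 2≤wx) = finish k bd c₁
      where
      w₁ : Weight n
      w₁ v = w v ∸ χ ⁅ x ⁆ v
      drop : ∀ (T : Subset n) → x ∈ T → w x ∸ χ T x < w x
      drop T x∈T rewrite χ-in x∈T = ∸-monoʳ-< {w x} {1} {0} (s≤s z≤n) (≤-trans (s≤s z≤n) 2≤wx)
      small : ∀ (T : Subset n) → x ∈ T → sum (λ v → w v ∸ χ T v) ≤ N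
      small T x∈T = ≤-pred (≤-trans (sum-mono-< (λ v → m∸n≤m (w v) (χ T v)) x (drop T x∈T)) sz)
      supp∸ : ∀ (T : Subset n) v → v ∉ S → w v ∸ χ T v ≡ 0
      supp∸ T v v∉S = trans (cong (_∸ χ T v) (supp v v∉S)) (0∸n≡0 (χ T v))
      c₁ : Cover G w₁ k
      c₁ = go N w₁ k (small ⁅ x ⁆ (x∈⁅x⁆ x)) (supp∸ ⁅ x ⁆) (bound-mono (λ v → m∸n≤m (w v) (χ ⁅ x ⁆ v)) bd)
      finish : ∀ k → CliqueBound G w k → Cover G w₁ k → Cover G w k
      finish k bd (F , st , cv) with sum-pos (λ i → χ (F i) x) (≤-trans w₁x (cv x))
        where
        w₁x : 1 ≤ w₁ x
        w₁x rewrite χ-in (x∈⁅x⁆ x) = ≤-pred (≤-trans 2≤wx (≤-reflexive (sym (m+[n∸m]≡n {1} {w x} (≤-trans (s≤s z≤n) 2≤wx)))))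
      finish (suc k) bd (F , st , cv) | i , p = cover-cons {w′ = w₂} (F i) (st i) (λ v → m≤n+m∸n (w v) (χ (F i) v)) c₂
        where
        x∈Fi : x ∈ F i
        x∈Fi = χ-pos p
        w₂ : Weight n
        w₂ v = w v ∸ χ (F i) v
        bd₂ : CliqueBound G w₂ k
        -- A clique through `x` loses at least the unit of `x`, which lies in `F i`. On a clique
        -- avoiding `x` the weights `w` and `w₁` agree, so the other `k` classes of the cover of
        -- `w₁` bound what is left.
        bd₂ K cl with x ∈? K
        ... | yes x∈K = ≤-pred (≤-trans (sum-mono-< (λ v → *-monoʳ-≤ (χ K v) (m∸n≤m (w v) (χ (F i) v))) x lt) (bd K cl))
          where
          lt : χ K x * w₂ x < χ K x * w x
          lt rewrite χ-in x∈K = +-monoˡ-< 0 (drop (F i) x∈Fi)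
        ... | no x∉K = clique-weight≤-all (F ∘ punchIn i) (st ∘ punchIn i) cl bound
          where
          bound : ∀ v → v ∈ K → w₂ v ≤ sum (λ j → χ (F (punchIn i j)) v)
          bound v v∈K = m≤n+o⇒m∸n≤o (w v) (χ (F i) v) (≤-trans (≤-trans (≤-reflexive w≡w₁) (cv v))
                          (≤-reflexive (sum-remove {i = i} (λ j → χ (F j) v))))
            where
            w≡w₁ : w v ≡ w₁ v
            w≡w₁ rewrite χ-out {K = ⁅ x ⁆} {v} (λ q → x∉K (subst (_∈ K) (x∈⁅y⁆⇒x≡y x q) v∈K)) = refl
        c₂ : Cover G w₂ k
        c₂ = go N w₂ k (small (F i) x∈Fi) (supp∸ (F i)) bd₂

-- The perfect graph theorem

sumₛ : ∀ {n} → (Subset n → ℕ) → ℕ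
sumₛ {zero}  f = f []
sumₛ {suc n} f = sumₛ (λ K → f (inside ∷ K)) + sumₛ (λ K → f (outside ∷ K))

sumₛ-mono : ∀ {n} {f g : Subset n → ℕ} → (∀ K → f K ≤ g K) → sumₛ f ≤ sumₛ g
sumₛ-mono {zero}  h = h []
sumₛ-mono {suc n} h = +-mono-≤ (sumₛ-mono {n} (λ K → h _)) (sumₛ-mono {n} (λ K → h _))

sumₛ-mono-< : ∀ {n} {f g : Subset n → ℕ} → (∀ K → f K ≤ g K) → ∀ K → f K < g K → sumₛ f < sumₛ g
sumₛ-mono-< {zero}  h [] lt = lt
sumₛ-mono-< {suc n} h (inside ∷ K) lt = +-mono-<-≤ (sumₛ-mono-< {n} (λ K → h _) K lt) (sumₛ-mono {n} (λ K → h _))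
sumₛ-mono-< {suc n} h (outside ∷ K) lt = +-mono-≤-< (sumₛ-mono {n} (λ K → h _)) (sumₛ-mono-< {n} (λ K → h _) K lt)

sumₛ-cong : ∀ {n} {f g : Subset n → ℕ} → (∀ K → f K ≡ g K) → sumₛ f ≡ sumₛ g
sumₛ-cong {zero}  h = h []
sumₛ-cong {suc n} h = cong₂ _+_ (sumₛ-cong {n} (λ K → h _)) (sumₛ-cong {n} (λ K → h _))

sumₛ-* : ∀ {n} c (f : Subset n → ℕ) → c * sumₛ f ≡ sumₛ (λ K → c * f K)
sumₛ-* {zero}  c f = refl
sumₛ-* {suc n} c f = trans (*-distribˡ-+ c (sumₛ {n} _) _) (cong₂ _+_ (sumₛ-* {n} c _) (sumₛ-* {n} c _))

sum-sumₛ-comm : ∀ {m n} (f : Fin m → Subset n → ℕ) → sum (λ v → sumₛ (f v)) ≡ sumₛ (λ K → sum (λ v → f v K))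
sum-sumₛ-comm {m} {zero}  f = refl
sum-sumₛ-comm {m} {suc n} f = trans
  (∑-distrib-+ {m} (λ v → sumₛ {n} (λ K → f v (inside ∷ K))) (λ v → sumₛ {n} (λ K → f v (outside ∷ K))))
  (cong₂ _+_ (sum-sumₛ-comm {m} {n} _) (sum-sumₛ-comm {m} {n} _))

module _ {n : ℕ} (G : Graph n) where

  clique? : ∀ K → Dec (IsClique G K)
  clique? K = all? λ u → all? λ v → (u ∈? K) →-dec ((v ∈? K) →-dec (¬? (u ≟ v) →-dec adj? G u v))

  stable? : ∀ K → Dec (Stable G K)
  stable? K = all? λ u → all? λ v → (u ∈? K) →-dec ((v ∈? K) →-dec ¬? (adj? G u v))

  stable⇒coclique : ∀ {S} → Stable G S → IsClique (complement G) S
  stable⇒coclique st u v u∈ v∈ u≢v = u≢v , st u v u∈ v∈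

  coclique⇒stable : ∀ {S} → IsClique (complement G) S → Stable G S
  coclique⇒stable cl u v u∈ v∈ uv with u ≟ v
  ... | yes u≡v = adj-irrefl G u≡v uv
  ... | no u≢v = proj₂ (cl u v u∈ v∈ u≢v) uv

  clique⇒costable : ∀ {S} → IsClique G S → Stable (complement G) S
  clique⇒costable cl u v u∈ v∈ (u≢v , ¬uv) = ¬uv (cl u v u∈ v∈ u≢v)

  costable⇒clique : ∀ {S} → Stable (complement G) S → IsClique G S
  costable⇒clique st u v u∈ v∈ u≢v with adj? G u v
  ... | yes uv = uv
  ... | no ¬uv = contradiction (u≢v , ¬uv) (st u v u∈ v∈)

  ⊥-clique : IsClique G ⊥
  ⊥-clique u v u∈ _ _ = contradiction u∈ ∉⊥

  module _ (pf : ∀ T → PerfectOn G T) (T : Subset n) where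

    Missed : Subset n → ℕ → Subset n → Set
    Missed K k S = Stable G S × S ⊆ T × ∣ S ∣ ≡ k × ¬ Nonempty (S ∩ K)

    missed? : ∀ K k S → Dec (Missed K k S)
    missed? K k S = stable? S ×-dec ((S ⊆? T) ×-dec ((∣ S ∣ ℕₚ.≟ k) ×-dec ¬? (nonempty? (S ∩ K))))

    -- Lovász: if every clique K missed some stable set S of size k, the weight
    -- counting these stable sets would need as many stable sets as there are
    -- cliques, although every clique has smaller weight.
    transversal-clique : ∀ k → 1 ≤ k → (∀ S → Stable G S → S ⊆ T → ∣ S ∣ ≤ k) →
      ∃[ K ] IsClique G K × (∀ S → Stable G S → S ⊆ T → ∣ S ∣ ≡ k → Nonempty (S ∩ K))
    transversal-clique k 1≤k small with anySubset? (λ K → clique? K ×-dec ¬? (anySubset? (missed? K k)))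
    ... | yes (K , cl , hits) = K , cl , λ S st S⊆T sz → decidable-stable (nonempty? (S ∩ K)) (λ e → hits (S , st , S⊆T , sz , e))
    ... | no none = ⊥-elim (count cliques refl)
      where
      -- Sets that are not cliques select the empty set, so sums over all subsets count cliques
      -- only. A clique without a missed stable set is excluded by `none`.
      pick : ∀ {K} → Dec (IsClique G K) → Dec (∃ (Missed K k)) → Subset n
      pick (yes _) (yes (S , _)) = S
      pick (yes _) (no _)        = ⊥
      pick (no _)  _             = ⊥
      sel : Subset n → Subset n
      sel K = pick (clique? K) (anySubset? (missed? K k))
      sel-stable : ∀ K → Stable G (sel K)
      sel-stable K with clique? K | anySubset? (missed? K k)
      ... | yes _ | yes (S , st , _) = st
      ... | yes _ | no _ = λ u v u∈ → contradiction u∈ ∉⊥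
      ... | no _  | _ = λ u v u∈ → contradiction u∈ ∉⊥
      sel⊆T : ∀ K → sel K ⊆ T
      sel⊆T K with clique? K | anySubset? (missed? K k)
      ... | yes _ | yes (S , _ , S⊆T , _) = S⊆T
      ... | yes _ | no _ = λ u∈ → contradiction u∈ ∉⊥
      ... | no _  | _ = λ u∈ → contradiction u∈ ∉⊥
      sel-size : ∀ K → ∣ sel K ∣ ≡ k * indicator (clique? K)
      sel-size K with clique? K | anySubset? (missed? K k)
      ... | yes _ | yes (S , _ , _ , sz , _) = trans sz (sym (*-identityʳ k))
      ... | yes cl | no ¬S = contradiction (K , cl , ¬S) none
      ... | no _  | _ = trans (∣⊥∣≡0 n) (sym (*-zeroʳ k))
      sel-miss : ∀ K → IsClique G K → ¬ Nonempty (sel K ∩ K)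
      sel-miss K cl with clique? K | anySubset? (missed? K k)
      ... | yes _ | yes (S , _ , _ , _ , e) = e
      ... | yes _ | no ¬S = contradiction (K , cl , ¬S) none
      ... | no ¬cl | _ = contradiction cl ¬cl
      sel-empty : ∀ K → ¬ IsClique G K → sel K ≡ ⊥
      sel-empty K ¬cl with clique? K
      ... | yes cl = contradiction cl ¬cl
      ... | no _ = refl

      w : Weight n
      w v = sumₛ λ K → χ (sel K) v
      cliques : ℕ
      cliques = sumₛ λ K → indicator (clique? K)

      weight-w : ∀ K₀ → weight w K₀ ≡ sumₛ λ K → sum λ v → χ K₀ v * χ (sel K) v
      weight-w K₀ = trans (sum-cong-≗ {n} λ v → sumₛ-* {n} (χ K₀ v) _) (sum-sumₛ-comm {n} {n} _)

      -- A clique meets each selected stable set in at most one vertex, and the one selected for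
      -- itself in none.
      bound : ∀ K₀ → IsClique G K₀ → weight w K₀ < cliques
      bound K₀ cl₀ = ≤-trans (s≤s (≤-reflexive (weight-w K₀))) (sumₛ-mono-< {n} term K₀ strict)
        where
        term : ∀ K → sum (λ v → χ K₀ v * χ (sel K) v) ≤ indicator (clique? K)
        term K = by (clique? K)
          where
          zeros : sel K ≡ ⊥ → sum (λ v → χ K₀ v * χ (sel K) v) ≤ 0
          zeros eq = ≤-trans (sum-mono {n} (λ v → ≤-reflexive (trans (cong (χ K₀ v *_) (χ-out (subst (v ∉_) (sym eq) ∉⊥))) (*-zeroʳ (χ K₀ v)))))
                       (≤-reflexive (trans (sum-const n 0) (*-zeroʳ n)))
          by : (d : Dec (IsClique G K)) → sum (λ v → χ K₀ v * χ (sel K) v) ≤ indicator d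
          by (yes _)  = clique∩stable≤1 {G = G} cl₀ (sel-stable K)
          by (no ¬cl) = zeros (sel-empty K ¬cl)
        strict : sum (λ v → χ K₀ v * χ (sel K₀) v) < indicator (clique? K₀)
        strict rewrite indicator-yes (clique? K₀) cl₀ = s≤s (≤-trans (sum-mono {n} zero-term) (≤-reflexive (trans (sum-const n 0) (*-zeroʳ n))))
          where
          zero-term : ∀ v → χ K₀ v * χ (sel K₀) v ≤ 0
          zero-term v with v ∈? K₀ | v ∈? sel K₀
          ... | yes a | yes b = contradiction (v , x∈p∩q⁺ (b , a)) (sel-miss K₀ cl₀)
          ... | yes _ | no _  = z≤n
          ... | no _  | _     = z≤n

      total : sum w ≡ k * cliques
      total = trans (sum-sumₛ-comm {n} {n} _) (trans (sumₛ-cong {n} λ K → trans (sym (∣∣≡sum-χ (sel K))) (sel-size K)) (sym (sumₛ-* {n} k _)))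

      w≤ : ∀ v → w v ≤ χ T v * w v
      w≤ v with v ∈? T
      ... | yes _ = ≤-reflexive (sym (*-identityˡ _))
      ... | no v∉T = ≤-trans (sumₛ-mono {n} (λ K → ≤-reflexive (χ-out (v∉T ∘ sel⊆T K)))) (≤-reflexive (sym (sumₛ-* {n} 0 (λ _ → 0))))

      -- The weight `w` lives on `T`, and no stable set covers more than `k` vertices of `T`.
      cover-total : ∀ m → Cover G w m → sum w ≤ m * k
      cover-total m (F , st , cv) = begin
        sum w                                           ≤⟨ sum-mono {n} (λ v → ≤-trans (w≤ v) (*-monoʳ-≤ (χ T v) (cv v))) ⟩
        sum (λ v → χ T v * sum (λ i → χ (F i) v))       ≡⟨ sum-cong-≗ {n} (λ v → sum-* {m} (χ T v) _) ⟩
        sum (λ v → sum (λ i → χ T v * χ (F i) v))       ≡⟨ ∑-comm {n} {m} (λ v i → χ T v * χ (F i) v) ⟩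
        sum (λ i → weight (χ (F i)) T)                  ≤⟨ sum-mono {m} (λ i → ≤-trans (≤-reflexive (weight-χ (F i) T))
                                                              (small (T ∩ F i) (λ u v u∈ v∈ → st i u v (p∩q⊆q T (F i) u∈) (p∩q⊆q T (F i) v∈)) (p∩q⊆p T (F i)))) ⟩
        sum {m} (λ i → k)                               ≡⟨ sum-const m k ⟩
        m * k                                           ∎
        where open ≤-Reasoning

      -- One colour fewer than there are cliques covers `w`, although the total weight is `k` times
      -- the number of cliques. That number is positive, as the empty set is a clique.
      count : ∀ M → M ≡ cliques → 𝟘
      count zero eq = contradiction (subst (weight w ⊥ <_) (sym eq) (bound ⊥ ⊥-clique)) λ ()
      count (suc m) eq = <-irrefl refl (≤-trans (*-monoˡ-< k {{>-nonZero 1≤k}} (n<1+n m)) (≤-trans (≤-reflexive (trans (*-comm (suc m) k) (trans (cong (k *_) eq) (sym total))))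
        (cover-total m (perfect⇒cover {G = G} ⊤ (λ S _ → pf S) w m (λ v v∉ → contradiction ∈⊤ v∉)
          (λ K cl → ≤-pred (≤-trans (bound K cl) (≤-reflexive (sym eq))))))))

  -- A clique of `G` is a colour class of the complement. Deleting one that meets every stable set
  -- of size `suc k` in `T` leaves stable sets of size at most `k`, which is the induction.
  perfect-complement : (∀ T → PerfectOn G T) → ∀ T → PerfectOn (complement G) T
  perfect-complement pf T zero bd = (λ ()) , (λ ()) , λ v → ≤-trans (χ≤0 v) z≤n
    where
    χ≤0 : ∀ v → χ T v ≤ 0
    χ≤0 v = ≤-trans (≤-reflexive (sym (trans (cong (_* χ T v) (χ-in (x∈⁅x⁆ v))) (*-identityˡ _))))
              (≤-trans (term≤sum (λ u → χ ⁅ v ⁆ u * χ T u) v) (bd ⁅ v ⁆ single))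
      where
      single : IsClique (complement G) ⁅ v ⁆
      single a b a∈ b∈ a≢b = contradiction (trans (x∈⁅y⁆⇒x≡y v a∈) (sym (x∈⁅y⁆⇒x≡y v b∈))) a≢b
  perfect-complement pf T (suc k) bd with transversal-clique pf T (suc k) (s≤s z≤n) small
    where
    small : ∀ S → Stable G S → S ⊆ T → ∣ S ∣ ≤ suc k
    small S st S⊆T = ≤-trans (≤-reflexive (sym (weight-χ-⊆ S⊆T))) (bd S (stable⇒coclique st))
  ... | K , cl , hits = cover-cons {G = complement G} {w′ = χ (T ─ K)} K (clique⇒costable cl) split
                          (perfect-complement pf (T ─ K) k bound)
    where
    split : ∀ v → χ T v ≤ χ K v + χ (T ─ K) v
    split v with v ∈? K
    ... | yes _ = ≤-trans (χ≤1 T v) (m≤m+n 1 _)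
    ... | no v∉K = χ-≤ λ v∈T → x∈p∧x∉q⇒x∈p─q v∈T v∉K
    bound : CliqueBound (complement G) (χ (T ─ K)) k
    bound L clL with weight (χ (T ─ K)) L ≤? k
    ... | yes p = p
    ... | no ¬p = contradiction (hits S stS (p─q⊆p T K ∘ p∩q⊆q L (T ─ K)) size) empty
      where
      S : Subset n
      S = L ∩ (T ─ K)
      stS : Stable G S
      stS = coclique⇒stable λ u v u∈ v∈ → clL u v (p∩q⊆p L _ u∈) (p∩q⊆p L _ v∈)
      size : ∣ S ∣ ≡ suc k
      size = ≤-antisym
        (≤-trans (≤-reflexive (sym (weight-χ (T ─ K) L))) (≤-trans (weight-mono L (λ v _ → χ-≤ (p─q⊆p T K))) (bd L clL)))
        (≤-trans (≰⇒> ¬p) (≤-reflexive (weight-χ (T ─ K) L)))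
      empty : ¬ Nonempty (S ∩ K)
      empty (x , x∈) with x∈p∩q⁻ S K x∈
      ... | x∈S , x∈K = proj₂ (∈─⁻ T K (p∩q⊆q L (T ─ K) x∈S)) x∈K

-- Minimum imperfect graphs

-- A relation in place of a function lets the assignment exist on `K` only, and covers images and
-- inverse images under an injection alike.
card-≤-via : ∀ {m n} (K : Subset m) (L : Subset n) (R : Fin m → Fin n → Set) →
  (∀ x → x ∈ K → ∃[ y ] y ∈ L × R x y) → (∀ {x x′ y} → R x y → R x′ y → x ≡ x′) → ∣ K ∣ ≤ ∣ L ∣
card-≤-via [] L R f inj = z≤n
card-≤-via (outside ∷ K) L R f inj =
  card-≤-via K L (R ∘ suc) (λ x x∈ → f (suc x) (there x∈)) (λ r r′ → suc-injective (inj r r′))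
card-≤-via (inside ∷ K) L R f inj with f zero here
... | y , y∈L , r = ≤-trans (s≤s (card-≤-via K (L ⊖ y) (R ∘ suc) rest (λ r r′ → suc-injective (inj r r′)))) (x∈p⇒∣p-x∣<∣p∣ y∈L)
  where
  rest : ∀ x → x ∈ K → ∃[ y′ ] y′ ∈ L ⊖ y × R (suc x) y′
  rest x x∈ with f (suc x) (there x∈)
  ... | y′ , y′∈L , r′ = y′ , x∈p∧x≢y⇒x∈p-y y′∈L (λ { refl → contradiction (inj r′ r) λ () }) , r′

enum : ∀ {n} (T : Subset n) → Fin ∣ T ∣ → Fin n
enum (inside ∷ T)  zero    = zero
enum (inside ∷ T)  (suc i) = suc (enum T i)
enum (outside ∷ T) i       = suc (enum T i)

enum-injective : ∀ {n} (T : Subset n) {i j} → enum T i ≡ enum T j → i ≡ j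
enum-injective (inside ∷ T)  {zero}  {zero}  _  = refl
enum-injective (inside ∷ T)  {suc i} {suc j} eq = cong suc (enum-injective T (suc-injective eq))
enum-injective (outside ∷ T) eq                 = enum-injective T (suc-injective eq)

enum-∈ : ∀ {n} (T : Subset n) i → enum T i ∈ T
enum-∈ (inside ∷ T)  zero    = here
enum-∈ (inside ∷ T)  (suc i) = there (enum-∈ T i)
enum-∈ (outside ∷ T) i       = there (enum-∈ T i)

enum-onto : ∀ {n} (T : Subset n) {v} → v ∈ T → ∃[ i ] enum T i ≡ v
enum-onto (inside ∷ T) here = zero , refl
enum-onto (inside ∷ T) (there v∈) with enum-onto T v∈
... | i , eq = suc i , cong suc eq
enum-onto (outside ∷ T) (there v∈) with enum-onto T v∈
... | i , eq = i , cong suc eq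

largest : ∀ {n} {P : Subset n → Set} → (∀ K → Dec (P K)) → ∃ P → ∃[ K ] P K × (∀ L → P L → ∣ L ∣ ≤ ∣ K ∣)
largest {n} {P} P? (K , p) = go n K p (m≤m+n n ∣ K ∣)
  where
  go : ∀ fuel K → P K → n ≤ fuel + ∣ K ∣ → ∃[ K ] P K × (∀ L → P L → ∣ L ∣ ≤ ∣ K ∣)
  go zero K p n≤ = K , p , λ L _ → ≤-trans (∣p∣≤n L) n≤
  go (suc fuel) K p n≤ with anySubset? (λ L → P? L ×-dec (∣ K ∣ <? ∣ L ∣))
  ... | no none = K , p , λ L q → ≮⇒≥ (λ lt → none (L , q , lt))
  ... | yes (L , q , lt) = go fuel L q (≤-trans n≤ (≤-trans (≤-reflexive (sym (+-suc fuel ∣ K ∣))) (+-monoʳ-≤ fuel lt)))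

-- Minimality gives perfection doubly negated, one subset at a time. There are finitely many
-- subsets, so the double negation can be moved outside the quantifier.
¬¬-shift : ∀ {n} {P : Subset n → Set} → (∀ T → ¬ ¬ P T) → ¬ ¬ (∀ T → P T)
¬¬-shift {zero}  h k = h [] λ p → k λ { [] → p }
¬¬-shift {suc n} h k = ¬¬-shift {n} (λ T → h (inside ∷ T)) λ p → ¬¬-shift {n} (λ T → h (outside ∷ T)) λ q →
  k λ { (inside ∷ T) → p T ; (outside ∷ T) → q T }

_≟⊤ : ∀ {n} (T : Subset n) → Dec (T ≡ ⊤)
T ≟⊤ = map′ (⊆-antisym ⊆⊤) (λ { refl → ⊆-refl }) (⊤ ⊆? T)

PerfectAt : ∀ {m} → Graph m → Set
PerfectAt H = ∃[ k ] IsChromaticNumber H k × IsCliqueNumber H k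

module _ {m n : ℕ} (G : Graph n) (f : Fin m ↣ Fin n) where
  open Injection f using (to; injective)

  -- Here `f` enumerates `T`. The image of a maximum clique forces `ω ≤ k`, so the optimal colours
  -- are among `k` colours.
  perfectAt⇒perfectOn : ∀ {T} → (∀ i → to i ∈ T) → (∀ {v} → v ∈ T → ∃[ i ] to i ≡ v) →
    PerfectAt (induced G f) → PerfectOn G T
  perfectAt⇒perfectOn {T} f∈T onto (ω , ((c , proper) , _) , ((K , cl , sz) , _)) k bd = F , stable , cover
    where
    image? = λ v → any? λ i → (i ∈? K) ×-dec (to i ≟ v)
    L : Subset n
    L = ⟪ image? ⟫
    clL : IsClique G L
    clL u v u∈ v∈ u≢v with ∈⟪⟫⁻ image? u∈ | ∈⟪⟫⁻ image? v∈
    ... | i , i∈ , refl | j , j∈ , refl = cl i j i∈ j∈ (u≢v ∘ cong to)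
    L⊆T : L ⊆ T
    L⊆T v∈ with ∈⟪⟫⁻ image? v∈
    ... | i , _ , refl = f∈T i
    ω≤k : ω ≤ k
    ω≤k = ≤-trans (≤-reflexive (sym sz)) (≤-trans
      (card-≤-via K L (λ i v → to i ≡ v) (λ i i∈ → to i , ∈⟪⟫⁺ image? (i , i∈ , refl) , refl) (λ p q → injective (trans p (sym q))))
      (≤-trans (≤-reflexive (sym (weight-χ-⊆ L⊆T))) (bd L clL)))
    class? = λ j v → any? λ i → (to i ≟ v) ×-dec (toℕ (c i) ℕₚ.≟ toℕ j)
    F : Fin k → Subset n
    F j = ⟪ class? j ⟫
    stable : ∀ j → Stable G (F j)
    stable j u v u∈ v∈ uv with ∈⟪⟫⁻ (class? j) u∈ | ∈⟪⟫⁻ (class? j) v∈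
    ... | i , refl , p | i′ , refl , q = proper i i′ uv (toℕ-injective (trans p (sym q)))
    cover : ∀ v → χ T v ≤ sum (λ j → χ (F j) v)
    cover v with v ∈? T
    ... | no _ = z≤n
    ... | yes v∈T with onto v∈T
    ...   | i , eq = ≤-trans (≤-reflexive (sym (χ-in v∈F))) (term≤sum (λ j → χ (F j) v) j)
      where
      j : Fin k
      j = fromℕ< (≤-trans (toℕ<n (c i)) ω≤k)
      v∈F : v ∈ F j
      v∈F = ∈⟪⟫⁺ (class? j) (i , eq , sym (toℕ-fromℕ< _))

  perfectOn⇒perfectAt : ∀ {T} → (∀ i → to i ∈ T) → (∀ {v} → v ∈ T → ∃[ i ] to i ≡ v) →
    PerfectOn G T → PerfectAt (induced G f)
  perfectOn⇒perfectAt {T} f∈T onto pf with largest (clique? (induced G f)) (⊥ , ⊥-clique (induced G f))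
  ... | K , cl , max with pf ∣ K ∣ bound
    where
    bound : CliqueBound G (χ T) ∣ K ∣
    bound L clL = ≤-trans (≤-reflexive (weight-χ T L)) (≤-trans
      (card-≤-via (L ∩ T) preimage (λ v i → to i ≡ v) back (λ p q → trans (sym p) q))
      (max preimage clP))
      where
      preimage? = λ i → to i ∈? L
      preimage : Subset m
      preimage = ⟪ preimage? ⟫
      back : ∀ v → v ∈ L ∩ T → ∃[ i ] i ∈ preimage × to i ≡ v
      back v v∈ with x∈p∩q⁻ L T v∈
      ... | v∈L , v∈T with onto v∈T
      ... | i , refl = i , ∈⟪⟫⁺ preimage? v∈L , refl
      clP : IsClique (induced G f) preimage
      clP i j i∈ j∈ i≢j = clL (to i) (to j) (∈⟪⟫⁻ preimage? i∈) (∈⟪⟫⁻ preimage? j∈) (i≢j ∘ injective)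
  ... | F , st , cv = ∣ K ∣ , ((colour , proper) , least) , ((K , cl , refl) , max)
    where
    class : ∀ i → ∃[ j ] to i ∈ F j
    class i with sum-pos (λ j → χ (F j) (to i)) (≤-trans (≤-reflexive (sym (χ-in (f∈T i)))) (cv (to i)))
    ... | j , p = j , χ-pos p
    colour : Fin m → Fin ∣ K ∣
    colour = proj₁ ∘ class
    proper : ∀ u v → Adj G (to u) (to v) → colour u ≢ colour v
    proper u v uv eq = st (colour u) (to u) (to v) (proj₂ (class u)) (subst (λ j → to v ∈ F j) (sym eq) (proj₂ (class v))) uv
    least : ∀ j → Colourable (induced G f) j → ∣ K ∣ ≤ j
    least j (c , pr) = ≤-trans (card-≤-via K ⊤ (λ i y → i ∈ K × c i ≡ y) (λ i i∈ → c i , ∈⊤ , i∈ , refl) inj)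
                         (≤-reflexive (∣⊤∣≡n j))
      where
      inj : ∀ {x x′ y} → x ∈ K × c x ≡ y → x′ ∈ K × c x′ ≡ y → x ≡ x′
      inj {x} {x′} (x∈ , p) (x′∈ , q) with x ≟ x′
      ... | yes eq = eq
      ... | no neq = contradiction (trans p (sym q)) (pr x x′ (cl x x′ x∈ x′∈ neq))

enum↣ : ∀ {n} (T : Subset n) → Fin ∣ T ∣ ↣ Fin n
enum↣ T = mk↣ (enum-injective T)

perfect⇒perfectOn : ∀ {n} (G : Graph n) → Perfect G → ∀ T → PerfectOn G T
perfect⇒perfectOn G pf T = perfectAt⇒perfectOn G (enum↣ T) (enum-∈ T) (enum-onto T) (pf _ (enum↣ T))

perfectOn⇒perfect : ∀ {n} (G : Graph n) → (∀ T → PerfectOn G T) → Perfect G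
perfectOn⇒perfect {n} G pf m f = perfectOn⇒perfectAt G f (λ i → ∈⟪⟫⁺ image? (i , refl)) (∈⟪⟫⁻ image?) (pf ⟪ image? ⟫)
  where
  image? = λ (v : Fin n) → any? λ i → Injection.to f i ≟ v

perfectOn-co-co : ∀ {n} (G : Graph n) T → PerfectOn (complement (complement G)) T → PerfectOn G T
perfectOn-co-co G T pf k bd with pf k (λ K cl → bd K (costable⇒clique G (coclique⇒stable (complement G) cl)))
... | F , st , cv = F , (λ i → coclique⇒stable G (costable⇒clique (complement G) (st i))) , cv

-- The complement of the complement has the adjacency of `G` only up to equivalence, hence the
-- detour through `perfectOn-co-co`.
perfect-co : ∀ {n} (G : Graph n) → Perfect (complement G) → Perfect G
perfect-co G pf = perfectOn⇒perfect G λ T →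
  perfectOn-co-co G T (perfect-complement (complement G) (perfect⇒perfectOn (complement G) pf) T)

adj-stable : ∀ {n} (G : Graph n) {u v} → ¬ ¬ Adj G u v → Adj G u v
adj-stable G {u} {v} = decidable-stable (adj? G u v)

module _ {k n : ℕ} (G : Graph n) (f : Fin k ↣ Fin n) where
  open Injection f using (to; injective)

  induced-co : ∀ i j → Adj (complement (induced G f)) i j ⇔ Adj (induced (complement G) f) i j
  induced-co i j = mk⇔ (λ (p , q) → p ∘ injective , q) (λ (p , q) → p ∘ cong to , q)

  induced-co-co : ∀ i j → Adj (induced G f) i j ⇔ Adj (complement (induced (complement G) f)) i j
  induced-co-co i j = mk⇔ (λ p → (λ { refl → adj-irrefl G refl p }) , λ (_ , q) → q p)
    (λ (p , q) → adj-stable G λ ¬uv → q (p ∘ injective , ¬uv))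

berge-co : ∀ {n} (G : Graph n) → Berge G → Berge (complement G)
berge-co G (holes , antiholes) =
  (λ k (4≤k , f , cyc) → antiholes k (4≤k , f , λ i j → cyc i j ⇔-∘ induced-co G f i j)) ,
  (λ k (4≤k , f , cyc) → holes k (4≤k , f , λ i j → cyc i j ⇔-∘ induced-co-co G f i j))

minimumImperfect-co : ∀ {n} (G : Graph n) → MinimumImperfect G → MinimumImperfect (complement G)
minimumImperfect-co G (berge , imp , min) = berge-co G berge , imp ∘ perfect-co G , min

BergeOn : ∀ {n} → Graph n → Subset n → Set
BergeOn {n} G T =
    (∀ k → 4 ≤ k → (f : Fin k ↣ Fin n) → (∀ i → Injection.to f i ∈ T) → IsCycle (induced G f) → Even k)
  × (∀ k → 4 ≤ k → (f : Fin k ↣ Fin n) → (∀ i → Injection.to f i ∈ T) → IsCycle (complement (induced G f)) → Even k)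

berge⇒bergeOn : ∀ {n} (G : Graph n) → Berge G → ∀ T → BergeOn G T
berge⇒bergeOn G (h , a) T = (λ k 4≤k f _ c → h k (4≤k , f , c)) , (λ k 4≤k f _ c → a k (4≤k , f , c))

module _ {n : ℕ} (G : Graph n) (mi : MinimumImperfect G) where

  -- Only the number of vertices counts, so `H` may be any graph on the same vertex set. This admits
  -- graphs made from `G` by altering the neighbourhood of a vertex.
  minimal : (H : Graph n) (S : Subset n) → S ≢ ⊤ → BergeOn H S → ¬ ¬ PerfectOn H S
  minimal H S S≢⊤ (h , a) ¬pf = <⇒≱ small (proj₂ (proj₂ mi) ∣ S ∣ (induced H (enum↣ S)) berge
      (λ pf → ¬pf (perfectAt⇒perfectOn H (enum↣ S) (enum-∈ S) (enum-onto S) (pf _ (mk↣ id)))))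
    where
    small : ∣ S ∣ < n
    small = ≤∧≢⇒< (∣p∣≤n S) (S≢⊤ ∘ ∣p∣≡n⇒p≡⊤)
    into : ∀ {k} → Fin k ↣ Fin ∣ S ∣ → Fin k ↣ Fin n
    into f = mk↣ (Injection.injective f ∘ enum-injective S)
    berge : Berge (induced H (enum↣ S))
    berge = (λ k (4≤k , f , c) → h k 4≤k (into f) (λ i → enum-∈ S _) c) ,
            (λ k (4≤k , f , c) → a k 4≤k (into f) (λ i → enum-∈ S _) c)

  minimal-⊆ : (H : Graph n) (S : Subset n) → S ≢ ⊤ → BergeOn H S → ¬ ¬ (∀ T → T ⊆ S → PerfectOn H T)
  minimal-⊆ H S S≢⊤ (h , a) = ¬¬-shift {P = λ T → T ⊆ S → PerfectOn H T} λ T k → k λ T⊆S → ⊥-elim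
    (minimal H T (λ { refl → S≢⊤ (⊆-antisym ⊆⊤ T⊆S) })
      ((λ j 4≤ f f∈ → h j 4≤ f (T⊆S ∘ f∈)) , (λ j 4≤ f f∈ → a j 4≤ f (T⊆S ∘ f∈)))
      λ p → k λ _ → p)

  minimal-proper : ¬ ¬ (∀ T → T ≢ ⊤ → PerfectOn G T)
  minimal-proper = ¬¬-shift {P = λ T → T ≢ ⊤ → PerfectOn G T} λ T k → k λ T≢⊤ → ⊥-elim
    (minimal G T T≢⊤ (berge⇒bergeOn G (proj₁ mi) T) λ p → k λ _ → p)

  not-perfectOn-⊤ : (∀ T → T ≢ ⊤ → PerfectOn G T) → ¬ PerfectOn G ⊤
  not-perfectOn-⊤ proper pf = proj₁ (proj₂ mi) (perfectOn⇒perfect G all)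
    where
    all : ∀ T → PerfectOn G T
    all T with T ≟⊤
    ... | yes refl = pf
    ... | no T≢⊤ = proper T T≢⊤

-- Star cutsets and colourings with an apex

cover-append : ∀ {n} (G : Graph n) {w w′ : Weight n} s {t} → Cover G w s → Cover G w′ t → Cover G (λ v → w v + w′ v) (s + t)
cover-append G zero (F , st , cv) (F′ , st′ , cv′) = F′ , st′ , λ v → +-mono-≤ (cv v) (cv′ v)
cover-append G {w} {w′} (suc s) (F , st , cv) c′ =
  cover-cons {G = G} {w = λ v → w v + w′ v} (F zero) (st zero)
    (λ v → ≤-trans (+-monoˡ-≤ (w′ v) (cv v)) (≤-reflexive (+-assoc (χ (F zero) v) (rest v) (w′ v))))
    (cover-append G {rest} {w′} s (F ∘ suc , st ∘ suc , λ v → ≤-refl) c′)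
  where
  rest : Weight _
  rest v = sum λ i → χ (F (suc i)) v

cover-≤ : ∀ {n} (G : Graph n) {w w′ : Weight n} {k} → (∀ v → w v ≤ w′ v) → Cover G w′ k → Cover G w k
cover-≤ G h (F , st , cv) = F , st , λ v → ≤-trans (h v) (cv v)

-- Chvátal's star cutset lemma: in optimal colourings of the two sides, the
-- classes of the centre b together form a stable set meeting every large clique.
no-star-cutset : ∀ {n} (G : Graph n) → MinimumImperfect G → (A₁ A₂ : Subset n) (b : Fin n) →
  Nonempty A₁ → Nonempty A₂ → A₁ ∩ A₂ ≡ ⊥ → b ∉ A₁ → b ∉ A₂ → (∀ u v → u ∈ A₁ → v ∈ A₂ → ¬ Adj G u v) →
  (∀ c → c ∉ A₁ → c ∉ A₂ → c ≢ b → Adj G b c) → 𝟘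
no-star-cutset {n} G mi A₁ A₂ b (a₁ , a₁∈) (a₂ , a₂∈) A₁₂ b∉A₁ b∉A₂ anti star =
  minimal-proper G mi λ proper → not-perfectOn-⊤ G mi proper (whole proper)
  where
  whole : (∀ T → T ≢ ⊤ → PerfectOn G T) → PerfectOn G ⊤
  whole proper k bd = go k bd (side A₂ (a₂ , a₂∈)) (side A₁ (a₁ , a₁∈))
    where
    side : ∀ A → Nonempty A → Cover G (χ (∁ A)) k
    side A (a , a∈) = proper (∁ A) (λ eq → x∈∁p⇒x∉p (subst (a ∈_) (sym eq) ∈⊤) a∈) k
      (bound-mono {G = G} (λ v → χ-≤ λ _ → ∈⊤) bd)
    class-of-b : ∀ {k A} → b ∉ A → (c : Cover G (χ (∁ A)) k) → ∃[ i ] b ∈ proj₁ c i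
    class-of-b {A = A} b∉A (F , _ , cv) with sum-pos (λ i → χ (F i) b) (≤-trans (≤-reflexive (sym (χ-in {K = ∁ A} (x∉p⇒x∈∁p b∉A)))) (cv b))
    ... | i , p = i , χ-pos p
    go : ∀ k → CliqueBound G (χ ⊤) k → Cover G (χ (∁ A₂)) k → Cover G (χ (∁ A₁)) k → Cover G (χ ⊤) k
    go k bd c₁ c₂ with class-of-b {A = A₂} b∉A₂ c₁ | class-of-b {A = A₁} b∉A₁ c₂
    go (suc k) bd (F₁ , st₁ , cv₁) (F₂ , st₂ , cv₂) | i₁ , b∈₁ | i₂ , b∈₂ =
      cover-cons {G = G} {w = χ ⊤} {w′ = χ (∁ X)} X stX split (proper (∁ X) ∁X≢⊤ k bound)
      where
      -- A class of a cover may contain vertices of the side that was left out; these are discarded.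
      X₁ X₂ X : Subset n
      X₁ = F₁ i₁ ∩ ∁ A₂
      X₂ = F₂ i₂ ∩ ∁ A₁
      X = X₁ ∪ X₂
      b∈X₁ : b ∈ X₁
      b∈X₁ = x∈p∩q⁺ (b∈₁ , x∉p⇒x∈∁p b∉A₂)
      b∈X₂ : b ∈ X₂
      b∈X₂ = x∈p∩q⁺ (b∈₂ , x∉p⇒x∈∁p b∉A₁)
      in₁ : ∀ {v} → v ∈ X₁ → v ∈ F₁ i₁ × v ∉ A₂
      in₁ v∈ = let p , q = x∈p∩q⁻ (F₁ i₁) (∁ A₂) v∈ in p , x∈∁p⇒x∉p q
      in₂ : ∀ {v} → v ∈ X₂ → v ∈ F₂ i₂ × v ∉ A₁
      in₂ v∈ = let p , q = x∈p∩q⁻ (F₂ i₂) (∁ A₁) v∈ in p , x∈∁p⇒x∉p q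
      -- The centre `b` is adjacent to the rest of the cutset, so the class of `b` meets the cutset
      -- in `b` alone.
      only₁ : ∀ {v} → v ∈ X₁ → v ∈ A₁ ⊎ v ∈ X₂
      only₁ {v} v∈ with v ∈? A₁ | v ≟ b
      ... | yes p | _ = inj₁ p
      ... | no _ | yes refl = inj₂ b∈X₂
      ... | no p | no v≢b = contradiction (star v p (proj₂ (in₁ v∈)) v≢b) (st₁ i₁ b v b∈₁ (proj₁ (in₁ v∈)))
      only₂ : ∀ {v} → v ∈ X₂ → v ∈ A₂ ⊎ v ∈ X₁
      only₂ {v} v∈ with v ∈? A₂ | v ≟ b
      ... | yes p | _ = inj₁ p
      ... | no _ | yes refl = inj₂ b∈X₁
      ... | no p | no v≢b = contradiction (star v (proj₂ (in₂ v∈)) p v≢b) (st₂ i₂ b v b∈₂ (proj₁ (in₂ v∈)))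
      cross : ∀ u v → u ∈ X₁ → v ∈ X₂ → ¬ Adj G u v
      cross u v u∈ v∈ with only₁ u∈ | only₂ v∈
      ... | inj₂ u∈₂ | _ = st₂ i₂ u v (proj₁ (in₂ u∈₂)) (proj₁ (in₂ v∈))
      ... | inj₁ _ | inj₂ v∈₁ = st₁ i₁ u v (proj₁ (in₁ u∈)) (proj₁ (in₁ v∈₁))
      ... | inj₁ p | inj₁ q = anti u v p q
      stX : Stable G X
      stX u v u∈ v∈ with x∈p∪q⁻ X₁ X₂ u∈ | x∈p∪q⁻ X₁ X₂ v∈
      ... | inj₁ p | inj₁ q = st₁ i₁ u v (proj₁ (in₁ p)) (proj₁ (in₁ q))
      ... | inj₁ p | inj₂ q = cross u v p q
      ... | inj₂ p | inj₁ q = cross v u q p ∘ adj-sym G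
      ... | inj₂ p | inj₂ q = st₂ i₂ u v (proj₁ (in₂ p)) (proj₁ (in₂ q))
      split : ∀ v → χ ⊤ v ≤ χ X v + χ (∁ X) v
      split v with v ∈? X
      ... | yes _ = ≤-trans (χ≤1 ⊤ v) (m≤m+n 1 _)
      ... | no v∉ = χ-≤ λ _ → x∉p⇒x∈∁p v∉
      ∁X≢⊤ : ∁ X ≢ ⊤
      ∁X≢⊤ eq = x∈∁p⇒x∉p (subst (b ∈_) (sym eq) ∈⊤) (x∈p∪q⁺ (inj₁ b∈X₁))
      colour-removed : ∀ A (F : Fin (suc k) → Subset n) → (∀ i → Stable G (F i)) → (∀ v → χ (∁ A) v ≤ sum λ i → χ (F i) v) →
        ∀ i → F i ∩ ∁ A ⊆ X → ∀ {K} → IsClique G K → (∀ {v} → v ∈ K → v ∈ ∁ A) → weight (χ (∁ X)) K ≤ k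
      colour-removed A F st cv i X⊇ {K} cl K⊆ = clique-weight≤-all {G = G} (F ∘ punchIn i) (st ∘ punchIn i) cl covered
        where
        covered : ∀ v → v ∈ K → χ (∁ X) v ≤ sum λ j → χ (F (punchIn i j)) v
        covered v v∈K with v ∈? ∁ X
        ... | no _ = z≤n
        ... | yes v∈ = ≤-trans (≤-reflexive (sym (χ-in (K⊆ v∈K)))) (≤-trans (cv v)
                (≤-reflexive (trans (sum-remove {i = i} (λ j → χ (F j) v)) (cong (_+ sum (λ j → χ (F (punchIn i j)) v)) (χ-out v∉Fi)))))
          where
          v∉Fi : v ∉ F i
          v∉Fi p = x∈∁p⇒x∉p v∈ (X⊇ (x∈p∩q⁺ (p , K⊆ v∈K)))
      -- No clique meets both `A₁` and `A₂`. It is therefore coloured by one of the two covers, of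
      -- which the class of `b` is no longer used outside `X`.
      bound : CliqueBound G (χ (∁ X)) k
      bound K cl with nonempty? (K ∩ A₂)
      ... | no empty = colour-removed A₂ F₁ st₁ cv₁ i₁ (p⊆p∪q X₂) cl
              (λ {v} v∈ → x∉p⇒x∈∁p λ v∈A → empty (v , x∈p∩q⁺ (v∈ , v∈A)))
      ... | yes (y , y∈) = colour-removed A₁ F₂ st₂ cv₂ i₂ (q⊆p∪q X₁ X₂) cl
              (λ {v} v∈ → x∉p⇒x∈∁p λ v∈A → let y∈K , y∈A = x∈p∩q⁻ K A₂ y∈ in
                 anti v y v∈A y∈A (cl v y v∈ y∈K λ { refl → disjoint-⊥ A₁₂ v∈A y∈A }))

singleton-weight : ∀ {n} (K : Subset n) z → sum (λ v → χ K v * χ ⁅ z ⁆ v) ≡ χ K z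
singleton-weight {n} K z = trans (weight-χ ⁅ z ⁆ K) (by (z ∈? K))
  where
  by : (d : Dec (z ∈ K)) → ∣ K ∩ ⁅ z ⁆ ∣ ≡ indicator d
  by (yes z∈) = trans (cong ∣_∣ (⊆-antisym (p∩q⊆q K ⁅ z ⁆) λ {x} x∈ →
    x∈p∩q⁺ (subst (_∈ K) (sym (x∈⁅y⁆⇒x≡y z x∈)) z∈ , x∈))) (∣⁅x⁆∣≡1 z)
  by (no z∉) = trans (cong ∣_∣ (Empty-unique λ (x , x∈) → let p , q = x∈p∩q⁻ K ⁅ z ⁆ x∈ in
    z∉ (subst (_∈ K) (x∈⁅y⁆⇒x≡y z q) p))) (∣⊥∣≡0 n)

-- Giving z the weight k − s forces the vertices of B onto s of the k colours;
-- U consists of the vertices of S covered by those colours.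
apex-split : ∀ {n} (H : Graph n) (S B K₀ : Subset n) z k → z ∉ S → B ⊆ S →
  (∀ v → v ∈ B → Adj H z v) → (∀ v → v ∈ S → Adj H z v → v ∈ B) →
  K₀ ⊆ B → IsClique H K₀ → (∀ K → K ⊆ B → IsClique H K → ∣ K ∣ ≤ ∣ K₀ ∣) →
  (∀ K → K ⊆ S → IsClique H K → ∣ K ∣ ≤ k) → (∀ T → T ⊆ S ∪ ⁅ z ⁆ → PerfectOn H T) →
  ∃[ U ] U ⊆ S × B ⊆ U × (∀ v → v ∈ U → (∀ u → u ∈ B → Adj H v u) → 𝟘)
    × (∀ K → K ⊆ U → IsClique H K → ∣ K ∣ ≤ ∣ K₀ ∣)
    × (∀ K → K ⊆ S → (∀ v → v ∈ K → v ∉ U) → IsClique H K → ∣ K ∣ ≤ k ∸ ∣ K₀ ∣)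
apex-split {n} H S B K₀ z k z∉S B⊆S zB Bz K₀⊆B clK₀ max ω pf =
  U , proj₁ ∘ ∈⟪⟫⁻ U? , B⊆U , avoids , (λ K K⊆U → small-on-J K (λ v v∈ → on-J-U (K⊆U v∈))) , rest
  where
  s t : ℕ
  s = ∣ K₀ ∣
  t = k ∸ s
  s≤k : s ≤ k
  s≤k = ω K₀ (B⊆S ∘ K₀⊆B) clK₀
  w : Weight n
  w v = χ S v + t * χ ⁅ z ⁆ v
  weight-w : ∀ K → weight w K ≡ ∣ K ∩ S ∣ + t * χ K z
  weight-w K = begin
    weight w K ≡⟨ sum-cong-≗ {n} (λ v → trans (*-distribˡ-+ (χ K v) (χ S v) _) (cong (χ K v * χ S v +_) (*-swapˡ (χ K v) t _))) ⟩
    sum (λ v → χ K v * χ S v + t * (χ K v * χ ⁅ z ⁆ v)) ≡⟨ ∑-distrib-+ {n} (λ v → χ K v * χ S v) _ ⟩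
    weight (χ S) K + sum (λ v → t * (χ K v * χ ⁅ z ⁆ v)) ≡⟨ cong₂ _+_ (weight-χ S K) (sym (sum-* {n} t _)) ⟩
    ∣ K ∩ S ∣ + t * sum (λ v → χ K v * χ ⁅ z ⁆ v) ≡⟨ cong (λ x → ∣ K ∩ S ∣ + t * x) (singleton-weight K z) ⟩
    ∣ K ∩ S ∣ + t * χ K z ∎
    where
    open ≡-Reasoning
  sub-clique : ∀ {K} → IsClique H K → IsClique H (K ∩ S)
  sub-clique {K} cl u v u∈ v∈ = cl u v (p∩q⊆p K S u∈) (p∩q⊆p K S v∈)
  -- A clique through `z` meets `S` only in `B`, hence in at most `s` vertices, and `s + t = k`.
  bound : CliqueBound H w k
  bound K cl rewrite weight-w K with z ∈? K
  ... | no _ rewrite *-zeroʳ t | +-identityʳ ∣ K ∩ S ∣ = ω (K ∩ S) (p∩q⊆q K S) (sub-clique cl)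
  ... | yes z∈K rewrite *-identityʳ t = ≤-trans (+-monoˡ-≤ t (max (K ∩ S) K∩S⊆B (sub-clique cl))) (≤-reflexive (m+[n∸m]≡n s≤k))
    where
    K∩S⊆B : K ∩ S ⊆ B
    K∩S⊆B {v} v∈ with x∈p∩q⁻ K S v∈
    ... | v∈K , v∈S = Bz v v∈S (cl z v z∈K v∈K λ { refl → z∉S v∈S })
  supp : ∀ v → v ∉ S ∪ ⁅ z ⁆ → w v ≡ 0
  supp v v∉ rewrite χ-out {K = S} (v∉ ∘ p⊆p∪q ⁅ z ⁆) | χ-out {K = ⁅ z ⁆} (v∉ ∘ q⊆p∪q S ⁅ z ⁆) = *-zeroʳ t
  cover : Cover H w k
  cover = perfect⇒cover {G = H} (S ∪ ⁅ z ⁆) pf w k supp bound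
  F = proj₁ cover
  st = proj₁ (proj₂ cover)
  cv = proj₂ (proj₂ cover)
  -- `J′` marks the colours that `z` receives, `J` the others. The weight of `z` makes the former at
  -- least `t`, so at most `s` remain; vertices of `B`, being adjacent to `z`, have only colours of
  -- the latter kind.
  J′ J : Fin k → ℕ
  J′ j = χ (F j) z
  J j = 1 ∸ χ (F j) z
  J+J′ : sum J + sum J′ ≡ k
  J+J′ = trans (sym (∑-distrib-+ {k} J J′)) (trans (sum-cong-≗ {k} λ j → m∸n+n≡m (χ≤1 (F j) z)) (sum-ones k))
  t≤J′ : t ≤ sum J′
  t≤J′ = ≤-trans (≤-reflexive (trans (sym (*-identityʳ t)) (cong (t *_) (sym (χ-in (x∈⁅x⁆ z)))))) (≤-trans (m≤n+m _ (χ S z)) (cv z))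
  J≤s : sum J ≤ s
  J≤s = +-cancelʳ-≤ t (sum J) s (≤-trans (+-monoʳ-≤ (sum J) t≤J′) (≤-reflexive (trans J+J′ (sym (m+[n∸m]≡n s≤k)))))
  on-J : Fin n → ℕ
  on-J v = sum λ j → J j * χ (F j) v
  U? = λ v → (v ∈? S) ×-dec (1 ≤? on-J v)
  U : Subset n
  U = ⟪ U? ⟫
  S-covered : ∀ {v} → v ∈ S → 1 ≤ sum λ j → χ (F j) v
  S-covered {v} v∈S = ≤-trans (≤-trans (≤-reflexive (sym (χ-in v∈S))) (m≤m+n _ _)) (cv v)
  split : ∀ v → sum (λ j → χ (F j) v) ≡ on-J v + sum (λ j → J′ j * χ (F j) v)
  split v = trans (sum-cong-≗ {k} λ j → trans (sym (*-identityˡ _)) (trans (cong (_* χ (F j) v) (sym (m∸n+n≡m (χ≤1 (F j) z)))) (*-distribʳ-+ (χ (F j) v) (J j) (J′ j))))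
    (∑-distrib-+ {k} (λ j → J j * χ (F j) v) _)
  B⊆U : B ⊆ U
  B⊆U {v} v∈B = ∈⟪⟫⁺ U? (B⊆S v∈B , ≤-trans (S-covered (B⊆S v∈B)) (sum-mono {k} term))
    where
    term : ∀ j → χ (F j) v ≤ J j * χ (F j) v
    term j with v ∈? F j | z ∈? F j
    ... | no _  | _     = z≤n
    ... | yes _ | no _  = s≤s z≤n
    ... | yes p | yes q = contradiction (zB v v∈B) (st j z v q p)
  small-on-J : ∀ K → (∀ v → v ∈ K → 1 ≤ on-J v) → IsClique H K → ∣ K ∣ ≤ s
  small-on-J K h cl = ≤-trans (≤-reflexive (sym (weight-χ-⊆ {T = K} ⊆-refl)))
    (≤-trans (clique-weight≤ {G = H} F st J cl (λ v v∈ → ≤-trans (χ≤1 K v) (h v v∈))) J≤s)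
  on-J-U : ∀ {v} → v ∈ U → 1 ≤ on-J v
  on-J-U = proj₂ ∘ ∈⟪⟫⁻ U?
  -- The clique `K₀` needs `s` colours not given to `z`, so there are exactly `s` of these and `t`
  -- of the others.
  s≤J : s ≤ sum J
  s≤J = ≤-trans (≤-reflexive (sym (weight-χ-⊆ {T = K₀} ⊆-refl)))
    (clique-weight≤ {G = H} F st J clK₀ (λ v v∈ → ≤-trans (χ≤1 K₀ v) (on-J-U (B⊆U (K₀⊆B v∈)))))
  J′≤t : sum J′ ≤ t
  J′≤t = +-cancelˡ-≤ s (sum J′) t (≤-trans (+-monoˡ-≤ (sum J′) s≤J) (≤-reflexive (trans J+J′ (sym (m+[n∸m]≡n s≤k)))))
  -- Such a `v` would enlarge `K₀` to a clique of size `s + 1` that is covered by `s` colours.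
  avoids : ∀ v → v ∈ U → (∀ u → u ∈ B → Adj H v u) → 𝟘
  avoids v v∈U vB = <⇒≱ (p⊂q⇒∣p∣<∣q∣ (p⊆p∪q ⁅ v ⁆ , v , x∈p∪q⁺ (inj₂ (x∈⁅x⁆ v)) , v∉K₀))
      (small-on-J (K₀ ∪ ⁅ v ⁆) covered clK)
    where
    v∉K₀ : v ∉ K₀
    v∉K₀ p = adj-irrefl H refl (vB v (K₀⊆B p))
    covered : ∀ u → u ∈ K₀ ∪ ⁅ v ⁆ → 1 ≤ on-J u
    covered u u∈ with x∈p∪q⁻ K₀ ⁅ v ⁆ u∈
    ... | inj₁ p = on-J-U (B⊆U (K₀⊆B p))
    ... | inj₂ p rewrite x∈⁅y⁆⇒x≡y v p = on-J-U v∈U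
    clK : IsClique H (K₀ ∪ ⁅ v ⁆)
    clK a b a∈ b∈ a≢b with x∈p∪q⁻ K₀ ⁅ v ⁆ a∈ | x∈p∪q⁻ K₀ ⁅ v ⁆ b∈
    ... | inj₁ p | inj₁ q = clK₀ a b p q a≢b
    ... | inj₁ p | inj₂ q rewrite x∈⁅y⁆⇒x≡y v q = adj-sym H (vB a (K₀⊆B p))
    ... | inj₂ p | inj₁ q rewrite x∈⁅y⁆⇒x≡y v p = vB b (K₀⊆B q)
    ... | inj₂ p | inj₂ q = contradiction (trans (x∈⁅y⁆⇒x≡y v p) (sym (x∈⁅y⁆⇒x≡y v q))) a≢b
  rest : ∀ K → K ⊆ S → (∀ v → v ∈ K → v ∉ U) → IsClique H K → ∣ K ∣ ≤ t
  rest K K⊆S K∉U cl = ≤-trans (≤-reflexive (sym (weight-χ-⊆ {T = K} ⊆-refl)))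
    (≤-trans (clique-weight≤ {G = H} F st J′ cl covered) J′≤t)
    where
    covered : ∀ v → v ∈ K → χ K v ≤ sum λ j → J′ j * χ (F j) v
    covered v v∈ with on-J v in eq
    ... | suc _ = contradiction (∈⟪⟫⁺ U? (K⊆S v∈ , ≤-trans (s≤s z≤n) (≤-reflexive (sym eq)))) (K∉U v v∈)
    ... | zero = ≤-trans (χ≤1 K v) (≤-trans (S-covered (K⊆S v∈)) (≤-reflexive (trans (split v) (cong (_+ sum (λ j → J′ j * χ (F j) v)) eq))))

-- Attaching a vertex

Near : ℕ → ℕ → ℕ → Set
Near k a b = ∣ a - b ∣ ≡ 1 ⊎ suc ∣ a - b ∣ ≡ k

-- Stated for any relation, so that rotation serves holes and antiholes alike.
Cyclic : ∀ {k n} → (Fin n → Fin n → Set) → Fin k ↣ Fin n → Set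
Cyclic {k} R f = ∀ i j → R (Injection.to f i) (Injection.to f j) ⇔ Near k (toℕ i) (toℕ j)

next : ∀ {m} → Fin (suc m) → Fin (suc m)
next {m} i with m ℕₚ.≟ toℕ i
... | yes _ = zero
... | no m≢i = suc (lower₁ i m≢i)

next-suc : ∀ {m} (i : Fin (suc m)) → m ≢ toℕ i → toℕ (next i) ≡ suc (toℕ i)
next-suc {m} i neq with m ℕₚ.≟ toℕ i
... | yes eq = contradiction eq neq
... | no m≢i = cong suc (toℕ-lower₁ i m≢i)

-- When a position wraps from `m` to 0, an ordinary edge and the closing edge change roles.
near-wrap : ∀ m a → a ≤ m → Near (suc m) m a ⇔ Near (suc m) 0 (suc a)
near-wrap m a a≤m rewrite ∣-∣-comm m a | m≤n⇒∣m-n∣≡n∸m a≤m = mk⇔ to from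
  where
  d = m ∸ a
  m≡ : d + a ≡ m
  m≡ = m∸n+n≡m a≤m
  to : d ≡ 1 ⊎ suc d ≡ suc m → suc a ≡ 1 ⊎ suc (suc a) ≡ suc m
  to (inj₁ d≡1) = inj₂ (cong suc (trans (cong (_+ a) (sym d≡1)) m≡))
  to (inj₂ eq) = inj₁ (cong suc (+-cancelˡ-≡ d a 0 (trans m≡ (trans (sym (ℕₚ.suc-injective eq)) (sym (+-identityʳ d))))))
  from : suc a ≡ 1 ⊎ suc (suc a) ≡ suc m → d ≡ 1 ⊎ suc d ≡ suc m
  from (inj₁ a≡0) = inj₂ (cong suc (trans (sym (+-identityʳ d)) (trans (cong (d +_) (sym (ℕₚ.suc-injective a≡0))) m≡)))
  from (inj₂ eq) = inj₁ (+-cancelʳ-≡ a d 1 (trans m≡ (sym (ℕₚ.suc-injective eq))))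

near-sym : ∀ {k} a b → Near k a b → Near k b a
near-sym a b = subst (λ d → d ≡ 1 ⊎ suc d ≡ _) (∣-∣-comm a b)

near-next : ∀ {m} (i j : Fin (suc m)) → Near (suc m) (toℕ i) (toℕ j) ⇔ Near (suc m) (toℕ (next i)) (toℕ (next j))
near-next {m} i j with m ℕₚ.≟ toℕ i | m ℕₚ.≟ toℕ j
... | yes p | yes q rewrite sym p | sym q | ∣n-n∣≡0 m = mk⇔ id id
... | yes p | no ¬q rewrite toℕ-lower₁ j ¬q | sym p = near-wrap m (toℕ j) (≤-pred (toℕ<n j))
... | no ¬p | yes q rewrite toℕ-lower₁ i ¬p | sym q =
  mk⇔ (near-sym 0 (suc (toℕ i)) ∘ Equivalence.to e ∘ near-sym (toℕ i) m)
      (near-sym m (toℕ i) ∘ Equivalence.from e ∘ near-sym (suc (toℕ i)) 0)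
  where e = near-wrap m (toℕ i) (≤-pred (toℕ<n i))
... | no ¬p | no ¬q rewrite toℕ-lower₁ i ¬p | toℕ-lower₁ j ¬q = mk⇔ id id

next-injective : ∀ {m} {i j : Fin (suc m)} → next i ≡ next j → i ≡ j
next-injective {m} {i} {j} eq with m ℕₚ.≟ toℕ i | m ℕₚ.≟ toℕ j
... | yes p | yes q = toℕ-injective (trans (sym p) q)
... | no ¬p | no ¬q = toℕ-injective (trans (sym (toℕ-lower₁ i ¬p)) (trans (cong toℕ (suc-injective eq)) (toℕ-lower₁ j ¬q)))

-- Brings a chosen vertex of the cycle to position 0, from where `Unhook` removes it.
rotate : ∀ {m n} {R : Fin n → Fin n → Set} (f : Fin (suc m) ↣ Fin n) → Cyclic R f → ∀ i →
  Σ[ g ∈ Fin (suc m) ↣ Fin n ] Cyclic R g × Injection.to g zero ≡ Injection.to f i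
    × (∀ j → ∃[ j′ ] Injection.to g j ≡ Injection.to f j′)
rotate {m} {n} {R} f cyc i = go (toℕ i) f cyc i refl
  where
  go : ∀ p (f : Fin (suc m) ↣ Fin n) → Cyclic R f → ∀ i → toℕ i ≡ p →
    Σ[ g ∈ Fin (suc m) ↣ Fin n ] Cyclic R g × Injection.to g zero ≡ Injection.to f i
      × (∀ j → ∃[ j′ ] Injection.to g j ≡ Injection.to f j′)
  go zero f cyc zero eq = f , cyc , refl , λ j → j , refl
  go (suc p) f cyc (suc i) eq with go p (mk↣ (next-injective ∘ Injection.injective f))
      (λ a b → ⇔-sym (near-next a b) ⇔-∘ cyc (next a) (next b))
      (inject₁ i) (trans (toℕ-inject₁ i) (ℕₚ.suc-injective eq))
  ... | g , cycg , g0 , range = g , cycg , trans g0 (cong (Injection.to f) (toℕ-injective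
          (trans (next-suc (inject₁ i) neq) (cong suc (toℕ-inject₁ i))))) , λ j → let j′ , e = range j in next j′ , e
    where
    neq : m ≢ toℕ (inject₁ i)
    neq e = <-irrefl (sym (trans e (toℕ-inject₁ i))) (toℕ<n i)

gap≤ : ∀ {m} (i j : Fin (suc m)) → ∣ toℕ i - toℕ j ∣ ≤ m
gap≤ i j = ≤-trans (∣m-n∣≤m⊔n (toℕ i) (toℕ j)) (⊔-lub (≤-pred (toℕ<n i)) (≤-pred (toℕ<n j)))

tail↣ : ∀ {m n} → Fin (suc m) ↣ Fin n → Fin m ↣ Fin n
tail↣ f = mk↣ (suc-injective ∘ Injection.injective f)

module Unhook {m n : ℕ} {R : Fin n → Fin n → Set} (f : Fin (suc (suc m)) ↣ Fin n) (cyc : Cyclic R f) where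
  private
    to = Injection.to f

  path : ∀ i j → R (to (suc i)) (to (suc j)) ⇔ ∣ toℕ i - toℕ j ∣ ≡ 1
  path i j = mk⇔ (λ r → case Equivalence.to (cyc (suc i) (suc j)) r of λ where
      (inj₁ e) → e
      (inj₂ e) → contradiction (≤-trans (≤-reflexive (sym (ℕₚ.suc-injective e))) (gap≤ i j)) 1+n≰n)
    (Equivalence.from (cyc (suc i) (suc j)) ∘ inj₁)

  first : R (to zero) (to (suc zero))
  first = Equivalence.from (cyc zero (suc zero)) (inj₁ refl)

  final : R (to zero) (to (suc (fromℕ m)))
  final = Equivalence.from (cyc zero (suc (fromℕ m))) (inj₂ (cong (2 +_) (toℕ-fromℕ m)))

  middle : ∀ i → i ≢ zero → i ≢ fromℕ m → ¬ R (to zero) (to (suc i))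
  middle i i≢0 i≢m r with Equivalence.to (cyc zero (suc i)) r
  ... | inj₁ e = i≢0 (toℕ-injective (ℕₚ.suc-injective e))
  ... | inj₂ e = i≢m (toℕ-injective (trans (ℕₚ.suc-injective (ℕₚ.suc-injective e)) (sym (toℕ-fromℕ m))))

-- An existing vertex `z` is given the neighbourhood `B`, instead of adding a new vertex. The vertex
-- set stays `Fin n`, so minimality applies to every proper subset.
attach : ∀ {n} → Graph n → (z : Fin n) (B : Subset n) → z ∉ B → Graph n
attach {n} G z B z∉B = record
  { Adj = Adj′
  ; adj-sym = λ where
      (inj₁ p) → inj₂ (inj₁ p)
      (inj₂ (inj₁ p)) → inj₁ p
      (inj₂ (inj₂ (u , v , p))) → inj₂ (inj₂ (v , u , adj-sym G p))
  ; adj-irrefl = λ where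
      refl (inj₁ (refl , p)) → z∉B p
      refl (inj₂ (inj₁ (refl , p))) → z∉B p
      refl (inj₂ (inj₂ (_ , _ , p))) → adj-irrefl G refl p
  ; adj? = λ u v → ((u ≟ z) ×-dec (v ∈? B)) ⊎-dec (((v ≟ z) ×-dec (u ∈? B)) ⊎-dec (¬? (u ≟ z) ×-dec (¬? (v ≟ z) ×-dec adj? G u v)))
  }
  where
  Adj′ : Fin n → Fin n → Set
  Adj′ u v = (u ≡ z × v ∈ B) ⊎ (v ≡ z × u ∈ B) ⊎ (u ≢ z × v ≢ z × Adj G u v)

module _ {n : ℕ} (G : Graph n) (z : Fin n) (B₁ : Subset n) (z∉B₁ : z ∉ B₁) where
  private
    H = attach G z B₁ z∉B₁

  attach-z : ∀ {v} → Adj H z v → v ∈ B₁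
  attach-z (inj₁ (_ , v∈)) = v∈
  attach-z (inj₂ (inj₁ (refl , z∈))) = z∈
  attach-z (inj₂ (inj₂ (z≢z , _))) = contradiction refl z≢z

  attach-off : ∀ {u v} → u ≢ z → v ≢ z → Adj H u v ⇔ Adj G u v
  attach-off u≢z v≢z = mk⇔ (λ where
      (inj₁ (p , _)) → contradiction p u≢z
      (inj₂ (inj₁ (p , _))) → contradiction p v≢z
      (inj₂ (inj₂ (_ , _ , uv))) → uv)
    (λ uv → inj₂ (inj₂ (u≢z , v≢z , uv)))

  attach-off-co : ∀ {u v} → u ≢ z → v ≢ z → Adj (complement H) u v ⇔ Adj (complement G) u v
  attach-off-co u≢z v≢z = mk⇔ (λ (p , q) → p , q ∘ Equivalence.from (attach-off u≢z v≢z))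
    (λ (p , q) → p , q ∘ Equivalence.to (attach-off u≢z v≢z))

  module _ (A B₂ S : Subset n) (complete : ∀ u v → u ∈ B₁ → v ∈ B₂ → Adj G u v)
    (S-parts : ∀ {v} → v ∈ S → v ≡ z ⊎ v ∈ A ⊎ v ∈ B₁ ⊎ v ∈ B₂)
    (berge : Berge G) (balanced : Balanced G A B₁) where
    private
      -- Without `z` the hole is an odd path between two vertices of `B₁`. Its interior avoids `B₁`,
      -- since `z` sees only the ends; a vertex of `B₂` inside would be adjacent to both ends, which
      -- makes the hole a four-cycle.
      no-hole : ∀ m → 4 ≤ suc (suc m) → (f : Fin (suc (suc m)) ↣ Fin n) → (∀ i → Injection.to f i ∈ S) →
        Cyclic (Adj H) f → Injection.to f zero ≡ z → Odd (suc (suc m)) → 𝟘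
      no-hole m 4≤ f f∈S cyc refl odd = proj₁ balanced
        (m , tail↣ f , isPath , (λ e → odd (∣m∣n⇒∣m+n ∣-refl e)) , attach-z first , attach-z final , ends , interior)
        where
        open Unhook {R = Adj H} f cyc
        to = Injection.to f
        off : ∀ i → to (suc i) ≢ to zero
        off i eq = contradiction (Injection.injective f eq) λ ()
        pathG : ∀ i j → Adj G (to (suc i)) (to (suc j)) ⇔ ∣ toℕ i - toℕ j ∣ ≡ 1
        pathG i j = path i j ⇔-∘ ⇔-sym (attach-off (off i) (off j))
        isPath : IsPath (induced G (tail↣ f))
        isPath = pathG
        ends : ¬ Adj G (to (suc zero)) (to (suc (fromℕ m)))
        ends e = contradiction (subst (2 ≤_) (trans (sym (toℕ-fromℕ m)) (Equivalence.to (pathG zero (fromℕ m)) e)) (≤-pred (≤-pred 4≤))) λ { (s≤s ()) }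
        interior : InteriorIn (tail↣ f) A
        interior i i≢0 i≢m with S-parts (f∈S (suc i))
        ... | inj₁ eq = contradiction eq (off i)
        ... | inj₂ (inj₁ p) = p
        ... | inj₂ (inj₂ (inj₁ p)) = contradiction (inj₁ (refl , p)) (middle i i≢0 i≢m)
        ... | inj₂ (inj₂ (inj₂ p)) = contradiction (divides 2 (cong (2 +_) (two i at0 (trans (cong (∣_-_∣ (toℕ i)) (sym (toℕ-fromℕ m))) atm)))) odd
          where
          at0 : ∣ 0 - toℕ i ∣ ≡ 1
          at0 = Equivalence.to (pathG zero i) (complete _ _ (attach-z first) p)
          atm : ∣ toℕ i - toℕ (fromℕ m) ∣ ≡ 1
          atm = Equivalence.to (pathG i (fromℕ m)) (adj-sym G (complete _ _ (attach-z final) p))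
          two : ∀ i → toℕ i ≡ 1 → ∣ toℕ i - m ∣ ≡ 1 → m ≡ 2
          two i e1 e2 rewrite e1 = go m (≤-pred (≤-pred 4≤)) e2
            where
            go : ∀ m → 2 ≤ m → ∣ 1 - m ∣ ≡ 1 → m ≡ 2
            go (suc m) _ e = cong suc e

      -- Without `z` the antihole is an odd antipath. Its interior is adjacent to `z`, hence in
      -- `B₁`; each end is nonadjacent to `z` and to an interior vertex, hence neither in `B₁` nor
      -- in `B₂`.
      no-antihole : ∀ m → 4 ≤ suc (suc m) → (f : Fin (suc (suc m)) ↣ Fin n) → (∀ i → Injection.to f i ∈ S) →
        Cyclic (Adj (complement H)) f → Injection.to f zero ≡ z → Odd (suc (suc m)) → 𝟘
      no-antihole zero (s≤s (s≤s ()))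
      no-antihole (suc zero) (s≤s (s≤s (s≤s ())))
      no-antihole (suc (suc m)) _ f f∈S cyc refl odd = proj₂ balanced
        (suc (suc m) , tail↣ f , isPath , (λ e → odd (∣m∣n⇒∣m+n ∣-refl e)) ,
          end zero first (suc zero) (λ ()) (λ ()) refl ,
          -- `suc (inject₁ (fromℕ m))` is position `m + 1`, the last but one of the antipath.
          end (fromℕ (suc (suc m))) final (suc (inject₁ (fromℕ m))) (λ ()) before-last before-gap , adjacent , interior)
        where
        open Unhook {R = Adj (complement H)} f cyc
        to = Injection.to f
        off : ∀ i → to (suc i) ≢ to zero
        off i eq = contradiction (Injection.injective f eq) λ ()
        pathG : ∀ i j → Adj (complement G) (to (suc i)) (to (suc j)) ⇔ ∣ toℕ i - toℕ j ∣ ≡ 1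
        pathG i j = path i j ⇔-∘ ⇔-sym (attach-off-co (off i) (off j))
        isPath : IsPath (complement (induced G (tail↣ f)))
        isPath i j = pathG i j ⇔-∘ induced-co G (tail↣ f) i j
        interior : InteriorIn (tail↣ f) B₁
        interior i i≢0 i≢m = attach-z (adj-stable H λ ¬a → middle i i≢0 i≢m (off i ∘ sym , ¬a))
        adjacent : Adj G (to (suc zero)) (to (suc (fromℕ (suc (suc m)))))
        adjacent = adj-stable G λ ¬a → contradiction
          (Equivalence.to (pathG zero (fromℕ (suc (suc m)))) ((λ e → contradiction (Injection.injective f e) λ ()) , ¬a)) λ ()
        before-last : suc (inject₁ (fromℕ m)) ≢ fromℕ (suc (suc m))
        before-last e = contradiction (trans (sym (trans (toℕ-inject₁ (fromℕ m)) (toℕ-fromℕ m))) (trans (cong toℕ (suc-injective e)) (toℕ-fromℕ (suc m)))) λ ()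
        before-gap : ∣ toℕ (fromℕ (suc (suc m))) - suc (toℕ (inject₁ (fromℕ m))) ∣ ≡ 1
        before-gap rewrite toℕ-inject₁ (fromℕ m) | toℕ-fromℕ m = trans (m≤n⇒∣n-m∣≡n∸m (n≤1+n m)) (m+n∸n≡m 1 m)
        end : ∀ i → Adj (complement H) (to zero) (to (suc i)) → ∀ j → j ≢ zero → j ≢ fromℕ (suc (suc m)) →
          ∣ toℕ i - toℕ j ∣ ≡ 1 → to (suc i) ∈ A
        end i (_ , ¬zi) j j≢0 j≢m gap with S-parts (f∈S (suc i))
        ... | inj₁ eq = contradiction eq (off i)
        ... | inj₂ (inj₁ p) = p
        ... | inj₂ (inj₂ (inj₁ p)) = contradiction (inj₁ (refl , p)) ¬zi
        ... | inj₂ (inj₂ (inj₂ p)) = contradiction (adj-sym G (complete _ _ (interior j j≢0 j≢m) p))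
                (proj₂ (Equivalence.from (pathG i j) gap))

      even-or : ∀ {m} → (Odd m → 𝟘) → Even m
      even-or {m} = decidable-stable (2 ∣? m)

    attach-berge : BergeOn H S
    attach-berge = hole , antihole
      where
      hole : ∀ k → 4 ≤ k → (f : Fin k ↣ Fin n) → (∀ i → Injection.to f i ∈ S) → IsCycle (induced H f) → Even k
      hole k 4≤k f f∈S cyc with any? (λ i → Injection.to f i ≟ z)
      ... | no avoid = proj₁ berge k (4≤k , f , λ i j → cyc i j ⇔-∘ ⇔-sym (attach-off (λ e → avoid (i , e)) (λ e → avoid (j , e))))
      hole (suc zero) (s≤s ()) f f∈S cyc | yes (i , eq)
      hole (suc (suc m)) 4≤k f f∈S cyc | yes (i , eq) with rotate {R = Adj H} f cyc i
      ... | g , cycg , g0 , range = even-or (no-hole m 4≤k g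
              (λ j → let j′ , e = range j in subst (_∈ S) (sym e) (f∈S j′)) cycg (trans g0 eq))
      antihole : ∀ k → 4 ≤ k → (f : Fin k ↣ Fin n) → (∀ i → Injection.to f i ∈ S) → IsCycle (complement (induced H f)) → Even k
      antihole k 4≤k f f∈S cyc with any? (λ i → Injection.to f i ≟ z)
      ... | no avoid = proj₂ berge k (4≤k , f , λ i j → cyc i j ⇔-∘ ((⇔-sym (induced-co H f i j) ⇔-∘ ⇔-sym (attach-off-co (λ e → avoid (i , e)) (λ e → avoid (j , e)))) ⇔-∘ induced-co G f i j))
      antihole (suc zero) (s≤s ()) f f∈S cyc | yes (i , eq)
      antihole (suc (suc m)) 4≤k f f∈S cyc | yes (i , eq)
        with rotate {R = Adj (complement H)} f (λ a b → cyc a b ⇔-∘ ⇔-sym (induced-co H f a b)) i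
      ... | g , cycg , g0 , range = even-or (no-antihole m 4≤k g
              (λ j → let j′ , e = range j in subst (_∈ S) (sym e) (f∈S j′)) cycg (trans g0 eq))

-- Combining the colourings of the two sides.

-- A vertex carries two bits: the first tells A from B, the second tells the
-- two halves of A, respectively of B, apart.
Quarter : Set
Quarter = Bool × Bool

pattern A₁ = true , true
pattern A₂ = true , false
pattern B₁ = false , true
pattern B₂ = false , false

_≟q_ : (p q : Quarter) → Dec (p ≡ q)
_≟q_ = ≡-dec 𝔹ₚ._≟_ 𝔹ₚ._≟_

module _ {n : ℕ} (G : Graph n) (quarter : Fin n → Quarter) where

  part : Quarter → Subset n
  part q = ⟪ (λ v → quarter v ≟q q) ⟫

  part⁺ : ∀ {q v} → quarter v ≡ q → v ∈ part q
  part⁺ {q} = ∈⟪⟫⁺ (λ v → quarter v ≟q q)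

  part⁻ : ∀ {q v} → v ∈ part q → quarter v ≡ q
  part⁻ {q} = ∈⟪⟫⁻ (λ v → quarter v ≟q q)

  part-disjoint : ∀ {p q} → p ≢ q → part p ∩ part q ≡ ⊥
  part-disjoint {p} {q} p≢q = Empty-unique λ (x , x∈) → let a , b = x∈p∩q⁻ (part p) (part q) x∈ in
    p≢q (trans (sym (part⁻ a)) (part⁻ b))

  -- Each side A_i ∪ B, extended by a vertex z of the other half of A whose
  -- neighbourhood is changed to B₁, is Berge and smaller than G.
  no-balanced-quartering : MinimumImperfect G →
    (∀ q → ∃[ v ] quarter v ≡ q) →
    (∀ u v → quarter u ≡ A₁ → quarter v ≡ A₂ → ¬ Adj G u v) →
    (∀ u v → quarter u ≡ B₁ → quarter v ≡ B₂ → Adj G u v) →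
    (A B : Subset n) → (∀ v → proj₁ (quarter v) ≡ true → v ∈ A) → (∀ v → quarter v ≡ B₁ → v ∈ B) →
    Balanced G A B → 𝟘
  no-balanced-quartering mi inhabited anti complete A B A∋ B∋ (no-path , no-antipath) =
    two-in true λ z₁ → two-in false λ z₂ →
    minimal-proper G mi λ proper → smaller true z₁ λ pf₁ → smaller false z₂ λ pf₂ →
    not-perfectOn-⊤ G mi proper (colour proper z₁ pf₁ z₂ pf₂)
    where
    anti′ : ∀ i u v → quarter u ≡ (true , i) → quarter v ≡ (true , not i) → ¬ Adj G u v
    anti′ true  u v p q = anti u v p q
    anti′ false u v p q = anti v u q p ∘ adj-sym G

    Two : Bool → Set
    Two i = ∃₂ λ z z′ → quarter z ≡ (true , i) × quarter z′ ≡ (true , i) × z′ ≢ z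

    two-in : ∀ i → (Two i → 𝟘) → 𝟘
    two-in i k with inhabited (true , i)
    ... | z , zi with any? (λ z′ → (quarter z′ ≟q (true , i)) ×-dec ¬? (z′ ≟ z))
    ...   | yes (z′ , z′i , z′≢z) = k (z , z′ , zi , z′i , z′≢z)
    -- In the complement no edge joins `B₁` to `B₂`, and `z`, alone in its half of `A`, is adjacent
    -- to the whole other half, which is all that remains.
    ...   | no alone = no-star-cutset (complement G) (minimumImperfect-co G mi) (part B₁) (part B₂) z
              (let v , e = inhabited B₁ in v , part⁺ e) (let v , e = inhabited B₂ in v , part⁺ e)
              (part-disjoint λ ()) (λ z∈ → contradiction (trans (sym zi) (part⁻ z∈)) λ ()) (λ z∈ → contradiction (trans (sym zi) (part⁻ z∈)) λ ())
              (λ u v u∈ v∈ (_ , ¬uv) → ¬uv (complete u v (part⁻ u∈) (part⁻ v∈)))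
              (λ c c∉₁ c∉₂ c≢z → (c≢z ∘ sym) , far c c≢z (quarter c) refl c∉₁ c∉₂)
      where
      far : ∀ c → c ≢ z → ∀ q → quarter c ≡ q → c ∉ part B₁ → c ∉ part B₂ → ¬ Adj G z c
      far c c≢z B₁ e c∉₁ c∉₂ = contradiction (part⁺ e) c∉₁
      far c c≢z B₂ e c∉₁ c∉₂ = contradiction (part⁺ e) c∉₂
      far c c≢z (true , j) e c∉₁ c∉₂ with i 𝔹ₚ.≟ j
      ... | yes refl = contradiction (c , e , c≢z) alone
      ... | no i≢j = anti′ i z c zi (trans e (cong (true ,_) (𝔹ₚ.¬-not (i≢j ∘ sym))))

    module Side (i : Bool) (two : Two i) where
      z = proj₁ two
      zi = proj₁ (proj₂ (proj₂ two))
      -- The side omits half `i` of `A`, and a vertex `z` of this very half becomes the apex. A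
      -- second vertex there keeps `S ∪ ⁅ z ⁆` proper.
      S? = λ v → ¬? (quarter v ≟q (true , i))
      S : Subset n
      S = ⟪ S? ⟫
      z∉B₁ : z ∉ part B₁
      z∉B₁ z∈ = contradiction (trans (sym zi) (part⁻ z∈)) λ ()
      z∉S : z ∉ S
      z∉S z∈ = ∈⟪⟫⁻ S? z∈ zi
      H : Graph n
      H = attach G z (part B₁) z∉B₁
      S⁺z≢⊤ : S ∪ ⁅ z ⁆ ≢ ⊤
      S⁺z≢⊤ eq with x∈p∪q⁻ S ⁅ z ⁆ (subst (proj₁ (proj₂ two) ∈_) (sym eq) ∈⊤)
      ... | inj₁ p = ∈⟪⟫⁻ S? p (proj₁ (proj₂ (proj₂ (proj₂ two))))
      ... | inj₂ p = proj₂ (proj₂ (proj₂ (proj₂ two))) (x∈⁅y⁆⇒x≡y z p)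
      parts : ∀ {v} → v ∈ S ∪ ⁅ z ⁆ → v ≡ z ⊎ v ∈ A ⊎ v ∈ part B₁ ⊎ v ∈ part B₂
      parts {v} v∈ with x∈p∪q⁻ S ⁅ z ⁆ v∈
      ... | inj₂ p = inj₁ (x∈⁅y⁆⇒x≡y z p)
      ... | inj₁ _ with quarter v in e
      ...   | true , _ = inj₂ (inj₁ (A∋ v (cong proj₁ e)))
      ...   | B₁ = inj₂ (inj₂ (inj₁ (part⁺ e)))
      ...   | B₂ = inj₂ (inj₂ (inj₂ (part⁺ e)))
      berge : BergeOn H (S ∪ ⁅ z ⁆)
      berge = attach-berge G z (part B₁) z∉B₁ A (part B₂) (S ∪ ⁅ z ⁆)
        (λ u v u∈ v∈ → complete u v (part⁻ u∈) (part⁻ v∈)) parts (proj₁ mi)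
        ((λ (k , f , p , odd , a , b , r) → no-path (k , f , p , odd , B∋ _ (part⁻ a) , B∋ _ (part⁻ b) , r)) ,
         (λ (k , f , p , odd , a , b , c , r) → no-antipath (k , f , p , odd , a , b , c , λ j x y → B∋ _ (part⁻ (r j x y)))))
      off : ∀ {K} → K ⊆ S → ∀ {v} → v ∈ K → v ≢ z
      off K⊆S v∈ refl = z∉S (K⊆S v∈)
      clique-HG : ∀ {K} → K ⊆ S → IsClique H K → IsClique G K
      clique-HG K⊆S cl u v u∈ v∈ u≢v = Equivalence.to (attach-off G z (part B₁) z∉B₁ (off K⊆S u∈) (off K⊆S v∈)) (cl u v u∈ v∈ u≢v)
      clique-GH : ∀ {K} → K ⊆ S → IsClique G K → IsClique H K
      clique-GH K⊆S cl u v u∈ v∈ u≢v = Equivalence.from (attach-off G z (part B₁) z∉B₁ (off K⊆S u∈) (off K⊆S v∈)) (cl u v u∈ v∈ u≢v)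
      B₁⊆S : part B₁ ⊆ S
      B₁⊆S v∈ = ∈⟪⟫⁺ S? λ e → contradiction (trans (sym (part⁻ v∈)) e) λ ()

      Split : Graph n → Subset n → ℕ → Set
      Split H K₀ k = ∃[ U ] U ⊆ S × part B₁ ⊆ U × (∀ v → v ∈ U → (∀ u → u ∈ part B₁ → Adj H v u) → 𝟘)
        × (∀ K → K ⊆ U → IsClique H K → ∣ K ∣ ≤ ∣ K₀ ∣)
        × (∀ K → K ⊆ S → (∀ v → v ∈ K → v ∉ U) → IsClique H K → ∣ K ∣ ≤ k ∸ ∣ K₀ ∣)

      back : ∀ {K₀ k} → Split H K₀ k → Split G K₀ k
      back (U , U⊆S , B⊆U , avoid , small , rest) = U , U⊆S , B⊆U ,
        (λ v v∈ h → avoid v v∈ λ u u∈ → Equivalence.from (attach-off G z (part B₁) z∉B₁ (off U⊆S v∈) (off B₁⊆S u∈)) (h u u∈)) ,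
        (λ K K⊆ cl → small K K⊆ (clique-GH (λ v∈ → U⊆S (K⊆ v∈)) cl)) ,
        (λ K K⊆ K∉ cl → rest K K⊆ K∉ (clique-GH K⊆ cl))

      split : (∀ T → T ⊆ S ∪ ⁅ z ⁆ → PerfectOn H T) → ∀ K₀ k → K₀ ⊆ part B₁ → IsClique G K₀ →
        (∀ K → K ⊆ part B₁ → IsClique G K → ∣ K ∣ ≤ ∣ K₀ ∣) → (∀ K → IsClique G K → ∣ K ∣ ≤ k) → Split G K₀ k
      split pf K₀ k K₀⊆ clK₀ max ω = back {K₀} {k} (apex-split H S (part B₁) K₀ z k z∉S B₁⊆S
          (λ v v∈ → inj₁ (refl , v∈)) (λ v _ → attach-z G z (part B₁) z∉B₁) K₀⊆ (clique-GH (λ v∈ → B₁⊆S (K₀⊆ v∈)) clK₀)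
          (λ K K⊆ cl → max K K⊆ (clique-HG (λ v∈ → B₁⊆S (K⊆ v∈)) cl)) (λ K K⊆ cl → ω K (clique-HG K⊆ cl)) pf)

    smaller : ∀ i (two : Two i) → let open Side i two in ((∀ T → T ⊆ S ∪ ⁅ z ⁆ → PerfectOn H T) → 𝟘) → 𝟘
    smaller i two = minimal-⊆ G mi H (S ∪ ⁅ z ⁆) S⁺z≢⊤ berge
      where open Side i two

    -- No clique meets both halves of `A`, so each lies within one side. There `Y` coincides with
    -- that side's `U`, because both `U₁` and `U₂` contain `B₁` and, by the avoidance property,
    -- neither meets `B₂`.
    combine : (∀ T → T ≢ ⊤ → PerfectOn G T) → (z₁ : Two true) (z₂ : Two false) → ∀ k K₀ → ∣ K₀ ∣ ≤ k →
      Side.Split true z₁ G K₀ k → Side.Split false z₂ G K₀ k → Cover G (χ ⊤) k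
    combine proper z₁ z₂ k K₀ s≤k (U₁ , U₁⊆ , B⊆U₁ , U₁∌ , small₁ , rest₁) (U₂ , U₂⊆ , B⊆U₂ , U₂∌ , small₂ , rest₂) =
      subst (Cover G (χ ⊤)) (m+[n∸m]≡n s≤k) (cover-≤ G both
        (cover-append G s (proper Y Y≢⊤ s boundY) (proper (∁ Y) ∁Y≢⊤ (k ∸ s) bound∁Y)))
      where
      s = ∣ K₀ ∣
      Y : Subset n
      Y = U₁ ∪ U₂
      both : ∀ v → χ ⊤ v ≤ χ Y v + χ (∁ Y) v
      both v with v ∈? Y
      ... | yes _ = ≤-trans (χ≤1 ⊤ v) (m≤m+n 1 _)
      ... | no v∉ = χ-≤ λ _ → x∉p⇒x∈∁p v∉
      Y≢⊤ : Y ≢ ⊤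
      Y≢⊤ eq with inhabited B₂
      ... | v , e with x∈p∪q⁻ U₁ U₂ (subst (v ∈_) (sym eq) ∈⊤)
      ...   | inj₁ p = U₁∌ v p λ u u∈ → adj-sym G (complete u v (part⁻ u∈) e)
      ...   | inj₂ p = U₂∌ v p λ u u∈ → adj-sym G (complete u v (part⁻ u∈) e)
      ∁Y≢⊤ : ∁ Y ≢ ⊤
      ∁Y≢⊤ eq with inhabited B₁
      ... | v , e = x∈∁p⇒x∉p (subst (v ∈_) (sym eq) ∈⊤) (x∈p∪q⁺ (inj₁ (B⊆U₁ (part⁺ e))))
      into₁ : ∀ {v} → v ∈ Y → quarter v ≢ A₁ → v ∈ U₁
      into₁ {v} v∈ v≢ with x∈p∪q⁻ U₁ U₂ v∈
      ... | inj₁ p = p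
      ... | inj₂ p with quarter v in e
      ...   | A₁ = contradiction refl v≢
      ...   | A₂ = contradiction e (∈⟪⟫⁻ (Side.S? false z₂) (U₂⊆ p))
      ...   | B₁ = B⊆U₁ (part⁺ e)
      ...   | B₂ = ⊥-elim (U₂∌ v p λ u u∈ → adj-sym G (complete u v (part⁻ u∈) e))
      into₂ : ∀ {v} → v ∈ Y → quarter v ≢ A₂ → v ∈ U₂
      into₂ {v} v∈ v≢ with x∈p∪q⁻ U₁ U₂ v∈
      ... | inj₂ p = p
      ... | inj₁ p with quarter v in e
      ...   | A₂ = contradiction refl v≢
      ...   | A₁ = contradiction e (∈⟪⟫⁻ (Side.S? true z₁) (U₁⊆ p))
      ...   | B₁ = B⊆U₂ (part⁺ e)
      ...   | B₂ = ⊥-elim (U₁∌ v p λ u u∈ → adj-sym G (complete u v (part⁻ u∈) e))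
      one-sided : ∀ {K} → IsClique G K → (∀ {v} → v ∈ K → quarter v ≢ A₁) ⊎ (∀ {v} → v ∈ K → quarter v ≢ A₂)
      one-sided {K} cl with any? (λ v → (v ∈? K) ×-dec (quarter v ≟q A₁))
      ... | no none = inj₁ λ {v} v∈ e → none (v , v∈ , e)
      ... | yes (u , u∈ , uA) = inj₂ λ {v} v∈ e → anti u v uA e (cl u v u∈ v∈ λ { refl → contradiction (trans (sym uA) e) λ () })
      sub-clique : ∀ {K} X → IsClique G K → IsClique G (K ∩ X)
      sub-clique {K} X cl u v u∈ v∈ = cl u v (p∩q⊆p K X u∈) (p∩q⊆p K X v∈)
      boundY : CliqueBound G (χ Y) s
      boundY K cl rewrite weight-χ Y K with one-sided cl
      ... | inj₁ h = small₁ (K ∩ Y) (λ v∈ → into₁ (p∩q⊆q K Y v∈) (h (p∩q⊆p K Y v∈))) (sub-clique Y cl)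
      ... | inj₂ h = small₂ (K ∩ Y) (λ v∈ → into₂ (p∩q⊆q K Y v∈) (h (p∩q⊆p K Y v∈))) (sub-clique Y cl)
      bound∁Y : CliqueBound G (χ (∁ Y)) (k ∸ s)
      bound∁Y K cl rewrite weight-χ (∁ Y) K with one-sided cl
      ... | inj₁ h = rest₁ (K ∩ ∁ Y) (λ v∈ → ∈⟪⟫⁺ (Side.S? true z₁) (h (p∩q⊆p K (∁ Y) v∈)))
              (λ v v∈ u → x∈∁p⇒x∉p (p∩q⊆q K (∁ Y) v∈) (p⊆p∪q U₂ u)) (sub-clique (∁ Y) cl)
      ... | inj₂ h = rest₂ (K ∩ ∁ Y) (λ v∈ → ∈⟪⟫⁺ (Side.S? false z₂) (h (p∩q⊆p K (∁ Y) v∈)))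
              (λ v v∈ u → x∈∁p⇒x∉p (p∩q⊆q K (∁ Y) v∈) (q⊆p∪q U₁ U₂ u)) (sub-clique (∁ Y) cl)

    colour : (∀ T → T ≢ ⊤ → PerfectOn G T) →
      (z₁ : Two true) → (∀ T → T ⊆ Side.S true z₁ ∪ ⁅ Side.z true z₁ ⁆ → PerfectOn (Side.H true z₁) T) →
      (z₂ : Two false) → (∀ T → T ⊆ Side.S false z₂ ∪ ⁅ Side.z false z₂ ⁆ → PerfectOn (Side.H false z₂) T) →
      PerfectOn G ⊤
    colour proper z₁ pf₁ z₂ pf₂ k bd =
      let K₀ , (K₀⊆ , clK₀) , max = largest (λ K → (K ⊆? part B₁) ×-dec clique? G K) (⊥ , ⊥⊆ , ⊥-clique G)
          ω = λ K cl → ≤-trans (≤-reflexive (sym (weight-χ-⊆ {T = ⊤} {K} ⊆⊤))) (bd K cl)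
      in combine proper z₁ z₂ k K₀ (ω K₀ clK₀)
           (Side.split true z₁ pf₁ K₀ k K₀⊆ clK₀ (λ K K⊆ cl → max K (K⊆ , cl)) ω)
           (Side.split false z₂ pf₂ K₀ k K₀⊆ clK₀ (λ K K⊆ cl → max K (K⊆ , cl)) ω)

-- Induced paths as lists

odd : ℕ → Bool
odd zero    = false
odd (suc k) = not (odd k)

odd-+ : ∀ a b → odd (a + b) ≡ odd a xor odd b
odd-+ zero    b = refl
odd-+ (suc a) b = trans (cong not (odd-+ a b)) (𝔹ₚ.not-distribˡ-xor (odd a) (odd b))

even⇒¬odd : ∀ {k} → Even k → odd k ≡ false
even⇒¬odd (divides q refl) = go q
  where
  go : ∀ q → odd (q * 2) ≡ false
  go zero    = refl
  go (suc q) = trans (𝔹ₚ.not-involutive _) (go q)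

¬odd⇒even : ∀ k → odd k ≡ false → Even k
¬odd⇒even zero          _  = divides 0 refl
¬odd⇒even (suc (suc k)) eq = ∣m∣n⇒∣m+n ∣-refl (¬odd⇒even k (trans (sym (𝔹ₚ.not-involutive _)) eq))

Odd⇒odd : ∀ {k} → Odd k → odd k ≡ true
Odd⇒odd {k} h with odd k in eq
... | true  = refl
... | false = contradiction (¬odd⇒even k eq) h

xor≡false : ∀ {a b} → a xor b ≡ false → a ≡ b
xor≡false {true}  {true}  _ = refl
xor≡false {false} {false} _ = refl

-- Lets the vertices of a path be indexed by natural numbers. The default `zero` beyond `k` carries
-- no information.
clamp : ∀ k → ℕ → Fin (suc k)
clamp k i with i ≤? k
... | yes i≤k = fromℕ< (s≤s i≤k)
... | no _    = zero

toℕ-clamp : ∀ {k i} → i ≤ k → toℕ (clamp k i) ≡ i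
toℕ-clamp {k} {i} i≤k with i ≤? k
... | yes p = toℕ-fromℕ< (s≤s p)
... | no ¬p = contradiction i≤k ¬p

clamp-toℕ : ∀ {k} (i : Fin (suc k)) → clamp k (toℕ i) ≡ i
clamp-toℕ i = toℕ-injective (toℕ-clamp (≤-pred (toℕ<n i)))

module InducedPaths {n : ℕ} (H : Graph n) where
  private
    R : Fin n → Fin n → Set
    R = Adj H

  Apart : Fin n → Fin n → Set
  Apart x y = x ≢ y × ¬ R x y

  Far : Fin n → List (Fin n) → Set
  Far x = All (Apart x)

  apart-sym : ∀ {x y} → Apart x y → Apart y x
  apart-sym (p , q) = p ∘ sym , q ∘ adj-sym H

  -- The list is an induced path in this order; `Far` also excludes repetitions. Over the complement
  -- it is an antipath.
  Ind : List (Fin n) → Set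
  Ind []          = 𝟙
  Ind (x ∷ [])    = 𝟙
  Ind (x ∷ y ∷ r) = R x y × Far x r × Ind (y ∷ r)

  LastOnly : Fin n → List (Fin n) → Set
  LastOnly z []          = 𝟘
  LastOnly z (c ∷ [])    = R z c
  LastOnly z (x ∷ y ∷ r) = Apart z x × LastOnly z (y ∷ r)

  adj-≢ : ∀ {x y} → R x y → x ≢ y
  adj-≢ r refl = adj-irrefl H refl r

  ind-tail : ∀ x xs → Ind (x ∷ xs) → Ind xs
  ind-tail x []      _           = tt
  ind-tail x (y ∷ r) (_ , _ , i) = i

  ind-append : ∀ xs v ys → Ind (xs ++ v ∷ []) → Ind (v ∷ ys) → All (λ x → Far x ys) xs → Ind (xs ++ v ∷ ys)
  ind-append []          v ys _ i _ = i
  ind-append (x ∷ [])    v ys (r , _) i (f ∷ []) = r , f , i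
  ind-append (x ∷ y ∷ r) v ys (xy , far , i) j (f ∷ fs) =
    xy , ++⁺ (++⁻ˡ r far) (All.head (++⁻ʳ r far) ∷ f) , ind-append (y ∷ r) v ys i j fs

  ind-snoc⁻ : ∀ x xs u → Ind (x ∷ xs ++ u ∷ []) → Ind (x ∷ xs) × LastOnly u (x ∷ xs)
  ind-snoc⁻ x []      u (r , _) = tt , adj-sym H r
  ind-snoc⁻ x (y ∷ r) u (xy , far , i) with ind-snoc⁻ y r u i | ++⁻ r far
  ... | i′ , l | f , a ∷ [] = (xy , f , i′) , apart-sym a , l

  lastOnly-++ : ∀ z xs ys → Far z xs → LastOnly z ys → LastOnly z (xs ++ ys)
  lastOnly-++ z []          ys _ l = l
  lastOnly-++ z (x ∷ [])    (y ∷ ys) (f ∷ []) l = f , l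
  lastOnly-++ z (x ∷ w ∷ r) ys (f ∷ fs) l = f , lastOnly-++ z (w ∷ r) ys fs l

  lastOnly-≢ : ∀ z xs → LastOnly z xs → All (z ≢_) xs
  lastOnly-≢ z (c ∷ [])    r       = adj-≢ r ∷ []
  lastOnly-≢ z (x ∷ y ∷ r) (a , l) = proj₁ a ∷ lastOnly-≢ z (y ∷ r) l

  first-≢ : ∀ x xs → Ind (x ∷ xs) → All (x ≢_) xs
  first-≢ x []      _           = []
  first-≢ x (y ∷ r) (xy , f , _) = adj-≢ xy ∷ All.map proj₁ f

  interior-≢ : ∀ a ms b → Ind (a ∷ ms ++ b ∷ []) → All (λ m → a ≢ m × b ≢ m) ms
  interior-≢ a ms b i = All.zip (++⁻ˡ ms (first-≢ a (ms ++ b ∷ []) i) ,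
    All.tail (lastOnly-≢ b (a ∷ ms) (proj₂ (ind-snoc⁻ a ms b i))))

  ends-apart : ∀ a m ms b → Ind (a ∷ (m ∷ ms) ++ b ∷ []) → Apart a b
  ends-apart a m ms b (_ , f , _) = All.head (++⁻ʳ ms f)

  ind-adj : ∀ xs → Ind xs → ∀ i j → R (lookup xs i) (lookup xs j) ⇔ ∣ toℕ i - toℕ j ∣ ≡ 1
  ind-adj (x ∷ xs) _ zero zero = mk⇔ (λ r → contradiction r (adj-irrefl H refl)) λ ()
  ind-adj (x ∷ y ∷ r) (xy , _) zero (suc zero) = mk⇔ (λ _ → refl) (λ _ → xy)
  ind-adj (x ∷ y ∷ r) (xy , _) (suc zero) zero = mk⇔ (λ _ → refl) (λ _ → adj-sym H xy)
  ind-adj (x ∷ y ∷ r) (_ , f , _) zero (suc (suc j)) = mk⇔ (λ e → contradiction e (proj₂ (All.lookup f (∈-lookup j)))) λ ()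
  ind-adj (x ∷ y ∷ r) (_ , f , _) (suc (suc j)) zero = mk⇔ (λ e → contradiction (adj-sym H e) (proj₂ (All.lookup f (∈-lookup j)))) λ ()
  ind-adj (x ∷ y ∷ r) (_ , _ , k) (suc i) (suc j) = ind-adj (y ∷ r) k i j

  ind-injective : ∀ xs → Ind xs → ∀ {i j} → lookup xs i ≡ lookup xs j → i ≡ j
  ind-injective (x ∷ xs) k {zero}  {zero}  _  = refl
  ind-injective (x ∷ xs) k {zero}  {suc j} eq = contradiction eq (All.lookup (first-≢ x xs k) (∈-lookup j))
  ind-injective (x ∷ xs) k {suc i} {zero}  eq = contradiction (sym eq) (All.lookup (first-≢ x xs k) (∈-lookup i))
  ind-injective (x ∷ xs) k {suc i} {suc j} eq = cong suc (ind-injective xs (ind-tail x xs k) eq)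

  lastOnly-adj : ∀ z xs → LastOnly z xs → ∀ j → R z (lookup xs j) ⇔ suc (toℕ j) ≡ length xs
  lastOnly-adj z (c ∷ [])    r       zero    = mk⇔ (λ _ → refl) (λ _ → r)
  lastOnly-adj z (x ∷ y ∷ r) (a , _) zero    = mk⇔ (λ e → contradiction e (proj₂ a)) λ ()
  lastOnly-adj z (x ∷ y ∷ r) (_ , l) (suc j) = mk⇔ (cong suc ∘ Equivalence.to ih) (Equivalence.from ih ∘ ℕₚ.suc-injective)
    where ih = lastOnly-adj z (y ∷ r) l j

  -- The hole z – a – p₀ – ⋯ – z, of length 2 + length p.
  HoleList : Fin n → Fin n → List (Fin n) → Set
  HoleList z a p = R z a × LastOnly z p × Ind (a ∷ p)

  hole↣ : ∀ z a p → HoleList z a p → Fin (suc (suc (length p))) ↣ Fin n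
  hole↣ z a p (za , l , i) = mk↣ {to = lookup (z ∷ a ∷ p)} inj
    where
    z≢ : ∀ j → z ≢ lookup (a ∷ p) j
    z≢ j = All.lookup (adj-≢ za ∷ lastOnly-≢ z p l) (∈-lookup {xs = a ∷ p} j)
    inj : ∀ {i j} → lookup (z ∷ a ∷ p) i ≡ lookup (z ∷ a ∷ p) j → i ≡ j
    inj {zero}  {zero}  _  = refl
    inj {zero}  {suc j} eq = contradiction eq (z≢ j)
    inj {suc j} {zero}  eq = contradiction (sym eq) (z≢ j)
    inj {suc j} {suc k} eq = cong suc (ind-injective (a ∷ p) i eq)

  hole-cyclic : ∀ z a p (h : HoleList z a p) → Cyclic R (hole↣ z a p h)
  hole-cyclic z a p (za , l , i) = cyc
    where
    around : ∀ j → R z (lookup p j) ⇔ Near (suc (suc (length p))) 0 (suc (suc (toℕ j)))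
    around j = mk⇔ (λ r → inj₂ (cong (2 +_) (Equivalence.to (lastOnly-adj z p l j) r))) λ where
      (inj₁ ())
      (inj₂ e) → Equivalence.from (lastOnly-adj z p l j) (ℕₚ.suc-injective (ℕₚ.suc-injective e))
    cyc : ∀ x y → R (lookup (z ∷ a ∷ p) x) (lookup (z ∷ a ∷ p) y) ⇔ Near (suc (suc (length p))) (toℕ x) (toℕ y)
    cyc zero zero = mk⇔ (λ r → contradiction r (adj-irrefl H refl)) λ { (inj₁ ()) ; (inj₂ ()) }
    cyc zero (suc zero) = mk⇔ (λ _ → inj₁ refl) (λ _ → za)
    cyc (suc zero) zero = mk⇔ (λ _ → inj₁ refl) (λ _ → adj-sym H za)
    cyc zero (suc (suc j)) = around j
    cyc (suc (suc j)) zero = mk⇔ (near-sym 0 (suc (suc (toℕ j))) ∘ Equivalence.to (around j) ∘ adj-sym H)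
      (adj-sym H ∘ Equivalence.from (around j) ∘ near-sym (suc (suc (toℕ j))) 0)
    cyc (suc x) (suc y) = mk⇔ (inj₁ ∘ Equivalence.to (ind-adj (a ∷ p) i x y)) λ where
      (inj₁ e) → Equivalence.from (ind-adj (a ∷ p) i x y) e
      (inj₂ e) → contradiction (≤-trans (≤-reflexive (sym (ℕₚ.suc-injective e))) (gap≤ x y)) 1+n≰n

  NoOddHole : Set
  NoOddHole = ∀ z a p → HoleList z a p → 2 ≤ length p → odd (length p) ≡ false

  module Parity (noOddHole : NoOddHole) where

    -- The two paths together form a hole with two vertices more than their interiors have, whence
    -- equal parities.
    glue : ∀ u m ms v m′ ms′ → Ind (u ∷ (m ∷ ms) ++ v ∷ []) → Ind (v ∷ (m′ ∷ ms′) ++ u ∷ []) →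
      All (λ x → Far x (m′ ∷ ms′)) (m ∷ ms) → odd (length (m ∷ ms)) ≡ odd (length (m′ ∷ ms′))
    glue u m ms v m′ ms′ i@(um , f , i′) j cross with ind-snoc⁻ v (m′ ∷ ms′) u j
    ... | iv , lu = xor≡false (trans (sym (odd-+ (length (m ∷ ms)) _)) (trans (cong odd (sym len))
            (noOddHole u m (ms ++ v ∷ m′ ∷ ms′)
              (um , last , ind-append (m ∷ ms) v (m′ ∷ ms′) i′ iv cross)
              (≤-trans (s≤s (≤-trans (s≤s z≤n) (m≤n+m _ (length ms)))) (≤-reflexive (sym len))))))
      where
      len : length (ms ++ v ∷ m′ ∷ ms′) ≡ length (m ∷ ms) + length (m′ ∷ ms′)
      len = trans (length-++ ms) (+-suc (length ms) _)
      last : LastOnly u (ms ++ v ∷ m′ ∷ ms′)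
      last = lastOnly-++ u ms _ (++⁻ˡ ms f) lu

    -- `glue` with the path `v – b – u`, whose interior is the single vertex `b`.
    apex : ∀ u m ms v b → Ind (u ∷ (m ∷ ms) ++ v ∷ []) → R u b → R v b → Far b (m ∷ ms) →
      odd (length (m ∷ ms)) ≡ true
    apex u m ms v b i ub vb far = glue u m ms v b [] i
      (vb , apart-sym (ends-apart u m ms v i) ∷ [] , adj-sym H ub , [] , tt)
      (All.map (λ p → apart-sym p ∷ []) far)

  module _ (b : Fin n) (X : Fin n → Set) where

    PathTo : Fin n → Set
    PathTo x = x ≡ b ⊎ ∃[ ms ] All X ms × Ind (x ∷ ms ++ b ∷ [])

    private
      Touch : Fin n → Fin n → Set
      Touch x e = x ≡ e ⊎ R x e

      touch? : ∀ x e → Dec (Touch x e)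
      touch? x e = (x ≟ e) ⊎-dec adj? H x e

      untouched : ∀ {x} es → ¬ Any (Touch x) es → Far x es
      untouched []       _ = []
      untouched (e ∷ es) h = ((λ p → h (here (inj₁ p))) , (λ p → h (here (inj₂ p)))) ∷ untouched es (λ p → h (there p))

      -- `x` is attached at the last vertex of the path that it equals or is adjacent to; being far
      -- from all later vertices, it keeps the path induced.
      shortcut : ∀ x y ms → All X (y ∷ ms) → Ind (y ∷ ms ++ b ∷ []) → Any (Touch x) (y ∷ ms ++ b ∷ []) → PathTo x
      shortcut x y [] (Xy ∷ []) i t with touch? x b | t
      ... | yes (inj₁ e) | _ = inj₁ e
      ... | yes (inj₂ r) | _ = inj₂ ([] , [] , r , [] , tt)
      ... | no ¬t | here (inj₁ refl) = inj₂ ([] , [] , i)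
      ... | no ¬t | here (inj₂ r) = inj₂ (y ∷ [] , Xy ∷ [] , r , ((¬t ∘ inj₁ , ¬t ∘ inj₂) ∷ []) , i)
      ... | no ¬t | there (here t′) = contradiction t′ ¬t
      shortcut x y (m ∷ ms) (Xy ∷ Xs) i t with AnyDec.any? (touch? x) (m ∷ ms ++ b ∷ []) | t
      ... | yes t′ | _ = shortcut x m ms Xs (ind-tail y _ i) t′
      ... | no ¬t | here (inj₁ refl) = inj₂ (m ∷ ms , Xs , i)
      ... | no ¬t | here (inj₂ r) = inj₂ (y ∷ m ∷ ms , Xy ∷ Xs , r , untouched _ ¬t , i)
      ... | no ¬t | there t′ = contradiction t′ ¬t

    walk⇒path : ∀ {x} → Star (λ u v → X u × X v × R u v) x b → PathTo x
    walk⇒path ε = inj₁ refl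
    walk⇒path {x} (_◅_ {j = y} (Xx , Xy , r) w) with walk⇒path w
    ... | inj₁ refl = inj₂ ([] , [] , r , [] , tt)
    ... | inj₂ (ms , Xms , i) = shortcut x y ms (Xy ∷ Xms) i (here (inj₂ r))

  module _ (q : ℕ → Fin n) (k : ℕ) where

    Path : Set
    Path = (∀ i j → i ≤ k → j ≤ k → R (q i) (q j) ⇔ ∣ i - j ∣ ≡ 1) × (∀ i j → i ≤ k → j ≤ k → q i ≡ q j → i ≡ j)

    seg : ℕ → ℕ → List (Fin n)
    seg i zero    = []
    seg i (suc d) = q i ∷ seg (suc i) d

    seg-snoc : ∀ i d → seg i (suc d) ≡ seg i d ++ q (i + d) ∷ []
    seg-snoc i zero    = cong (λ j → q j ∷ []) (sym (+-identityʳ i))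
    seg-snoc i (suc d) = cong (q i ∷_) (trans (seg-snoc (suc i) d) (cong (λ j → seg (suc i) d ++ q j ∷ []) (sym (+-suc i d))))

    length-seg : ∀ i d → length (seg i d) ≡ d
    length-seg i zero    = refl
    length-seg i (suc d) = cong suc (length-seg (suc i) d)

    seg-all : ∀ {P : Fin n → Set} i d → (∀ j → i ≤ j → j < i + d → P (q j)) → All P (seg i d)
    seg-all i zero    h = []
    seg-all i (suc d) h = h i ≤-refl (m<m+n i (s≤s z≤n)) ∷
      seg-all (suc i) d (λ j i<j j< → h j (<⇒≤ i<j) (≤-trans j< (≤-reflexive (sym (+-suc i d)))))

    seg-ind : Path → ∀ i d → i + d ≤ k → Ind (seg i (suc d))
    seg-ind path i zero    _  = tt
    seg-ind path@(adj , inj) i (suc d) le =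
      Equivalence.from (adj i (suc i) i≤k (≤-trans (s≤s (m≤m+n i d)) le′)) (trans (m≤n⇒∣m-n∣≡n∸m (n≤1+n i)) (m+n∸n≡m 1 i)) ,
      seg-all (suc (suc i)) d far , seg-ind path (suc i) d le′
      where
      le′ : suc i + d ≤ k
      le′ = ≤-trans (≤-reflexive (sym (+-suc i d))) le
      i≤k : i ≤ k
      i≤k = ≤-trans (m≤m+n i (suc d)) le
      far : ∀ j → suc (suc i) ≤ j → j < suc (suc i) + d → Apart (q i) (q j)
      far j i<j j< = (λ e → <⇒≢ (≤-trans (n≤1+n (suc i)) i<j) (inj i j i≤k j≤k e)) ,
        λ r → contradiction (≤-trans (≤-trans (≤-reflexive (sym (m+n∸n≡m 2 i))) (∸-monoˡ-≤ i i<j))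
                (≤-reflexive (trans (sym (m≤n⇒∣m-n∣≡n∸m (≤-trans (n≤1+n i) (≤-trans (n≤1+n _) i<j)))) (Equivalence.to (adj i j i≤k j≤k) r)))) λ { (s≤s ()) }
        where
        j≤k : j ≤ k
        j≤k = ≤-trans (≤-pred j<) le′

  function⇒Path : ∀ {k} (f : Fin (suc k) ↣ Fin n) → (∀ i j → R (Injection.to f i) (Injection.to f j) ⇔ ∣ toℕ i - toℕ j ∣ ≡ 1) →
    Path (Injection.to f ∘ clamp k) k
  function⇒Path {k} f path =
    (λ i j i≤k j≤k → subst₂ (λ a b → R (Injection.to f (clamp k i)) (Injection.to f (clamp k j)) ⇔ ∣ a - b ∣ ≡ 1) (toℕ-clamp i≤k) (toℕ-clamp j≤k) (path (clamp k i) (clamp k j))) ,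
    (λ i j i≤k j≤k e → trans (sym (toℕ-clamp i≤k)) (trans (cong toℕ (Injection.injective f e)) (toℕ-clamp j≤k)))

berge⇒noOddHole : ∀ {n} (G : Graph n) → Berge G → InducedPaths.NoOddHole G
berge⇒noOddHole G (holes , _) z a p h 2≤p = trans (sym (𝔹ₚ.not-involutive _))
  (even⇒¬odd (holes _ (s≤s (s≤s 2≤p) , hole↣ z a p h , hole-cyclic z a p h)))
  where open InducedPaths G

-- Connectivity in terms of cuts

module Connectivity {n : ℕ} (H : Graph n) where

  -- Every cut of `X` is crossed by an edge. In this form a failure of connectedness can be searched
  -- for among the finitely many `S` and delivers the cut itself.
  Conn : Subset n → Set
  Conn X = ∀ S → (∃[ u ] u ∈ X × u ∈ S) → (∃[ v ] v ∈ X × v ∉ S) →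
    ∃₂ λ u v → (u ∈ X × u ∈ S) × (v ∈ X × v ∉ S) × Adj H u v

  connected⇒conn : ∀ {X} → Connected H X → Conn X
  connected⇒conn {X} c S (u , u∈ , uS) (v , v∈ , vS) = cross u∈ uS (c u v u∈ v∈)
    where
    cross : ∀ {u} → u ∈ X → u ∈ S → Star (λ x y → x ∈ X × y ∈ X × Adj H x y) u v →
      ∃₂ λ u v → (u ∈ X × u ∈ S) × (v ∈ X × v ∉ S) × Adj H u v
    cross u∈ uS ε = contradiction uS vS
    cross u∈ uS (_◅_ {j = y} (_ , y∈ , uy) w) with y ∈? S
    ... | yes yS = cross y∈ yS w
    ... | no y∉S = _ , y , (u∈ , uS) , (y∈ , y∉S) , uy

  -- The set of vertices known to be reachable from `u` grows across a crossing edge until it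
  -- contains `v`; each round adds a vertex, so `n` rounds are enough.
  conn⇒connected : ∀ {X} → Conn X → Connected H X
  conn⇒connected {X} c u v u∈ v∈ = go n ⁅ u ⁆ (x∈⁅x⁆ u) start (m≤m+n n _)
    where
    Reach : Fin n → Set
    Reach = Star (λ x y → x ∈ X × y ∈ X × Adj H x y) u
    start : ∀ x → x ∈ X → x ∈ ⁅ u ⁆ → Reach x
    start x _ x∈ rewrite x∈⁅y⁆⇒x≡y u x∈ = ε
    go : ∀ fuel S → u ∈ S → (∀ x → x ∈ X → x ∈ S → Reach x) → n ≤ fuel + ∣ S ∣ → Reach v
    go fuel S uS reach le with v ∈? S
    ... | yes vS = reach v v∈ vS
    go zero S uS reach le | no v∉S =
      contradiction (subst (v ∈_) (sym (∣p∣≡n⇒p≡⊤ (≤-antisym (∣p∣≤n S) le))) ∈⊤) v∉S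
    go (suc fuel) S uS reach le | no v∉S with c S (u , u∈ , uS) (v , v∈ , v∉S)
    ... | a , b , (a∈ , aS) , (b∈ , b∉S) , ab = go fuel (S ∪ ⁅ b ⁆) (p⊆p∪q ⁅ b ⁆ uS) reach′
            (≤-trans le (≤-trans (≤-reflexive (sym (+-suc fuel ∣ S ∣))) (+-monoʳ-≤ fuel
              (p⊂q⇒∣p∣<∣q∣ (p⊆p∪q ⁅ b ⁆ , b , q⊆p∪q S ⁅ b ⁆ (x∈⁅x⁆ b) , b∉S)))))
      where
      reach′ : ∀ x → x ∈ X → x ∈ S ∪ ⁅ b ⁆ → Reach x
      reach′ x x∈ x∈′ with x∈p∪q⁻ S ⁅ b ⁆ x∈′
      ... | inj₁ xS = reach x x∈ xS
      ... | inj₂ p rewrite x∈⁅y⁆⇒x≡y b p = reach a a∈ aS ◅◅ ((a∈ , b∈ , ab) ◅ ε)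

  -- L is a union of components of X.
  Closed : Subset n → Subset n → Set
  Closed X L = L ⊆ X × (∀ a b → a ∈ L → b ∈ X → b ∉ L → ¬ Adj H a b)

  conn-or-cut : ∀ X → Conn X ⊎ (∃[ S ] Closed X S × Nonempty S × ∃[ v ] v ∈ X × v ∉ S)
  conn-or-cut X with anySubset? (λ S → any? (λ u → (u ∈? X) ×-dec (u ∈? S)) ×-dec (any? (λ v → (v ∈? X) ×-dec ¬? (v ∈? S))
      ×-dec ¬? (any? λ u → any? λ v → ((u ∈? X) ×-dec (u ∈? S)) ×-dec (((v ∈? X) ×-dec ¬? (v ∈? S)) ×-dec adj? H u v))))
  ... | yes (S , (u , uX , uS) , (v , vX , vS) , none) = inj₂ (X ∩ S ,
          (p∩q⊆p X S , λ a b a∈ b∈ b∉ ab → none (a , b , x∈p∩q⁻ X S a∈ , (b∈ , λ bS → b∉ (x∈p∩q⁺ (b∈ , bS))) , ab)) ,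
          (u , x∈p∩q⁺ (uX , uS)) , v , vX , λ v∈ → vS (p∩q⊆q X S v∈))
  ... | no none = inj₁ λ S (u , u∈) (v , v∈) → decidable-stable
          (any? λ u → any? λ v → ((u ∈? X) ×-dec (u ∈? S)) ×-dec (((v ∈? X) ×-dec ¬? (v ∈? S)) ×-dec adj? H u v))
          (λ ¬e → none (S , (u , u∈) , (v , v∈) , ¬e))

  cut-avoiding : ∀ {X S} → Closed X S → Nonempty S → ∃[ v ] (v ∈ X × v ∉ S) → ∀ x → x ∈ X →
    ∃[ L ] Closed X L × Nonempty L × x ∉ L
  cut-avoiding {X} {S} (S⊆X , closed) ne (v , v∈ , v∉) x x∈ with x ∈? S
  ... | no x∉S = S , (S⊆X , closed) , ne , x∉S
  ... | yes xS = X ─ S , (p─q⊆p X S , λ a b a∈ b∈ b∉ ab → closed b a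
                    (decidable-stable (b ∈? S) λ b∉S → b∉ (x∈p∧x∉q⇒x∈p─q b∈ b∉S)) (proj₁ (∈─⁻ X S a∈)) (proj₂ (∈─⁻ X S a∈)) (adj-sym H ab)) ,
                  (v , x∈p∧x∉q⇒x∈p─q v∈ v∉) , λ x∈′ → proj₂ (∈─⁻ X S x∈′) xS

  conn-universal : ∀ {X} x → x ∈ X → (∀ v → v ∈ X → v ≢ x → Adj H x v) → Conn X
  conn-universal x x∈ all S (u , u∈ , uS) (v , v∈ , vS) with x ∈? S
  ... | yes xS = x , v , (x∈ , xS) , (v∈ , vS) , all v v∈ λ { refl → vS xS }
  ... | no x∉S = u , x , (u∈ , uS) , (x∈ , x∉S) , adj-sym H (all u u∈ λ { refl → x∉S uS })

  conn-singleton : ∀ x → Conn ⁅ x ⁆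
  conn-singleton x = conn-universal x (x∈⁅x⁆ x) λ v v∈ v≢ → contradiction (x∈⁅y⁆⇒x≡y x v∈) v≢

  conn-insert : ∀ {S s w} → Conn S → s ∈ S → Adj H s w → Conn (S ∪ ⁅ w ⁆)
  conn-insert {S} {s} {w} c s∈ sw T (u , u∈ , uT) (v , v∈ , vT)
    with any? (λ x → (x ∈? S) ×-dec (x ∈? T)) | any? (λ x → (x ∈? S) ×-dec ¬? (x ∈? T))
  ... | yes p | yes q with c T p q
  ...   | a , b , (a∈ , aT) , (b∈ , bT) , ab = a , b , (p⊆p∪q ⁅ w ⁆ a∈ , aT) , (p⊆p∪q ⁅ w ⁆ b∈ , bT) , ab
  conn-insert {S} {s} {w} c s∈ sw T (u , u∈ , uT) (v , v∈ , vT) | no none | _ with x∈p∪q⁻ S ⁅ w ⁆ u∈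
  ... | inj₁ uS = contradiction (u , uS , uT) none
  ... | inj₂ p rewrite x∈⁅y⁆⇒x≡y w p = w , s , (u∈ , uT) , (p⊆p∪q ⁅ w ⁆ s∈ , λ sT → none (s , s∈ , sT)) , adj-sym H sw
  conn-insert {S} {s} {w} c s∈ sw T (u , u∈ , uT) (v , v∈ , vT) | yes _ | no none with x∈p∪q⁻ S ⁅ w ⁆ v∈
  ... | inj₁ vS = contradiction (v , vS , vT) none
  ... | inj₂ p rewrite x∈⁅y⁆⇒x≡y w p = s , w , (p⊆p∪q ⁅ w ⁆ s∈ , decidable-stable (s ∈? T) λ s∉ → none (s , s∈ , s∉)) , (v∈ , vT) , sw

  -- `S` grows inside `W` by one adjacent vertex at a time, and stays connected. The vertex added
  -- last is not a cut vertex.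
  non-cut-vertex : ∀ {S W} → S ⊆ W → Conn S → Nonempty S → Conn W → ∃[ v ] (v ∈ W × v ∉ S) →
    ∃[ l ] l ∈ W × l ∉ S × Conn (W ⊖ l)
  non-cut-vertex {S₀} {W} = go n (m≤m+n n _)
    where
    go : ∀ fuel {S} → n ≤ fuel + ∣ S ∣ → S ⊆ W → Conn S → Nonempty S → Conn W → ∃[ v ] (v ∈ W × v ∉ S) →
      ∃[ l ] l ∈ W × l ∉ S × Conn (W ⊖ l)
    go zero {S} le _ _ _ _ (v , _ , v∉) =
      contradiction (subst (v ∈_) (sym (∣p∣≡n⇒p≡⊤ (≤-antisym (∣p∣≤n S) le))) ∈⊤) v∉
    go (suc fuel) {S} le S⊆W cS (s , s∈) cW out with cW S (s , S⊆W s∈ , s∈) out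
    ... | a , w , (_ , aS) , (wW , w∉S) , aw with any? (λ v → (v ∈? W) ×-dec ¬? (v ∈? (S ∪ ⁅ w ⁆)))
    ...   | no none = w , wW , w∉S , subst Conn S≡ cS
      where
      S≡ : S ≡ W ⊖ w
      S≡ = ⊆-antisym (λ v∈ → x∈p∧x≢y⇒x∈p-y (S⊆W v∈) λ { refl → w∉S v∈ }) back
        where
        back : W ⊖ w ⊆ S
        back {v} v∈ with ∈-⁻ W w v∈
        ... | vW , v≢w with x∈p∪q⁻ S ⁅ w ⁆ (decidable-stable (v ∈? (S ∪ ⁅ w ⁆)) λ v∉ → none (v , vW , v∉))
        ...   | inj₁ p = p
        ...   | inj₂ p = contradiction (x∈⁅y⁆⇒x≡y w p) v≢w
    ...   | yes out′ with go fuel {S ∪ ⁅ w ⁆}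
              (≤-trans le (≤-trans (≤-reflexive (sym (+-suc fuel ∣ S ∣))) (+-monoʳ-≤ fuel
                (p⊂q⇒∣p∣<∣q∣ (p⊆p∪q ⁅ w ⁆ , w , q⊆p∪q S ⁅ w ⁆ (x∈⁅x⁆ w) , w∉S)))))
              (λ v∈ → [ (λ p → S⊆W p) , (λ p → subst (_∈ W) (sym (x∈⁅y⁆⇒x≡y w p)) wW) ]′ (x∈p∪q⁻ S ⁅ w ⁆ v∈))
              (conn-insert cS aS aw) (s , p⊆p∪q ⁅ w ⁆ s∈) cW out′
    ...     | l , lW , l∉ , cl = l , lW , (λ p → l∉ (p⊆p∪q ⁅ w ⁆ p)) , cl

  -- L is attached to the rest of X only through y.
  conn-prune : ∀ {X L y} → Conn X → (∀ a b → a ∈ L → b ∈ X → b ∉ L → b ≢ y → ¬ Adj H a b) → Conn (X ─ L)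
  conn-prune {X} {L} {y} c closed T (u , u∈ , uT) (v , v∈ , vT) with ∈─⁻ X L u∈ | ∈─⁻ X L v∈ | y ∈? T
  ... | uX , uL | vX , vL | yes yT with c (T ∪ L) (u , uX , p⊆p∪q L uT) (v , vX , λ p → [ vT , vL ]′ (x∈p∪q⁻ T L p))
  ...   | a , b , (aX , a∈) , (bX , b∉) , ab = a , b , (x∈p∧x∉q⇒x∈p─q aX a∉L , [ id , (λ aL → contradiction aL a∉L) ]′ (x∈p∪q⁻ T L a∈)) ,
          (x∈p∧x∉q⇒x∈p─q bX (λ p → b∉ (q⊆p∪q T L p)) , λ p → b∉ (p⊆p∪q L p)) , ab
    where
    a∉L : a ∉ L
    a∉L aL = closed a b aL bX (λ p → b∉ (q⊆p∪q T L p)) (λ { refl → b∉ (p⊆p∪q L yT) }) ab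
  conn-prune {X} {L} {y} c closed T (u , u∈ , uT) (v , v∈ , vT) | uX , uL | vX , vL | no y∉T
    with c (T ─ L) (u , uX , x∈p∧x∉q⇒x∈p─q uT uL) (v , vX , λ p → vT (p─q⊆p T L p))
  ... | a , b , (aX , a∈) , (bX , b∉) , ab with ∈─⁻ T L a∈
  ...   | aT , aL = a , b , (x∈p∧x∉q⇒x∈p─q aX aL , aT) , (x∈p∧x∉q⇒x∈p─q bX b∉L , λ bT → b∉ (x∈p∧x∉q⇒x∈p─q bT b∉L)) , ab
    where
    b∉L : b ∉ L
    b∉L bL = closed b a bL aX aL (λ { refl → y∉T aT }) (adj-sym H ab)

  -- Tailored to the parity count by induction on `F`. A path of length two between the pair has an
  -- odd interior, and then deleting either vertex is enough; for a path with an even interior both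
  -- must be deletable together.
  record NonadjacentPair (F : Subset n) : Set where
    field
      x₁ x₂      : Fin n
      x₁∈        : x₁ ∈ F
      x₂∈        : x₂ ∈ F
      x₁≢x₂      : x₁ ≢ x₂
      nonadj     : ¬ Adj H x₁ x₂
      conn₁      : Conn (F ⊖ x₁)
      conn₂      : Conn (F ⊖ x₂)
      alternative : (∃[ y ] y ∈ F × Adj H x₁ y × Adj H y x₂) ⊎ Conn (F ⊖ x₁ ⊖ x₂)

  -- Growing from `u` yields a non-cut vertex `x` other than `u`. If `x` is adjacent to all of `F`,
  -- then it holds `F ⊖ u` together, and `u` itself serves.
  nonuniversal-non-cut : ∀ {F u u′} → Conn F → u ∈ F → u′ ∈ F → u′ ≢ u → ¬ Adj H u u′ →
    ∃₂ λ x w → x ∈ F × w ∈ F × w ≢ x × ¬ Adj H x w × Conn (F ⊖ x)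
  nonuniversal-non-cut {F} {u} {u′} c u∈ u′∈ u′≢u ¬uu′
    with non-cut-vertex {⁅ u ⁆} {F} (λ p → subst (_∈ F) (sym (x∈⁅y⁆⇒x≡y u p)) u∈) (conn-singleton u) (u , x∈⁅x⁆ u) c (u′ , u′∈ , λ p → u′≢u (x∈⁅y⁆⇒x≡y u p))
  ... | x , x∈ , x∉u , cx with any? (λ w → (w ∈? F) ×-dec (¬? (w ≟ x) ×-dec ¬? (adj? H x w)))
  ...   | yes (w , w∈ , w≢x , ¬xw) = x , w , x∈ , w∈ , w≢x , ¬xw , cx
  ...   | no none = u , u′ , u∈ , u′∈ , u′≢u , ¬uu′ ,
            conn-universal x (x∈p∧x≢y⇒x∈p-y x∈ λ { refl → x∉u (x∈⁅x⁆ x) })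
              λ v v∈ v≢x → adj-stable H λ ¬xv → none (v , proj₁ (∈-⁻ F u v∈) , v≢x , ¬xv)

  -- x₂ is at distance two from x₁ if some such vertex y is not a cut vertex;
  -- otherwise x₂ is taken beyond y.
  nonadjacent-pair : ∀ {F u u′} → Conn F → u ∈ F → u′ ∈ F → u′ ≢ u → ¬ Adj H u u′ → NonadjacentPair F
  nonadjacent-pair {F} c u∈ u′∈ u′≢u ¬uu′ with nonuniversal-non-cut c u∈ u′∈ u′≢u ¬uu′
  -- An edge `v y` leaving the closed neighbourhood of `x` puts `y` at distance two from `x`.
  ... | x , w , x∈ , w∈ , w≢x , ¬xw , cx with c ball (x , x∈ , ∈⟪⟫⁺ ball? (inj₁ refl)) (w , w∈ , λ p → [ w≢x , ¬xw ]′ (∈⟪⟫⁻ ball? p))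
    where
    ball? = λ v → (v ≟ x) ⊎-dec adj? H x v
    ball : Subset n
    ball = ⟪ ball? ⟫
  ... | v , y , (v∈ , vB) , (y∈ , y∉B) , vy = by-cut (conn-or-cut (F ⊖ y))
    where
    ball? = λ v → (v ≟ x) ⊎-dec adj? H x v
    y≢x : y ≢ x
    y≢x e = y∉B (∈⟪⟫⁺ ball? (inj₁ e))
    ¬xy : ¬ Adj H x y
    ¬xy e = y∉B (∈⟪⟫⁺ ball? (inj₂ e))
    xv : Adj H x v
    xv with ∈⟪⟫⁻ ball? vB
    ... | inj₁ refl = contradiction vy ¬xy
    ... | inj₂ e = e
    x∈′ : x ∈ F ⊖ y
    x∈′ = x∈p∧x≢y⇒x∈p-y x∈ (y≢x ∘ sym)
    -- `L` hangs on the rest of `F` only through `y`, so `F ⊖ x` without `L` is still connected.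
    -- Growing from there, the last vertex `l` lies in `L`, hence is nonadjacent to `x`, and `v`
    -- reattaches `x` to what remains.
    beyond : ∃[ L ] Closed (F ⊖ y) L × Nonempty L × x ∉ L → NonadjacentPair F
    beyond (L , (L⊆ , closed) , (m , m∈) , x∉L)
      with non-cut-vertex {F ⊖ x ─ L} {F ⊖ x} (p─q⊆p (F ⊖ x) L)
             (conn-prune {F ⊖ x} {L} {y} cx λ a b a∈ b∈ b∉ b≢y → closed a b a∈ (x∈p∧x≢y⇒x∈p-y (proj₁ (∈-⁻ F x b∈)) b≢y) b∉)
             (y , x∈p∧x∉q⇒x∈p─q (x∈p∧x≢y⇒x∈p-y y∈ y≢x) (λ yL → proj₂ (∈-⁻ F y (L⊆ yL)) refl))
             cx (m , x∈p∧x≢y⇒x∈p-y (proj₁ (∈-⁻ F y (L⊆ m∈))) (λ { refl → x∉L m∈ }) , λ p → proj₂ (∈─⁻ (F ⊖ x) L p) m∈)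
    ... | l , l∈ , l∉ , cl = record
      { x₁ = x ; x₂ = l ; x₁∈ = x∈ ; x₂∈ = proj₁ (∈-⁻ F x l∈) ; x₁≢x₂ = λ { refl → x∉L lL }
      ; nonadj = ¬xl ; conn₁ = cx ; conn₂ = subst Conn F⊖l≡ (conn-insert cl (x∈p∧x≢y⇒x∈p-y (x∈p∧x≢y⇒x∈p-y v∈ λ { refl → adj-irrefl H refl xv })
                                               λ { refl → ¬xl xv }) (adj-sym H xv))
      ; alternative = inj₂ cl }
      where
      lL : l ∈ L
      lL = decidable-stable (l ∈? L) λ l∉L → l∉ (x∈p∧x∉q⇒x∈p─q l∈ l∉L)
      ¬xl : ¬ Adj H x l
      ¬xl e = closed l x lL x∈′ x∉L (adj-sym H e)
      x≢l : x ≢ l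
      x≢l refl = x∉L lL
      F⊖l≡ : (F ⊖ x ⊖ l) ∪ ⁅ x ⁆ ≡ F ⊖ l
      F⊖l≡ = ⊆-antisym
        (λ p → [ (λ q → let a , b = ∈-⁻ (F ⊖ x) l q in x∈p∧x≢y⇒x∈p-y (proj₁ (∈-⁻ F x a)) b) ,
                 (λ q → subst (_∈ F ⊖ l) (sym (x∈⁅y⁆⇒x≡y x q)) (x∈p∧x≢y⇒x∈p-y x∈ x≢l)) ]′ (x∈p∪q⁻ (F ⊖ x ⊖ l) ⁅ x ⁆ p))
        back
        where
        back : F ⊖ l ⊆ (F ⊖ x ⊖ l) ∪ ⁅ x ⁆
        back {z} p with ∈-⁻ F l p | z ≟ x
        ... | a , b | yes refl = q⊆p∪q (F ⊖ x ⊖ l) ⁅ x ⁆ (x∈⁅x⁆ x)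
        ... | a , b | no z≢x = p⊆p∪q ⁅ x ⁆ (x∈p∧x≢y⇒x∈p-y (x∈p∧x≢y⇒x∈p-y a z≢x) b)
    by-cut : Conn (F ⊖ y) ⊎ (∃[ S ] Closed (F ⊖ y) S × Nonempty S × ∃[ v ] v ∈ F ⊖ y × v ∉ S) → NonadjacentPair F
    by-cut (inj₁ cy) = record
      { x₁ = x ; x₂ = y ; x₁∈ = x∈ ; x₂∈ = y∈ ; x₁≢x₂ = y≢x ∘ sym ; nonadj = ¬xy ; conn₁ = cx ; conn₂ = cy
      ; alternative = inj₁ (v , v∈ , xv , vy) }
    by-cut (inj₂ (S , closed , ne , out)) = beyond (cut-avoiding closed ne out x x∈′)

-- Sums modulo two

xorSum : ℕ → (ℕ → Bool) → Bool
xorSum zero    f = false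
xorSum (suc k) f = xorSum k f xor f k

xorSum-cong : ∀ k {f g} → (∀ i → i < k → f i ≡ g i) → xorSum k f ≡ xorSum k g
xorSum-cong zero    h = refl
xorSum-cong (suc k) h = cong₂ _xor_ (xorSum-cong k λ i i<k → h i (≤-trans i<k (n≤1+n k))) (h k ≤-refl)

xorSum-differ : ∀ k {f g} → xorSum k f ≢ xorSum k g → ∃[ i ] i < k × f i ≢ g i
xorSum-differ zero    h = contradiction refl h
xorSum-differ (suc k) {f} {g} h with f k 𝔹ₚ.≟ g k
... | no neq = k , ≤-refl , neq
... | yes eq with xorSum-differ k {f} {g} (λ e → h (cong₂ _xor_ e eq))
...   | i , i<k , neq = i , ≤-trans i<k (n≤1+n k) , neq

xor-interchange : ∀ a b c d → (a xor b) xor (c xor d) ≡ (a xor c) xor (b xor d)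
xor-interchange a b c d = begin
  (a xor b) xor (c xor d) ≡⟨ xor-assoc a b (c xor d) ⟩
  a xor (b xor (c xor d)) ≡⟨ cong (a xor_) (sym (xor-assoc b c d)) ⟩
  a xor ((b xor c) xor d) ≡⟨ cong (λ x → a xor (x xor d)) (xor-comm b c) ⟩
  a xor ((c xor b) xor d) ≡⟨ cong (a xor_) (xor-assoc c b d) ⟩
  a xor (c xor (b xor d)) ≡⟨ sym (xor-assoc a c (b xor d)) ⟩
  (a xor c) xor (b xor d) ∎
  where open ≡-Reasoning

xorSum-xor : ∀ k {f g} → xorSum k (λ i → f i xor g i) ≡ xorSum k f xor xorSum k g
xorSum-xor zero    = refl
xorSum-xor (suc k) {f} {g} = trans (cong (_xor (f k xor g k)) (xorSum-xor k {f} {g}))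
  (xor-interchange (xorSum k f) (xorSum k g) (f k) (g k))

-- The shape in which inclusion-exclusion is used: union and intersection against the two sets, with
-- three of the four parities known.
xorSum-exchange : ∀ k {a b c d} κ → (∀ i → i < k → a i xor b i ≡ c i xor d i) →
  xorSum k b ≡ κ → xorSum k c ≡ κ → xorSum k d ≡ κ → xorSum k a ≡ κ
xorSum-exchange k {a} {b} {c} {d} κ h b≡ c≡ d≡ = xor≡false (begin
  xorSum k a xor κ                ≡⟨ cong (xorSum k a xor_) (sym b≡) ⟩
  xorSum k a xor xorSum k b       ≡⟨ sym (xorSum-xor k {a} {b}) ⟩
  xorSum k (λ i → a i xor b i)    ≡⟨ xorSum-cong k h ⟩
  xorSum k (λ i → c i xor d i)    ≡⟨ xorSum-xor k {c} {d} ⟩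
  xorSum k c xor xorSum k d       ≡⟨ cong₂ _xor_ c≡ d≡ ⟩
  κ xor κ                         ≡⟨ xor-same κ ⟩
  false                           ∎)
  where open ≡-Reasoning

-- The marked positions cut the interval from 0 to `k` into gaps. A gap of length one contributes
-- one to the sum, any other is even and contributes nothing, so sum and length agree in parity.
scan : ∀ {M : ℕ → Set} (M? : ∀ i → Dec (M i)) k → M 0 → M k →
  (∀ i d → i + suc d ≤ k → M i → M (i + suc d) → (∀ j → i < j → j < i + suc d → ¬ M j) → d ≡ 0 ⊎ odd (suc d) ≡ false) →
  xorSum k (λ i → does (M? i ×-dec M? (suc i))) ≡ odd k
scan {M} M? k M0 Mk gap with invariant k ≤-refl
  where
  -- `j` is the last marked position up to `p`, and `d` its distance from `p`.
  Last : ℕ → Set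
  Last p = ∃₂ λ j d → p ≡ j + d × M j × (∀ l → j < l → l ≤ p → ¬ M l) × xorSum p (λ i → does (M? i ×-dec M? (suc i))) ≡ odd j
  invariant : ∀ p → p ≤ k → Last p
  invariant zero _ = 0 , 0 , refl , M0 , (λ { l 0<l l≤0 → contradiction (≤-trans 0<l l≤0) λ () }) , refl
  invariant (suc p) p<k with invariant p (≤-trans (n≤1+n p) p<k) | M? (suc p) in eq
  ... | j , d , p≡ , Mj , none , s≡ | no ¬M =
          j , suc d , trans (cong suc p≡) (sym (+-suc j d)) , Mj ,
          none′ , trans (cong₂ _xor_ s≡ (𝔹ₚ.∧-zeroʳ _)) (𝔹ₚ.xor-identityʳ (odd j))
    where
    none′ : ∀ l → j < l → l ≤ suc p → ¬ M l
    none′ l j<l l≤ with m≤n⇒m<n∨m≡n l≤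
    ... | inj₁ l<  = none l j<l (≤-pred l<)
    ... | inj₂ refl = ¬M
  ... | j , zero , p≡ , Mj , none , s≡ | yes M′ rewrite +-identityʳ j | p≡ =
          suc j , 0 , cong suc (sym (+-identityʳ j)) , M′ , (λ l a b → contradiction (≤-trans a b) 1+n≰n) ,
          trans (cong₂ _xor_ s≡ (cong (_∧ true) (dec-true (M? j) Mj))) (trans (xor-comm (odd j) true) refl)
  ... | j , suc d , p≡ , Mj , none , s≡ | yes M′ =
          suc p , 0 , sym (+-identityʳ (suc p)) , M′ , (λ l a b → contradiction (≤-trans a b) 1+n≰n) , par
    where
    sp≡ : suc p ≡ j + suc (suc d)
    sp≡ = trans (cong suc p≡) (sym (+-suc j (suc d)))
    par : xorSum p (λ i → does (M? i ×-dec M? (suc i))) xor (does (M? p) ∧ true) ≡ odd (suc p)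
    par with gap j (suc d) (subst (_≤ k) sp≡ p<k) Mj (subst M sp≡ M′) (λ l a b → none l a (≤-pred (subst (l <_) (sym sp≡) b)))
    ... | inj₂ e = trans (cong₂ _xor_ s≡ (cong (_∧ true) (dec-false (M? p) (none p (subst (j <_) (sym p≡) (m<m+n j (s≤s z≤n))) ≤-refl))))
                     (trans (𝔹ₚ.xor-identityʳ (odd j)) (sym (trans (cong odd sp≡) (trans (odd-+ j (suc (suc d))) (trans (cong (odd j xor_) e) (𝔹ₚ.xor-identityʳ (odd j)))))))
... | j , zero , k≡ , Mj , none , s≡ = trans s≡ (cong odd (sym (trans k≡ (+-identityʳ j))))
... | j , suc d , k≡ , Mj , none , s≡ = contradiction Mk (none k (subst (j <_) (sym k≡) (m<m+n j (s≤s z≤n))) ≤-refl)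

-- Positions on a path

distance-one : ∀ a b → ∣ a - b ∣ ≡ 1 → a ≡ suc b ⊎ b ≡ suc a
distance-one zero    b       e = inj₂ e
distance-one (suc a) zero    e = inj₁ e
distance-one (suc a) (suc b) e with distance-one a b e
... | inj₁ p = inj₁ (cong suc p)
... | inj₂ p = inj₂ (cong suc p)

distance-one-odd : ∀ a b → ∣ a - b ∣ ≡ 1 → odd a ≡ not (odd b)
distance-one-odd a b e with distance-one a b e
... | inj₁ refl = refl
... | inj₂ refl = sym (𝔹ₚ.not-involutive _)

no-triangle : ∀ a b c → ∣ a - b ∣ ≡ 1 → ∣ a - c ∣ ≡ 1 → ∣ c - b ∣ ≡ 1 → 𝟘
no-triangle a b c ab ac cb = 𝔹ₚ.not-¬ {odd c} {odd c} refl
  (trans (distance-one-odd c b cb) (trans (sym (distance-one-odd a b ab)) (distance-one-odd a c ac)))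

gap-+ : ∀ c d → ∣ c - (d + c) ∣ ≡ d
gap-+ c d = trans (cong (∣ c -_∣) (+-comm d c)) (∣m-m+n∣≡n c d)

gap-+′ : ∀ c d → ∣ (d + c) - c ∣ ≡ d
gap-+′ c d = trans (∣-∣-comm (d + c) c) (gap-+ c d)

Distant : ℕ → ℕ → Set
Distant a b = a ≢ b × ∣ a - b ∣ ≢ 1

distant-+ : ∀ c d → Distant c (suc (suc d) + c)
distant-+ c d = (λ e → contradiction (trans (sym (gap-+ c (suc (suc d)))) (trans (cong (∣ c -_∣) (sym e)) (∣n-n∣≡0 c))) λ ()) ,
  λ e → contradiction (trans (sym (gap-+ c (suc (suc d)))) e) λ ()

distant-sym : ∀ {a b} → Distant a b → Distant b a
distant-sym {a} {b} (p , r) = p ∘ sym , λ e → r (trans (∣-∣-comm a b) e)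

-- In one direction or the other, `a′`, `a`, `b`, `b′` are four consecutive numbers.
four-in-line : ∀ a b a′ b′ → ∣ a - b ∣ ≡ 1 → ∣ a - a′ ∣ ≡ 1 → ∣ b - b′ ∣ ≡ 1 → a′ ≢ b → b′ ≢ a →
  Distant b a′ × Distant b′ a × Distant a′ b′
four-in-line a b a′ b′ ab aa bb a′≢b b′≢a with distance-one a b ab | distance-one a a′ aa | distance-one b b′ bb
... | inj₁ refl | inj₁ refl | _         = contradiction refl a′≢b
... | inj₁ refl | inj₂ refl | inj₂ refl = contradiction refl b′≢a
... | inj₁ refl | inj₂ refl | inj₁ refl = distant-+ b 0 , distant-+ b′ 0 , distant-sym (distant-+ b′ 1)
... | inj₂ refl | inj₂ refl | _         = contradiction refl a′≢b
... | inj₂ refl | inj₁ refl | inj₁ refl = contradiction refl b′≢a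
... | inj₂ refl | inj₁ refl | inj₂ refl = distant-sym (distant-+ a′ 0) , distant-sym (distant-+ a 0) , distant-+ a′ 1

-- The Roussel–Rubio lemma

-- `q` is an antipath whose ends see nothing of `F₀`. In `paths` and `antipaths`, which express
-- balance, the lists are interiors, so an odd number of vertices means even length. The quantity
-- followed through the induction is `count F`, the parity of the number of antipath edges with both
-- ends free of neighbours in `F`.
module RousselRubio {n : ℕ} (G : Graph n) (F₀ B : Subset n) (q : ℕ → Fin n) (k : ℕ)
  (path : InducedPaths.Path (complement G) q k)
  (q∉ : ∀ i → i ≤ k → q i ∉ F₀) (q∈B : ∀ i → 0 < i → i < k → q i ∈ B)
  (free-first : ∀ f → f ∈ F₀ → ¬ Adj G (q 0) f) (free-last : ∀ f → f ∈ F₀ → ¬ Adj G (q k) f)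
  (no-hole : InducedPaths.NoOddHole G) (no-antihole : InducedPaths.NoOddHole (complement G))
  (paths : ∀ u v m ms → u ∈ B → v ∈ B → All (_∈ F₀) (m ∷ ms) → InducedPaths.Ind G (u ∷ (m ∷ ms) ++ v ∷ []) →
    odd (length (m ∷ ms)) ≡ true)
  (antipaths : ∀ u v m ms → u ∈ F₀ → v ∈ F₀ → All (_∈ B) (m ∷ ms) → InducedPaths.Ind (complement G) (u ∷ (m ∷ ms) ++ v ∷ []) →
    odd (length (m ∷ ms)) ≡ true)
  where

  open Connectivity G
  private
    module P = InducedPaths G
    module Q = InducedPaths (complement G)
    seg = Q.seg q k

  q-inj : ∀ {i j} → i ≤ k → j ≤ k → i ≢ j → q i ≢ q j
  q-inj i≤ j≤ i≢j e = i≢j (proj₂ path _ _ i≤ j≤ e)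

  q≢F : ∀ {i f} → i ≤ k → f ∈ F₀ → q i ≢ f
  q≢F i≤ f∈ refl = q∉ _ i≤ f∈

  q-adj : ∀ {i j} → i ≤ k → j ≤ k → i ≢ j → ∣ i - j ∣ ≢ 1 → Adj G (q i) (q j)
  q-adj i≤ j≤ i≢j far = adj-stable G λ ¬a → far (Equivalence.to (proj₁ path _ _ i≤ j≤) (q-inj i≤ j≤ i≢j , ¬a))

  q-apart : ∀ {i j} → i ≤ k → j ≤ k → ∣ i - j ∣ ≡ 1 → P.Apart (q i) (q j)
  q-apart i≤ j≤ e = Equivalence.from (proj₁ path _ _ i≤ j≤) e

  -- The two ends of the antipath have no neighbour in `F₀`, so a vertex that has one is interior.
  touching⇒B : ∀ {i f} → i ≤ k → f ∈ F₀ → Adj G (q i) f → q i ∈ B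
  touching⇒B {zero} i≤ f∈ a = contradiction a (free-first _ f∈)
  touching⇒B {suc i} i≤ f∈ a with m≤n⇒m<n∨m≡n i≤
  ... | inj₁ i< = q∈B (suc i) (s≤s z≤n) i<
  ... | inj₂ refl = contradiction a (free-last _ f∈)

  Free : Subset n → ℕ → Set
  Free S i = ∀ f → f ∈ S → ¬ Adj G (q i) f

  FreePair : Subset n → ℕ → Set
  FreePair S i = Free S i × Free S (suc i)

  abstract
    freePair? : ∀ S i → Dec (FreePair S i)
    freePair? S i = free? S i ×-dec free? S (suc i)
      where
      free? : ∀ S i → Dec (Free S i)
      free? S i = all? λ f → (f ∈? S) →-dec ¬? (adj? G (q i) f)

  count : Subset n → Bool
  count S = xorSum k (λ i → does (freePair? S i))

  Miss : Fin n → ℕ → Set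
  Miss x i = ¬ Adj G (q i) x × ¬ Adj G (q (suc i)) x

  abstract
    miss? : ∀ x i → Dec (Miss x i)
    miss? x i = ¬? (adj? G (q i) x) ×-dec ¬? (adj? G (q (suc i)) x)

  ¬miss : ∀ {x i} → ¬ Miss x i → ∃[ a ] (a ≡ i ⊎ a ≡ suc i) × Adj G (q a) x
  ¬miss {x} {i} h with adj? G (q i) x | adj? G (q (suc i)) x
  ... | yes p | _ = i , inj₁ refl , p
  ... | no _  | yes p = suc i , inj₂ refl , p
  ... | no a  | no b = contradiction (a , b) h

  one-of≤ : ∀ {i a} → i < k → a ≡ i ⊎ a ≡ suc i → a ≤ k
  one-of≤ i<k (inj₁ refl) = <⇒≤ i<k
  one-of≤ i<k (inj₂ refl) = i<k

  one-of-free : ∀ {S i a} → FreePair S i → a ≡ i ⊎ a ≡ suc i → Free S a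
  one-of-free (f , _) (inj₁ refl) = f
  one-of-free (_ , f) (inj₂ refl) = f

  consecutive : ∀ {i a b} → a ≡ i ⊎ a ≡ suc i → b ≡ i ⊎ b ≡ suc i → a ≢ b → ∣ a - b ∣ ≡ 1
  consecutive (inj₁ refl) (inj₁ refl) h = contradiction refl h
  consecutive {i} (inj₁ refl) (inj₂ refl) h = trans (m≤n⇒∣m-n∣≡n∸m (n≤1+n i)) (m+n∸n≡m 1 i)
  consecutive {i} (inj₂ refl) (inj₁ refl) h = trans (m≤n⇒∣n-m∣≡n∸m (n≤1+n i)) (m+n∸n≡m 1 i)
  consecutive (inj₂ refl) (inj₂ refl) h = contradiction refl h

  module _ (F : Subset n) (F⊆ : F ⊆ F₀) (clique : IsClique G F) where
    private
      Mark : List (Fin n) → ℕ → Set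
      Mark Z i = Any (λ z → ¬ Adj G (q i) z) Z

      mark? : ∀ Z i → Dec (Mark Z i)
      mark? Z i = AnyDec.any? (λ z → ¬? (adj? G (q i) z)) Z

      witness : ∀ {Z i} → All (_∈ F) Z → Mark Z i → ∃[ z ] z ∈ F × ¬ Adj G (q i) z × (∀ {P : Fin n → Set} → P z → Any P Z)
      witness (z∈ ∷ _) (here ¬a) = _ , z∈ , ¬a , here
      witness (_ ∷ zs) (there m) with witness zs m
      ... | z , z∈ , ¬a , put = z , z∈ , ¬a , λ p → there (put p)

      unmarked : ∀ {Z i z} → ¬ Mark Z i → (∀ {P : Fin n → Set} → P z → Any P Z) → Adj G (q i) z
      unmarked h put = adj-stable G λ ¬a → h (put ¬a)

      -- Vertices inside the gap are complete to `Z`. If `z` or `z′` is nonadjacent to both `q i`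
      -- and `q j`, it closes this stretch of the antipath to an antihole; otherwise
      -- `z – q i – ⋯ – q j – z′` is an antipath with adjacent ends and interior in `B`. Either way
      -- the gap is even.
      gap : ∀ Z → All (_∈ F) Z → ∀ i d → i + suc d ≤ k → Mark Z i → Mark Z (i + suc d) →
        (∀ j → i < j → j < i + suc d → ¬ Mark Z j) → d ≡ 0 ⊎ odd (suc d) ≡ false
      gap Z Z⊆ i zero le _ _ _ = inj₁ refl
      gap Z Z⊆ i (suc d) le mi mj none with witness Z⊆ mi | witness Z⊆ mj
      ... | z , z∈ , ¬iz , put | z′ , z′∈ , ¬jz′ , put′ = inj₂ (cong not even)
        where
        j = i + suc (suc d)
        i≤ : i ≤ k
        i≤ = ≤-trans (m≤m+n i _) le
        ms = seg (suc (suc i)) d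
        inner : ∀ {t} → (∀ {P : Fin n → Set} → P t → Any P Z) → ∀ l → suc i ≤ l → l < suc i + suc d → Adj G (q l) t
        inner put l i<l l< = unmarked (none l i<l (≤-trans l< (≤-reflexive (sym (+-suc i (suc d)))))) put
        l≤k : ∀ {l} → l < suc i + suc d → l ≤ k
        l≤k l< = ≤-trans (<⇒≤ l<) (≤-trans (≤-reflexive (sym (+-suc i (suc d)))) le)
        apart : ∀ {t} → t ∈ F → (∀ {P : Fin n → Set} → P t → Any P Z) → ∀ l → suc i ≤ l → l < suc i + suc d → Q.Apart t (q l)
        apart t∈ put l a b = (q≢F (l≤k b) (F⊆ t∈) ∘ sym) , λ (_ , ¬a) → ¬a (adj-sym G (inner put l a b))
        co : ∀ {l t} → l ≤ k → t ∈ F → ¬ Adj G (q l) t → Adj (complement G) (q l) t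
        co l≤ t∈ ¬a = q≢F l≤ (F⊆ t∈) , ¬a
        whole : Q.Ind (q i ∷ seg (suc i) (suc d) ++ q j ∷ [])
        whole = subst (λ x → Q.Ind (q i ∷ x)) (trans (Q.seg-snoc q k (suc i) (suc d)) (cong (λ l → seg (suc i) (suc d) ++ q l ∷ []) (sym (+-suc i (suc d)))))
                  (Q.seg-ind q k path i (suc (suc d)) le)
        len : ∀ {b} → odd (length (seg (suc i) (suc d))) ≡ b → odd (suc d) ≡ b
        len {b} = subst (λ l → odd l ≡ b) (Q.length-seg q k (suc i) (suc d))
        by-apex : ∀ t → t ∈ F → (∀ {P : Fin n → Set} → P t → Any P Z) → ¬ Adj G (q i) t → ¬ Adj G (q j) t → odd (suc d) ≡ true
        by-apex t t∈ put ¬it ¬jt = len (Q.Parity.apex no-antihole (q i) (q (suc i)) ms (q j) t whole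
          (co i≤ t∈ ¬it) (co le t∈ ¬jt) (Q.seg-all q k (suc i) (suc d) (apart t∈ put)))
        even : odd (suc d) ≡ true
        even with adj? G (q i) z′ | adj? G (q j) z
        ... | no ¬iz′ | _ = by-apex z′ z′∈ put′ ¬iz′ ¬jz′
        ... | yes _ | no ¬jz = by-apex z z∈ put ¬iz ¬jz
        ... | yes iz′ | yes jz = trans (sym (𝔹ₚ.not-involutive _)) (trans (cong (not ∘ not) (sym (trans (cong odd length≡) (odd-+2 (suc d))))) (trans (𝔹ₚ.not-involutive _)
                (antipaths z z′ (q i) (seg (suc i) (suc d) ++ q j ∷ []) (F⊆ z∈) (F⊆ z′∈) all∈B
                  (subst (λ x → Q.Ind (z ∷ q i ∷ x)) (sym (++-assoc (seg (suc i) (suc d)) (q j ∷ []) (z′ ∷ []))) ind))))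
          where
          odd-+2 : ∀ a → odd (suc (suc a)) ≡ odd a
          odd-+2 a = 𝔹ₚ.not-involutive (odd a)
          length≡ : length (q i ∷ seg (suc i) (suc d) ++ q j ∷ []) ≡ suc (suc (suc d))
          length≡ = cong suc (trans (length-++ (seg (suc i) (suc d))) (trans (cong (_+ 1) (Q.length-seg q k (suc i) (suc d))) (+-comm (suc d) 1)))
          z~z′ : Adj G z z′
          z~z′ = clique z z′ z∈ z′∈ λ { refl → ¬iz iz′ }
          apart-zz′ : Q.Apart z z′
          apart-zz′ = (λ { refl → ¬iz iz′ }) , λ (_ , ¬a) → ¬a z~z′
          ∈B : ∀ l → suc i ≤ l → l < suc i + suc d → q l ∈ B
          ∈B l a b = q∈B l (≤-trans (s≤s z≤n) a) (≤-trans b (≤-trans (≤-reflexive (sym (+-suc i (suc d)))) le))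
          all∈B : All (_∈ B) (q i ∷ seg (suc i) (suc d) ++ q j ∷ [])
          all∈B = touching⇒B i≤ (F⊆ z′∈) iz′ ∷ ++⁺ (Q.seg-all q k (suc i) (suc d) ∈B) (touching⇒B le (F⊆ z∈) jz ∷ [])
          zj : Q.Apart z (q j)
          zj = (q≢F le (F⊆ z∈) ∘ sym) , λ (_ , ¬a) → ¬a (adj-sym G jz)
          ind : Q.Ind (z ∷ q i ∷ seg (suc i) (suc d) ++ q j ∷ z′ ∷ [])
          ind = adj-sym (complement G) (co i≤ z∈ ¬iz) ,
            ++⁺ (Q.seg-all q k (suc i) (suc d) (apart z∈ put)) (zj ∷ apart-zz′ ∷ []) ,
            Q.ind-append (q i ∷ seg (suc i) (suc d)) (q j) (z′ ∷ []) whole (co le z′∈ ¬jz′ , [] , tt)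
              (((q≢F i≤ (F⊆ z′∈) , λ (_ , ¬a) → ¬a iz′) ∷ []) ∷
               All.map (λ p → Q.apart-sym p ∷ []) (Q.seg-all q k (suc i) (suc d) (apart z′∈ put′)))

      anyMiss? : ∀ Z i → Dec (Any (λ z → Miss z i) Z)
      anyMiss? Z i = AnyDec.any? (λ z → miss? z i) Z

      allMiss? : ∀ S i → Dec (All (λ z → Miss z i) S)
      allMiss? S i = All.all? (λ z → miss? z i) S

      -- Two consecutive marked vertices have a common non-neighbour in Z, as
      -- otherwise q i – z′ – z – q (i + 1) is an odd path.
      common : ∀ Z → All (_∈ F) Z → ∀ i → i < k → Mark Z i → Mark Z (suc i) → Any (λ z → Miss z i) Z
      common Z Z⊆ i i<k mi mj with witness Z⊆ mi | witness Z⊆ mj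
      ... | z , z∈ , ¬iz , put | z′ , z′∈ , ¬jz′ , put′ with adj? G (q i) z′ | adj? G (q (suc i)) z
      ...   | no ¬iz′ | _ = put′ (¬iz′ , ¬jz′)
      ...   | yes _ | no ¬jz = put (¬iz , ¬jz)
      ...   | yes iz′ | yes jz = contradiction
              (paths (q i) (q (suc i)) z′ (z ∷ []) (touching⇒B i≤ (F⊆ z′∈) iz′) (touching⇒B i<k (F⊆ z∈) jz) (F⊆ z′∈ ∷ F⊆ z∈ ∷ [])
                (iz′ , (q≢F i≤ (F⊆ z∈) , ¬iz) ∷ q-apart i≤ i<k (consecutive {i} (inj₁ refl) (inj₂ refl) (<⇒≢ ≤-refl)) ∷ [] ,
                 clique z′ z z′∈ z∈ (λ { refl → ¬iz iz′ }) , ((q≢F i<k (F⊆ z′∈) ∘ sym) , ¬jz′ ∘ adj-sym G) ∷ [] ,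
                 adj-sym G jz , [] , tt)) λ ()
        where
        i≤ : i ≤ k
        i≤ = <⇒≤ i<k

      -- The ends of the antipath are marked. By `common`, the edges missed by some member of the
      -- list are those with both ends marked, which `scan` counts.
      meeting : ∀ z Z → All (_∈ F) (z ∷ Z) → xorSum k (λ i → does (anyMiss? (z ∷ Z) i)) ≡ odd k
      meeting z Z Z⊆@(z∈ ∷ _) = trans (xorSum-cong k same)
        (scan (mark? (z ∷ Z)) k (here (free-first z (F⊆ z∈))) (here (free-last z (F⊆ z∈))) (gap (z ∷ Z) Z⊆))
        where
        same : ∀ i → i < k → does (anyMiss? (z ∷ Z) i) ≡ does (mark? (z ∷ Z) i ×-dec mark? (z ∷ Z) (suc i))
        same i i<k = does-⇔ (mk⇔ (λ m → AnyDec.map proj₁ m , AnyDec.map proj₂ m) (λ (a , b) → common (z ∷ Z) Z⊆ i i<k a b))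
          (anyMiss? (z ∷ Z) i) (mark? (z ∷ Z) i ×-dec mark? (z ∷ Z) (suc i))

      -- Inclusion–exclusion over the elements of S.
      containing : ∀ S z Z → All (_∈ F) S → All (_∈ F) (z ∷ Z) →
        xorSum k (λ i → does (allMiss? S i) ∧ does (anyMiss? (z ∷ Z) i)) ≡ odd k
      containing [] z Z _ Z⊆ = meeting z Z Z⊆
      containing (x ∷ S) z Z (x∈ ∷ S⊆) Z⊆ = xorSum-exchange k (odd k)
        -- With `S` held fixed, an edge missed by `x` and by a member of `Z`, plus one missed by `x`
        -- or by a member of `Z`, equals one missed by `x` plus one missed by a member of `Z`.
        (λ i _ → identity (does (miss? x i)) (does (allMiss? S i)) (does (anyMiss? (z ∷ Z) i)))
        (containing S x (z ∷ Z) S⊆ (x∈ ∷ Z⊆)) (containing S x [] S⊆ (x∈ ∷ [])) (containing S z Z S⊆ Z⊆)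
        where
        identity : ∀ t a o → ((t ∧ a) ∧ o) xor (a ∧ (t ∨ o)) ≡ (a ∧ (t ∨ false)) xor (a ∧ o)
        identity true  true  true  = refl
        identity true  true  false = refl
        identity true  false o     = refl
        identity false true  true  = refl
        identity false true  false = refl
        identity false false o     = refl

    -- `containing` for all of `F` and the list of one element `f` of `F`, whose condition is
    -- already implied.
    count-clique : Nonempty F → count F ≡ odd k
    count-clique (f , f∈) = trans (xorSum-cong k same) (containing elems f [] elems∈ (f∈ ∷ []))
      where
      elems : List (Fin n)
      elems = filter (_∈? F) (allFin n)
      elems∈ : All (_∈ F) elems
      elems∈ = All.tabulate λ x∈ → proj₂ (∈-filter⁻ (_∈? F) {xs = allFin n} x∈)
      same : ∀ i → i < k → does (freePair? F i) ≡ does (allMiss? elems i) ∧ does (anyMiss? (f ∷ []) i)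
      same i _ = does-⇔ (mk⇔
        (λ (a , b) → All.map (λ {x} x∈ → a x x∈ , b x x∈) elems∈ , here (a f f∈ , b f f∈))
        (λ (all , _) → (λ x x∈ → proj₁ (All.lookup all (∈-filter⁺ (_∈? F) (∈-allFin x) x∈))) ,
                       (λ x x∈ → proj₂ (All.lookup all (∈-filter⁺ (_∈? F) (∈-allFin x) x∈)))))
        (freePair? F i) (allMiss? elems i ×-dec anyMiss? (f ∷ []) i)

  restrict : ∀ S T {i} → S ⊆ T → FreePair T i → FreePair S i
  restrict S T S⊆T (f , g) = (λ x x∈ → f x (S⊆T x∈)) , (λ x x∈ → g x (S⊆T x∈))

  ⊖⊆ : ∀ (F : Subset n) x → F ⊖ x ⊆ F
  ⊖⊆ F x v∈ = proj₁ (∈-⁻ F x v∈)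

  extend : ∀ F x {i} → FreePair (F ⊖ x) i → Miss x i → FreePair F i
  extend F x (f , g) (mf , mg) = add f mf , add g mg
    where
    add : ∀ {i} → Free (F ⊖ x) i → ¬ Adj G (q i) x → Free F i
    add f m y y∈ with y ≟ x
    ... | yes refl = m
    ... | no y≢x = f y (x∈p∧x≢y⇒x∈p-y y∈ y≢x)

  module Pair (F : Subset n) (F⊆ : F ⊆ F₀) (x₁ x₂ : Fin n) (x₁∈ : x₁ ∈ F) (x₂∈ : x₂ ∈ F) (x₁≢x₂ : x₁ ≢ x₂) (nonadj : ¬ Adj G x₁ x₂)
    (m : Fin n) (ms : List (Fin n)) (ms∈ : All (_∈ F) (m ∷ ms)) (ind : P.Ind (x₁ ∷ (m ∷ ms) ++ x₂ ∷ [])) where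

    private
      open P.Parity no-hole

      κ = odd k

      inner : All (λ x → x ∈ F × (x₁ ≢ x × x₂ ≢ x)) (m ∷ ms)
      inner = All.zip (ms∈ , P.interior-≢ x₁ (m ∷ ms) x₂ ind)

      Touching : Fin n → ℕ → Set
      Touching x a = Adj G (q a) x × Free (F ⊖ x) a

      apart₁ : ∀ {a x} → a ≤ k → Free (F ⊖ x₁) a → x ∈ F × (x₁ ≢ x × x₂ ≢ x) → P.Apart x (q a)
      apart₁ a≤ f (x∈ , x₁≢ , _) = (q≢F a≤ (F⊆ x∈) ∘ sym) , f _ (x∈p∧x≢y⇒x∈p-y x∈ (x₁≢ ∘ sym)) ∘ adj-sym G

      apart₂ : ∀ {a x} → a ≤ k → Free (F ⊖ x₂) a → x ∈ F × (x₁ ≢ x × x₂ ≢ x) → P.Apart x (q a)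
      apart₂ a≤ f (x∈ , _ , x₂≢) = (q≢F a≤ (F⊆ x∈) ∘ sym) , f _ (x∈p∧x≢y⇒x∈p-y x∈ (x₂≢ ∘ sym)) ∘ adj-sym G

      x₂∈₁ : x₂ ∈ F ⊖ x₁
      x₂∈₁ = x∈p∧x≢y⇒x∈p-y x₂∈ (x₁≢x₂ ∘ sym)

      x₁∈₂ : x₁ ∈ F ⊖ x₂
      x₁∈₂ = x∈p∧x≢y⇒x∈p-y x₁∈ x₁≢x₂

      x₂-apart : ∀ {a} → a ≤ k → ¬ Adj G (q a) x₂ → P.Apart x₂ (q a)
      x₂-apart a≤ h = (q≢F a≤ (F⊆ x₂∈) ∘ sym) , h ∘ adj-sym G

      apart-x₁ : ∀ {a} → a ≤ k → ¬ Adj G (q a) x₁ → P.Apart (q a) x₁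
      apart-x₁ a≤ h = q≢F a≤ (F⊆ x₁∈) , h

      x₂-apart-x₁ : P.Apart x₂ x₁
      x₂-apart-x₁ = x₁≢x₂ ∘ sym , nonadj ∘ adj-sym G

    -- An odd number of interior vertices, so the path from `x₁` to `x₂` has even length.
    module _ (even : odd (length (m ∷ ms)) ≡ true) where

      -- Otherwise `q a` and `q b` are adjacent in `G`, and `x₂ – q b – q a – x₁` closes the even
      -- path to an odd hole.
      touching-consecutive : ∀ {a b} → a ≤ k → b ≤ k → Touching x₁ a → Touching x₂ b → ∣ a - b ∣ ≡ 1
      touching-consecutive {a} {b} a≤ b≤ (ax , fa) (bx , fb) with ∣ a - b ∣ ℕₚ.≟ 1
      ... | yes e = e
      ... | no far = contradiction (trans (sym even) (glue x₁ m ms x₂ (q b) (q a ∷ []) ind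
              (adj-sym G bx , x₂-apart a≤ (fa x₂ x₂∈₁) ∷ x₂-apart-x₁ ∷ [] ,
               adj-sym G (q-adj a≤ b≤ (λ { refl → fa x₂ x₂∈₁ bx }) far) , apart-x₁ b≤ (fb x₁ x₁∈₂) ∷ [] , ax , [] , tt)
              (All.map (λ x∈ → apart₂ b≤ fb x∈ ∷ apart₁ a≤ fa x∈ ∷ []) inner))) λ ()

      private
        Witness : Fin n → Set
        Witness x = ∃₂ λ a a′ → (a ≤ k × a′ ≤ k) × ∣ a - a′ ∣ ≡ 1 × Touching x a × Free (F ⊖ x) a′

        differ : ∀ x {i} (d : Dec (FreePair F i)) (d′ : Dec (FreePair (F ⊖ x) i)) → does d ≢ does d′ → FreePair (F ⊖ x) i × ¬ Miss x i
        differ x (yes _) (yes _) h = contradiction refl h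
        differ x (no _)  (no _)  h = contradiction refl h
        differ x (yes f) (no ¬f) h = contradiction (restrict (F ⊖ x) F (⊖⊆ F x) f) ¬f
        differ x (no ¬f) (yes f) h = f , λ miss → ¬f (extend F x f miss)

        -- The two counts differ at some edge of the antipath. That edge is free from `F ⊖ x` but
        -- has an end adjacent to `x`.
        witness : ∀ {x} → count F ≢ κ → count (F ⊖ x) ≡ κ → Witness x
        witness {x} h e with xorSum-differ k {λ i → does (freePair? F i)} {λ i → does (freePair? (F ⊖ x) i)} (λ eq → h (trans eq e))
        ... | i , i<k , neq with differ x {i} (freePair? F i) (freePair? (F ⊖ x) i) neq
        ...   | fp , ¬m with ¬miss ¬m
        ...     | a , inj₁ refl , ax = i , suc i , (<⇒≤ i<k , i<k) , consecutive {i} (inj₁ refl) (inj₂ refl) (<⇒≢ ≤-refl) ,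
                    (ax , proj₁ fp) , proj₂ fp
        ...     | a , inj₂ refl , ax = suc i , i , (i<k , <⇒≤ i<k) , consecutive {i} (inj₂ refl) (inj₁ refl) (<⇒≢ ≤-refl ∘ sym) ,
                    (ax , proj₂ fp) , proj₁ fp

      -- The pairs witnessing that count changes when x₁, respectively x₂, is
      -- removed form a subpath a′ – a – b – b′ of the antipath, which closes
      -- the path from x₁ to x₂ to an odd hole.
      even-path-count : count F ≢ κ → count (F ⊖ x₁) ≡ κ → count (F ⊖ x₂) ≡ κ → 𝟘
      even-path-count h e₁ e₂ with witness h e₁ | witness h e₂
      ... | a , a′ , (a≤ , a′≤) , aa , (ax , fa) , fa′ | b , b′ , (b≤ , b′≤) , bb , (bx , fb) , fb′ =
          -- The complement of the four-vertex path `a′ – a – b – b′` is the path `b – a′ – b′ – a`,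
          -- whose ends are attached to `x₂` and `x₁`.
          contradiction (trans (sym even) (glue x₁ m ms x₂ (q b) (q a′ ∷ q b′ ∷ q a ∷ []) ind
            (adj-sym G bx , x₂-apart a′≤ (fa′ x₂ x₂∈₁) ∷ x₂-apart b′≤ ¬b′x₂ ∷ x₂-apart a≤ (fa x₂ x₂∈₁) ∷ x₂-apart-x₁ ∷ [] ,
             adj′ b≤ a′≤ (proj₁ line) , q-apart b≤ b′≤ bb ∷ q-apart b≤ a≤ (trans (∣-∣-comm b a) ab) ∷ apart-x₁ b≤ (fb x₁ x₁∈₂) ∷ [] ,
             adj′ a′≤ b′≤ (proj₂ (proj₂ line)) , q-apart a′≤ a≤ (trans (∣-∣-comm a′ a) aa) ∷ apart-x₁ a′≤ ¬a′x₁ ∷ [] ,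
             adj′ b′≤ a≤ (proj₁ (proj₂ line)) , apart-x₁ b′≤ (fb′ x₁ x₁∈₂) ∷ [] ,
             ax , [] , tt)
            (All.map (λ x∈ → apart₂ b≤ fb x∈ ∷ apart₁ a′≤ fa′ x∈ ∷ apart₂ b′≤ fb′ x∈ ∷ apart₁ a≤ fa x∈ ∷ []) inner))) λ ()
        where
        ab : ∣ a - b ∣ ≡ 1
        ab = touching-consecutive a≤ b≤ (ax , fa) (bx , fb)
        -- If `q a′` were adjacent to `x₁` too, then `a`, `a′` and `b` would be pairwise at distance
        -- one.
        ¬a′x₁ : ¬ Adj G (q a′) x₁
        ¬a′x₁ a′x = no-triangle a b a′ ab aa (touching-consecutive a′≤ b≤ (a′x , fa′) (bx , fb))
        ¬b′x₂ : ¬ Adj G (q b′) x₂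
        ¬b′x₂ b′x = no-triangle b a b′ (trans (∣-∣-comm b a) ab) bb
          (trans (∣-∣-comm b′ a) (touching-consecutive a≤ b′≤ (ax , fa) (b′x , fb′)))
        line = four-in-line a b a′ b′ ab aa bb (λ { refl → fa′ x₂ x₂∈₁ bx }) (λ { refl → fb′ x₁ x₁∈₂ ax })
        adj′ : ∀ {i j} → i ≤ k → j ≤ k → Distant i j → Adj G (q i) (q j)
        adj′ i≤ j≤ (i≢j , far) = q-adj i≤ j≤ i≢j far

    module _ (odd-path : odd (length (m ∷ ms)) ≡ false) where

      private
        F′ = F ⊖ x₁ ⊖ x₂

        apart₁₂ : ∀ {a x} → a ≤ k → Free F′ a → x ∈ F × (x₁ ≢ x × x₂ ≢ x) → P.Apart x (q a)
        apart₁₂ a≤ f (x∈ , x₁≢ , x₂≢) = (q≢F a≤ (F⊆ x∈) ∘ sym) ,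
          f _ (x∈p∧x≢y⇒x∈p-y (x∈p∧x≢y⇒x∈p-y x∈ (x₁≢ ∘ sym)) (x₂≢ ∘ sym)) ∘ adj-sym G

        -- A common neighbour `q a` would close the path of odd length to an odd hole.
        no-common : ∀ {a} → a ≤ k → Free F′ a → Adj G (q a) x₁ → Adj G (q a) x₂ → 𝟘
        no-common {a} a≤ f ax bx = contradiction (trans (sym odd-path) (apex x₁ m ms x₂ (q a) ind (adj-sym G ax) (adj-sym G bx)
          (All.map (λ x∈ → P.apart-sym (apart₁₂ a≤ f x∈)) inner))) λ ()

        -- The two ends of the edge would see one of `x₁`, `x₂` each, and prolong the path between
        -- these to an odd path with nonadjacent ends in `B` and interior in `F₀`.
        no-bad : ∀ {i} → i < k → FreePair F′ i → ¬ Miss x₁ i → ¬ Miss x₂ i → 𝟘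
        no-bad {i} i<k fp h₁ h₂ with ¬miss h₁ | ¬miss h₂
        ... | a , a∈ , ax | b , b∈ , bx = contradiction
            (trans (sym odd₂) (paths (q a) (q b) x₁ ((m ∷ ms) ++ x₂ ∷ []) (touching⇒B a≤ (F⊆ x₁∈) ax) (touching⇒B b≤ (F⊆ x₂∈) bx)
              (F⊆ x₁∈ ∷ ++⁺ (All.map F⊆ ms∈) (F⊆ x₂∈ ∷ []))
              (ax , subst (P.Far (q a)) (sym (++-assoc (m ∷ ms) (x₂ ∷ []) (q b ∷ []))) (++⁺ (All.map (λ x∈ → P.apart-sym (apart₁₂ a≤ fa x∈)) inner) beyond) ,
               subst (λ l → P.Ind (x₁ ∷ l)) (sym (++-assoc (m ∷ ms) (x₂ ∷ []) (q b ∷ [])))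
                 (P.ind-append (x₁ ∷ m ∷ ms) x₂ (q b ∷ []) ind (adj-sym G bx , [] , tt)
                   ((P.apart-sym (apart-x₁ b≤ ¬bx₁) ∷ []) ∷ All.map (λ x∈ → apart₁₂ b≤ fb x∈ ∷ []) inner))))) λ ()
          where
          a≤ = one-of≤ i<k a∈
          b≤ = one-of≤ i<k b∈
          fa = one-of-free {F′} fp a∈
          fb = one-of-free {F′} fp b∈
          ¬ax₂ : ¬ Adj G (q a) x₂
          ¬ax₂ = no-common a≤ fa ax
          ¬bx₁ : ¬ Adj G (q b) x₁
          ¬bx₁ e = no-common b≤ fb e bx
          beyond : P.Far (q a) (x₂ ∷ q b ∷ [])
          beyond = P.apart-sym (x₂-apart a≤ ¬ax₂) ∷ q-apart a≤ b≤ (consecutive a∈ b∈ λ { refl → ¬ax₂ bx }) ∷ []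
          odd₂ : odd (length (x₁ ∷ (m ∷ ms) ++ x₂ ∷ [])) ≡ false
          odd₂ = trans (cong (odd ∘ suc) (trans (length-++ (m ∷ ms)) (+-comm (length (m ∷ ms)) 1)))
                   (trans (𝔹ₚ.not-involutive _) odd-path)

        swap : F′ ⊆ F ⊖ x₂
        swap v∈ = let a , b = ∈-⁻ (F ⊖ x₁) x₂ v∈ in x∈p∧x≢y⇒x∈p-y (⊖⊆ F x₁ a) b

        -- If the edge is not free from `F′`, all four terms vanish. If it is, then by `no-bad` it
        -- is missed by `x₁` or by `x₂`, and the identity is inclusion-exclusion.
        exchange : ∀ i → i < k → (d′ : Dec (FreePair F′ i)) →
          does (freePair? F i) xor does d′ ≡ does (freePair? (F ⊖ x₁) i) xor does (freePair? (F ⊖ x₂) i)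
        exchange i i<k (no ¬f) = trans
          (cong (_xor false) (dec-false (freePair? F i) (λ f → ¬f (restrict F′ F (λ p → ⊖⊆ F x₁ (⊖⊆ (F ⊖ x₁) x₂ p)) f))))
          (sym (cong₂ _xor_ (dec-false (freePair? (F ⊖ x₁) i) (¬f ∘ restrict F′ (F ⊖ x₁) (⊖⊆ (F ⊖ x₁) x₂)))
                                    (dec-false (freePair? (F ⊖ x₂) i) (λ f → ¬f (restrict F′ (F ⊖ x₂) swap f)))))
        exchange i i<k (yes f) with miss? x₁ i | miss? x₂ i
        ... | no h₁ | no h₂ = ⊥-elim (no-bad i<k f h₁ h₂)
        ... | yes m₁ | yes m₂ = trans (cong (_xor true) (dec-true (freePair? F i) (extend F x₁ (extend (F ⊖ x₁) x₂ f m₂) m₁)))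
              (sym (cong₂ _xor_ (dec-true (freePair? (F ⊖ x₁) i) (extend (F ⊖ x₁) x₂ f m₂))
                               (dec-true (freePair? (F ⊖ x₂) i) (restrict (F ⊖ x₂) F (⊖⊆ F x₂) (extend F x₁ (extend (F ⊖ x₁) x₂ f m₂) m₁)))))
        ... | yes m₁ | no h₂ = trans (cong (_xor true) (dec-false (freePair? F i) (λ (p , r) → h₂ (p x₂ x₂∈ , r x₂ x₂∈))))
              (sym (cong₂ _xor_ (dec-false (freePair? (F ⊖ x₁) i) (λ (p , r) → h₂ (p x₂ x₂∈₁ , r x₂ x₂∈₁)))
                               (dec-true (freePair? (F ⊖ x₂) i) (extend (F ⊖ x₂) x₁ (subst (λ X → FreePair X i) (p─x─y≡p─y─x F x₁ x₂) f) m₁))))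
        ... | no h₁ | yes m₂ = trans (cong (_xor true) (dec-false (freePair? F i) (λ (p , r) → h₁ (p x₁ x₁∈ , r x₁ x₁∈))))
              (sym (cong₂ _xor_ (dec-true (freePair? (F ⊖ x₁) i) (extend (F ⊖ x₁) x₂ f m₂))
                               (dec-false (freePair? (F ⊖ x₂) i) (λ (p , r) → h₁ (p x₁ x₁∈₂ , r x₁ x₁∈₂)))))

      odd-path-count : count F′ ≡ κ → count (F ⊖ x₁) ≡ κ → count (F ⊖ x₂) ≡ κ → count F ≡ κ
      odd-path-count = xorSum-exchange k κ λ i i<k → exchange i i<k (freePair? F′ i)

  nonclique-pair : ∀ {F} → ¬ IsClique G F → ∃₂ λ u u′ → u ∈ F × u′ ∈ F × u′ ≢ u × ¬ Adj G u u′
  nonclique-pair {F} h with any? (λ u → any? λ u′ → (u ∈? F) ×-dec ((u′ ∈? F) ×-dec (¬? (u′ ≟ u) ×-dec ¬? (adj? G u u′))))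
  ... | yes r = r
  ... | no none = contradiction (λ u v u∈ v∈ u≢v → adj-stable G λ ¬a → none (u , v , u∈ , v∈ , u≢v ∘ sym , ¬a)) h

  module Step (F : Subset n) (F⊆ : F ⊆ F₀) (c : Conn F) (pair : NonadjacentPair F)
    (smaller : ∀ F′ → ∣ F′ ∣ < ∣ F ∣ → F′ ⊆ F₀ → Conn F′ → Nonempty F′ → count F′ ≡ odd k) where
    private
      open NonadjacentPair pair

      e₁ : count (F ⊖ x₁) ≡ odd k
      e₁ = smaller (F ⊖ x₁) (x∈p⇒∣p-x∣<∣p∣ x₁∈) (λ p → F⊆ (⊖⊆ F x₁ p)) conn₁ (x₂ , x∈p∧x≢y⇒x∈p-y x₂∈ (x₁≢x₂ ∘ sym))

      e₂ : count (F ⊖ x₂) ≡ odd k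
      e₂ = smaller (F ⊖ x₂) (x∈p⇒∣p-x∣<∣p∣ x₂∈) (λ p → F⊆ (⊖⊆ F x₂ p)) conn₂ (x₁ , x∈p∧x≢y⇒x∈p-y x₁∈ x₁≢x₂)

      module Along (m : Fin n) (ms : List (Fin n)) (ms∈ : All (_∈ F) (m ∷ ms)) (ind : P.Ind (x₁ ∷ (m ∷ ms) ++ x₂ ∷ [])) where
        open Pair F F⊆ x₁ x₂ x₁∈ x₂∈ x₁≢x₂ nonadj m ms ms∈ ind

        even-case : odd (length (m ∷ ms)) ≡ true → count F ≡ odd k
        even-case even = decidable-stable (count F 𝔹ₚ.≟ odd k) λ h → even-path-count even h e₁ e₂

        odd-case : Conn (F ⊖ x₁ ⊖ x₂) → odd (length (m ∷ ms)) ≡ false → count F ≡ odd k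
        odd-case c₁₂ odd-path = odd-path-count odd-path
          (smaller (F ⊖ x₁ ⊖ x₂) (≤-trans (s≤s (∣p─q∣≤∣p∣ (F ⊖ x₁) ⁅ x₂ ⁆)) (x∈p⇒∣p-x∣<∣p∣ x₁∈))
            (λ p → F⊆ (⊖⊆ F x₁ (⊖⊆ (F ⊖ x₁) x₂ p))) c₁₂
            (let x₁≢m , x₂≢m = All.head (P.interior-≢ x₁ (m ∷ ms) x₂ ind)
             in m , x∈p∧x≢y⇒x∈p-y (x∈p∧x≢y⇒x∈p-y (All.head ms∈) (x₁≢m ∘ sym)) (x₂≢m ∘ sym))) e₁ e₂

        either-case : Conn (F ⊖ x₁ ⊖ x₂) → ∀ b → odd (length (m ∷ ms)) ≡ b → count F ≡ odd k
        either-case c₁₂ true  = even-case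
        either-case c₁₂ false = odd-case c₁₂

      along : Conn (F ⊖ x₁ ⊖ x₂) → P.PathTo x₂ (_∈ F) x₁ → count F ≡ odd k
      along c₁₂ (inj₁ e) = contradiction e x₁≢x₂
      along c₁₂ (inj₂ ([] , _ , (a , _))) = contradiction a nonadj
      along c₁₂ (inj₂ (m ∷ ms , ms∈ , ind)) = Along.either-case m ms ms∈ ind c₁₂ _ refl

      by-alternative : (∃[ y ] y ∈ F × Adj G x₁ y × Adj G y x₂) ⊎ Conn (F ⊖ x₁ ⊖ x₂) → count F ≡ odd k
      by-alternative (inj₁ (y , y∈ , x₁y , yx₂)) =
        Along.even-case y [] (y∈ ∷ []) (x₁y , (x₁≢x₂ , nonadj) ∷ [] , yx₂ , [] , tt) refl
      by-alternative (inj₂ c₁₂) = along c₁₂ (P.walk⇒path x₂ (_∈ F) (conn⇒connected c x₁ x₂ x₁∈ x₂∈))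

    count-step : count F ≡ odd k
    count-step = by-alternative alternative

  count-connected : ∀ fuel F → ∣ F ∣ ≤ fuel → F ⊆ F₀ → Conn F → Nonempty F → count F ≡ odd k
  count-connected zero F le _ _ (x , x∈) = contradiction (≤-trans (x∈p⇒∣p-x∣<∣p∣ x∈) le) λ ()
  count-connected (suc fuel) F le F⊆ c ne = by-clique (clique? G F)
    where
    by-clique : Dec (IsClique G F) → count F ≡ odd k
    by-clique (yes cl) = count-clique F F⊆ cl ne
    by-clique (no ¬cl) = let u , u′ , u∈ , u′∈ , u′≢u , ¬uu′ = nonclique-pair ¬cl in
      Step.count-step F F⊆ c (nonadjacent-pair c u∈ u′∈ u′≢u ¬uu′)
        λ F′ lt → count-connected fuel F′ (≤-pred (≤-trans lt le))

  -- As `2 ≤ k`, each edge of the antipath has an interior end. No edge is free, and the count,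
  -- which has the parity of `k`, is zero.
  no-odd-antipath : Conn F₀ → Nonempty F₀ → 2 ≤ k → (∀ i → 0 < i → i < k → ¬ Free F₀ i) → odd k ≡ false
  no-odd-antipath c ne 2≤k touched = trans (sym (count-connected ∣ F₀ ∣ F₀ ≤-refl ⊆-refl c ne))
    (trans (xorSum-cong k zero-term) (zeros k))
    where
    zeros : ∀ k → xorSum k (λ _ → false) ≡ false
    zeros zero    = refl
    zeros (suc k) = trans (𝔹ₚ.xor-identityʳ _) (zeros k)
    zero-term : ∀ i → i < k → does (freePair? F₀ i) ≡ false
    zero-term zero i<k = dec-false (freePair? F₀ 0) λ (_ , f) → touched 1 ≤-refl 2≤k f
    zero-term (suc i) i<k = dec-false (freePair? F₀ (suc i)) λ (f , _) → touched (suc i) (s≤s z≤n) i<k f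

-- Skew partitions

-- A common form for odd paths and, over the complement, odd antipaths. Nonadjacent ends rule out
-- length one, hence the length `d + 2`.
record OddPath {n : ℕ} (H : Graph n) (X Y : Subset n) : Set where
  open InducedPaths H
  field
    d        : ℕ
    q        : ℕ → Fin n
    path     : Path q (suc (suc d))
    d-odd    : odd d ≡ true
    first∈   : q 0 ∈ Y
    last∈    : q (suc (suc d)) ∈ Y
    ends     : ¬ Adj H (q 0) (q (suc (suc d)))
    interior : ∀ i → 0 < i → i < suc (suc d) → q i ∈ X

  inner : List (Fin n)
  inner = seg q (suc (suc d)) 2 d

  ind : Ind (q 0 ∷ (q 1 ∷ inner) ++ q (suc (suc d)) ∷ [])
  ind = subst (λ l → Ind (q 0 ∷ l)) (seg-snoc q (suc (suc d)) 1 (suc d)) (seg-ind q (suc (suc d)) path 0 (suc (suc d)) ≤-refl)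

  inner-all : ∀ {P : Fin n → Set} → (∀ i → 0 < i → i < suc (suc d) → P (q i)) → All P (q 1 ∷ inner)
  inner-all h = seg-all q (suc (suc d)) 1 (suc d) h

  length-even : odd (length (q 1 ∷ inner)) ≡ false
  length-even = trans (cong (odd ∘ suc) (length-seg q (suc (suc d)) 2 d)) (cong not d-odd)

  not-odd-length : odd (length (q 1 ∷ inner)) ≡ true → 𝟘
  not-odd-length e = contradiction (trans (sym e) length-even) λ ()

  -- Consecutive interior vertices are adjacent, so the interior cannot leave a union of components
  -- of `X`.
  one-side : ∀ {C} → Connectivity.Closed H X C →
    (∀ i → 0 < i → i < suc (suc d) → q i ∈ C) ⊎ (∀ i → 0 < i → i < suc (suc d) → q i ∉ C)
  one-side {C} (_ , closed) with q 1 ∈? C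
  ... | yes q1∈ = inj₁ go
    where
    go : ∀ i → 0 < i → i < suc (suc d) → q i ∈ C
    go (suc zero) _ _ = q1∈
    go (suc (suc i)) _ i< = decidable-stable (q (suc (suc i)) ∈? C) λ out → closed (q (suc i)) (q (suc (suc i)))
      (go (suc i) (s≤s z≤n) (≤-trans (n≤1+n _) i<)) (interior (suc (suc i)) (s≤s z≤n) i<) out
      (Equivalence.from (proj₁ path (suc i) (suc (suc i)) (<⇒≤ (≤-trans (n≤1+n _) i<)) (<⇒≤ i<)) (gap-+ i 1))
  ... | no q1∉ = inj₂ go
    where
    go : ∀ i → 0 < i → i < suc (suc d) → q i ∉ C
    go (suc zero) _ _ = q1∉
    go (suc (suc i)) _ i< ∈C = closed (q (suc (suc i))) (q (suc i)) ∈C (interior (suc i) (s≤s z≤n) (≤-trans (n≤1+n _) i<))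
      (go (suc i) (s≤s z≤n) (≤-trans (n≤1+n _) i<))
      (Equivalence.from (proj₁ path (suc (suc i)) (suc i) (<⇒≤ i<) (<⇒≤ (≤-trans (n≤1+n _) i<))) (gap-+′ i 1))

oddPath : ∀ {n} (H : Graph n) (X Y : Subset n) {k} (f : Fin (suc k) ↣ Fin n) → let to = Injection.to f in
  (∀ i j → Adj H (to i) (to j) ⇔ ∣ toℕ i - toℕ j ∣ ≡ 1) → Odd k → to zero ∈ Y → to (fromℕ k) ∈ Y →
  ¬ Adj H (to zero) (to (fromℕ k)) → InteriorIn f X → OddPath H X Y
oddPath H X Y {zero} f path o = contradiction (divides 0 refl) o
oddPath H X Y {suc zero} f path o a b ends = contradiction (Equivalence.from (path zero (suc zero)) refl) ends
oddPath {n} H X Y {suc (suc d)} f path o a b ends int = record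
  { d = d ; q = q ; path = InducedPaths.function⇒Path H f path
  ; d-odd = trans (sym (𝔹ₚ.not-involutive _)) (Odd⇒odd o)
  ; first∈ = subst (_∈ Y) (sym q0) a ; last∈ = subst (_∈ Y) (sym qk) b
  ; ends = λ e → ends (subst₂ (Adj H) q0 qk e)
  ; interior = λ i 0<i i<k → int (clamp k i)
      (λ e → <⇒≢ 0<i (sym (trans (sym (toℕ-clamp (<⇒≤ i<k))) (cong toℕ e))))
      (λ e → <⇒≢ i<k (trans (sym (toℕ-clamp (<⇒≤ i<k))) (trans (cong toℕ e) (toℕ-fromℕ k)))) }
  where
  k = suc (suc d)
  q : ℕ → Fin n
  q = Injection.to f ∘ clamp k
  q0 : q 0 ≡ Injection.to f zero
  q0 = cong (Injection.to f) (clamp-toℕ {k} zero)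
  qk : q k ≡ Injection.to f (fromℕ k)
  qk = cong (Injection.to f) (toℕ-injective (trans (toℕ-clamp ≤-refl) (sym (toℕ-fromℕ k))))

oddPath-nonadjacent : ∀ {n} (G : Graph n) {A B} → OddPathBetweenNonadjacent G A B → OddPath G A B
oddPath-nonadjacent G {A} {B} (k , f , path , o , a , b , ends , int) = oddPath G A B f path o a b ends int

oddAntipath-adjacent : ∀ {n} (G : Graph n) {A B} → OddAntipathBetweenAdjacent G A B → OddPath (complement G) B A
oddAntipath-adjacent G {A} {B} (k , f , path , o , a , b , ends , int) = oddPath (complement G) B A f
  (λ i j → path i j ⇔-∘ ⇔-sym (induced-co G f i j)) o a b (λ (_ , ¬e) → ¬e ends) int

oddAntipath-adjacent-co : ∀ {n} (G : Graph n) {A B} → OddAntipathBetweenAdjacent (complement G) A B → OddPath G B A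
oddAntipath-adjacent-co G {A} {B} (k , f , path , o , a , b , ends , int) = oddPath G B A f
  (λ i j → path i j ⇔-∘ induced-co-co G f i j) o a b (proj₂ ends) int

-- A skew partition with its witnesses: `S` collects some but not all components of `A`, and `D`
-- some but not all anticomponents of `B`.
record Cut {n : ℕ} (G : Graph n) (A B S D : Subset n) : Set where
  field
    A∪B       : ∀ v → v ∈ A ⊎ v ∈ B
    A∩B       : ∀ v → v ∈ A → v ∈ B → 𝟘
    S-closed  : Connectivity.Closed G A S
    D-closed  : Connectivity.Closed (complement G) B D
    S≢∅       : Nonempty S
    A≢S       : ∃[ v ] v ∈ A × v ∉ S
    D≢∅       : Nonempty D
    B≢D       : ∃[ v ] v ∈ B × v ∉ D

no-balanced-cut : ∀ {n} (G : Graph n) → MinimumImperfect G → ∀ {A B S D} → Cut G A B S D → Balanced G A D → 𝟘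
no-balanced-cut {n} G mi {A} {B} {S} {D} cut balanced = no-balanced-quartering G quarter mi inhabited
    (λ u v uq vq → proj₂ S-closed u v (A₁-S uq) (proj₁ (A₂-S vq)) (proj₂ (A₂-S vq)))
    (λ u v uq vq → adj-stable G λ ¬uv → proj₂ D-closed u v (B₁-D uq) (proj₁ (B₂-D vq)) (proj₂ (B₂-D vq))
      ((λ { refl → proj₂ (B₂-D vq) (B₁-D uq) }) , ¬uv))
    A D in-A (λ v → B₁-D) balanced
  where
  open Cut cut
  classify : ∀ v → Dec (v ∈ A) → Quarter
  classify v (yes _) = true , does (v ∈? S)
  classify v (no _)  = false , does (v ∈? D)
  quarter : Fin n → Quarter
  quarter v = classify v (v ∈? A)
  on-A : ∀ {v} → v ∈ A → quarter v ≡ (true , does (v ∈? S))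
  on-A {v} v∈ with v ∈? A
  ... | yes _ = refl
  ... | no v∉ = contradiction v∈ v∉
  on-B : ∀ {v} → v ∈ B → quarter v ≡ (false , does (v ∈? D))
  on-B {v} v∈ with v ∈? A
  ... | yes ∈A = ⊥-elim (A∩B v ∈A v∈)
  ... | no _ = refl
  in-A : ∀ v → proj₁ (quarter v) ≡ true → v ∈ A
  in-A v e with v ∈? A
  ... | yes ∈A = ∈A
  in-B : ∀ v → proj₁ (quarter v) ≡ false → v ∈ B
  in-B v e with A∪B v
  ... | inj₂ ∈B = ∈B
  ... | inj₁ ∈A = contradiction (trans (sym (cong proj₁ (on-A ∈A))) e) λ ()
  does-yes : ∀ {X : Subset n} {v} → does (v ∈? X) ≡ true → v ∈ X
  does-yes {X} {v} e with v ∈? X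
  ... | yes ∈X = ∈X
  does-no : ∀ {X : Subset n} {v} → does (v ∈? X) ≡ false → v ∉ X
  does-no {X} {v} e with v ∈? X
  ... | no ∉X = ∉X
  A₁-S : ∀ {v} → quarter v ≡ A₁ → v ∈ S
  A₁-S {v} e = does-yes (trans (sym (cong proj₂ (on-A (in-A v (cong proj₁ e))))) (cong proj₂ e))
  A₂-S : ∀ {v} → quarter v ≡ A₂ → v ∈ A × v ∉ S
  A₂-S {v} e = let ∈A = in-A v (cong proj₁ e) in ∈A , does-no (trans (sym (cong proj₂ (on-A ∈A))) (cong proj₂ e))
  B₁-D : ∀ {v} → quarter v ≡ B₁ → v ∈ D
  B₁-D {v} e = does-yes (trans (sym (cong proj₂ (on-B (in-B v (cong proj₁ e))))) (cong proj₂ e))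
  B₂-D : ∀ {v} → quarter v ≡ B₂ → v ∈ B × v ∉ D
  B₂-D {v} e = let ∈B = in-B v (cong proj₁ e) in ∈B , does-no (trans (sym (cong proj₂ (on-B ∈B))) (cong proj₂ e))
  inhabited : ∀ p → ∃[ v ] quarter v ≡ p
  inhabited A₁ = let v , ∈S = S≢∅ in v , trans (on-A (proj₁ S-closed ∈S)) (cong (true ,_) (dec-true (v ∈? S) ∈S))
  inhabited A₂ = let v , ∈A , ∉S = A≢S in v , trans (on-A ∈A) (cong (true ,_) (dec-false (v ∈? S) ∉S))
  inhabited B₁ = let v , ∈D = D≢∅ in v , trans (on-B (proj₁ D-closed ∈D)) (cong (false ,_) (dec-true (v ∈? D) ∈D))
  inhabited B₂ = let v , ∈B , ∉D = B≢D in v , trans (on-B ∈B) (cong (false ,_) (dec-false (v ∈? D) ∉D))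

cut-co : ∀ {n} {G : Graph n} {A B S D} → Cut G A B S D → Cut (complement G) B A D S
cut-co {G = G} cut = record
  { A∪B = λ v → [ inj₂ , inj₁ ]′ (A∪B v) ; A∩B = λ v p r → A∩B v r p ; S-closed = D-closed
  ; D-closed = proj₁ S-closed , λ a b a∈ b∈ b∉ (a≢b , ¬co) → ¬co (a≢b , proj₂ S-closed a b a∈ b∈ b∉)
  ; S≢∅ = D≢∅ ; A≢S = B≢D ; D≢∅ = S≢∅ ; B≢D = A≢S }
  where open Cut cut

module _ {n : ℕ} (G : Graph n) (berge : Berge G) where

  private
    module P = InducedPaths G
    module Q = InducedPaths (complement G)
    no-hole = berge⇒noOddHole G berge
    no-antihole = berge⇒noOddHole (complement G) (berge-co G berge)

  -- The vertex t closes paths and antipaths between X and C to holes and antiholes.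
  module Separator (t : Fin n) (C X : Subset n) (t∉C : t ∉ C) (t-C : ∀ c → c ∈ C → ¬ Adj G t c) (t-X : ∀ x → x ∈ X → Adj G t x) where

    paths : ∀ u v m ms → u ∈ X → v ∈ X → All (_∈ C) (m ∷ ms) → P.Ind (u ∷ (m ∷ ms) ++ v ∷ []) → odd (length (m ∷ ms)) ≡ true
    paths u v m ms u∈ v∈ ms∈ ind = P.Parity.apex no-hole u m ms v t ind (adj-sym G (t-X u u∈)) (adj-sym G (t-X v v∈))
      (All.map (λ {c} c∈ → (λ { refl → t∉C c∈ }) , t-C c c∈) ms∈)

    antipaths : ∀ u v m ms → u ∈ C → v ∈ C → All (_∈ X) (m ∷ ms) → Q.Ind (u ∷ (m ∷ ms) ++ v ∷ []) → odd (length (m ∷ ms)) ≡ true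
    antipaths u v m ms u∈ v∈ ms∈ ind = Q.Parity.apex no-antihole u m ms v t ind
      ((λ { refl → t∉C u∈ }) , t-C u u∈ ∘ adj-sym G) ((λ { refl → t∉C v∈ }) , t-C v v∈ ∘ adj-sym G)
      (All.map (λ {x} x∈ → (λ { refl → adj-irrefl G refl (t-X x x∈) }) , λ (_ , ¬tx) → ¬tx (t-X x x∈)) ms∈)

  module LooseCut {A B C D : Subset n} (cut : Cut G A B C D) (b : Fin n) (b∈B : b ∈ B) (b∉D : b ∉ D)
    (b-C : ∀ c → c ∈ C → ¬ Adj G b c) where
    open Cut cut

    complete : ∀ x y → x ∈ D → y ∈ B → y ∉ D → Adj G x y
    complete x y x∈ y∈ y∉ = adj-stable G λ ¬xy → proj₂ D-closed x y x∈ y∈ y∉ ((λ { refl → y∉ x∈ }) , ¬xy)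

    B∌C : ∀ {v} → v ∈ B → v ∉ C
    B∌C v∈B v∈C = A∩B _ (proj₁ S-closed v∈C) v∈B

    module ByB = Separator b C D (B∌C b∈B) b-C (λ x x∈ → adj-sym G (complete x b x∈ b∈B b∉D))

    -- `c` is to `B ─ D` what `b` is to `D`. An antipath interior in `B` stays in one of these sets,
    -- and so do two nonadjacent ends of a path, because the sets are complete to each other.
    balanced-co : ∀ c → c ∈ D → (∀ x → x ∈ C → ¬ Adj G c x) → Balanced (complement G) B C
    balanced-co c c∈ c-C = no-antipath ∘ oddPath-nonadjacent (complement G) , no-path ∘ oddAntipath-adjacent-co G
      where
      rest : Subset n
      rest = B ─ D
      in-rest : ∀ {v} → v ∈ B → v ∉ D → v ∈ rest
      in-rest = x∈p∧x∉q⇒x∈p─q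
      c-rest : ∀ x → x ∈ rest → Adj G c x
      c-rest x x∈ = let ∈B , ∉D = ∈─⁻ B D x∈ in complete c x c∈ ∈B ∉D
      module ByC = Separator c C rest (B∌C (proj₁ D-closed c∈)) c-C c-rest
      no-antipath : OddPath (complement G) B C → 𝟘
      no-antipath p with OddPath.one-side p D-closed
      ... | inj₁ ∈D = not-odd-length (ByB.antipaths _ _ _ _ first∈ last∈ (inner-all ∈D) ind)
        where open OddPath p
      ... | inj₂ ∉D = not-odd-length (ByC.antipaths _ _ _ _ first∈ last∈ (inner-all λ i a z → in-rest (interior i a z) (∉D i a z)) ind)
        where open OddPath p
      no-path : OddPath G C B → 𝟘
      no-path p = sides (q 0 ∈? D) (q (suc (suc d)) ∈? D)
        where
        open OddPath p
        sides : Dec (q 0 ∈ D) → Dec (q (suc (suc d)) ∈ D) → 𝟘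
        sides (yes x) (yes y) = not-odd-length (ByB.paths _ _ _ _ x y (inner-all interior) ind)
        sides (no x)  (no y)  = not-odd-length (ByC.paths _ _ _ _ (in-rest first∈ x) (in-rest last∈ y) (inner-all interior) ind)
        sides (yes x) (no y)  = ends (complete _ _ x last∈ y)
        sides (no x)  (yes y) = ends (adj-sym G (complete _ _ y first∈ x))

    balanced : Connectivity.Conn G C → (∀ x → x ∈ D → ∃[ c ] c ∈ C × Adj G x c) → Balanced G A D
    balanced conn neighbour = no-path ∘ oddPath-nonadjacent G , no-antipath ∘ oddAntipath-adjacent G
      where
      no-path : OddPath G A D → 𝟘
      no-path p with OddPath.one-side p S-closed
      ... | inj₁ ∈C = not-odd-length (ByB.paths _ _ _ _ first∈ last∈ (inner-all ∈C) ind)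
        where open OddPath p
      ... | inj₂ ∉C = through (P.walk⇒path u X walk)
        where
        open OddPath p
        u = q 0
        v = q (suc (suc d))
        X : Fin n → Set
        X x = x ≡ u ⊎ x ≡ v ⊎ x ∈ C
        walk : Star (λ x y → X x × X y × Adj G x y) v u
        walk = let c , c∈ , vc = neighbour v last∈ ; c′ , c′∈ , uc′ = neighbour u first∈ in
          (inj₂ (inj₁ refl) , inj₂ (inj₂ c∈) , vc) ◅
          (Star.map (λ (x∈ , y∈ , xy) → inj₂ (inj₂ x∈) , inj₂ (inj₂ y∈) , xy) (Connectivity.conn⇒connected G conn c c′ c∈ c′∈)
            ◅◅ ((inj₂ (inj₂ c′∈) , inj₁ refl , adj-sym G uc′) ◅ ε))
        u≢v : u ≢ v
        u≢v = proj₁ (P.ends-apart u (q 1) inner v ind)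
        through : P.PathTo u X v → 𝟘
        through (inj₁ e) = u≢v (sym e)
        through (inj₂ ([] , _ , (a , _))) = ends (adj-sym G a)
        -- The given path avoids `C` and the new one runs through `C`, so no edge joins their
        -- interiors and the parities agree. The interior inside `C` is odd by `ByB`.
        through (inj₂ (m ∷ ms , ms∈ , ind′)) = not-odd-length (trans
            (P.Parity.glue no-hole u (q 1) inner v m ms ind ind′ (inner-all λ i a z → All.map (λ {c} c∈ →
              (λ { refl → ∉C i a z c∈ }) , (λ e → proj₂ S-closed c (q i) c∈ (interior i a z) (∉C i a z) (adj-sym G e))) inC))
            (ByB.paths v u m ms last∈ first∈ inC ind′))
          where
          inC : All (_∈ C) (m ∷ ms)
          inC = All.map (λ { (inj₁ refl , _ , u≢) → contradiction refl u≢
                           ; (inj₂ (inj₁ refl) , v≢ , _) → contradiction refl v≢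
                           ; (inj₂ (inj₂ c∈) , _) → c∈ }) (All.zip (ms∈ , P.interior-≢ v (m ∷ ms) u ind′))
      no-antipath : OddPath (complement G) D A → 𝟘
      no-antipath p = sides (q 0 ∈? C) (q (suc (suc d)) ∈? C)
        where
        open OddPath p
        k = suc (suc d)
        adjacent : Adj G (q 0) (q k)
        adjacent = adj-stable G λ ¬a → ends ((λ e → contradiction (proj₂ path 0 k z≤n ≤-refl e) λ ()) , ¬a)
        sides : Dec (q 0 ∈ C) → Dec (q k ∈ C) → 𝟘
        sides (yes x) (yes y) = not-odd-length (ByB.antipaths _ _ _ _ x y (inner-all interior) ind)
        sides (yes x) (no y)  = proj₂ S-closed _ _ x last∈ y adjacent
        sides (no x)  (yes y) = proj₂ S-closed _ _ y first∈ x (adj-sym G adjacent)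
        -- The ends lie in `A` outside `C` and have no neighbour in `C`, while every interior vertex
        -- has one.
        sides (no x)  (no y)  = contradiction (trans (sym (trans (𝔹ₚ.not-involutive _) d-odd))
            (no-odd-antipath conn S≢∅ (s≤s (s≤s z≤n)) (λ i a z free → let c , c∈ , e = neighbour (q i) (interior i a z) in free c c∈ e))) λ ()
          where
          outside-C : ∀ i → i ≤ k → q i ∉ C
          outside-C zero _ = x
          outside-C (suc i) i≤ with m≤n⇒m<n∨m≡n i≤
          ... | inj₁ i< = B∌C (proj₁ D-closed (interior (suc i) (s≤s z≤n) i<))
          ... | inj₂ refl = y
          open RousselRubio G C D q k path outside-C interior
            (λ f f∈ e → proj₂ S-closed f (q 0) f∈ first∈ x (adj-sym G e)) (λ f f∈ e → proj₂ S-closed f (q k) f∈ last∈ y (adj-sym G e))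
            no-hole no-antihole ByB.paths ByB.antipaths

module _ {n : ℕ} (G : Graph n) (mi : MinimumImperfect G) where

  private
    module C = Connectivity G
    module C̄ = Connectivity (complement G)

  partition : ∀ {A B : Subset n} → A ∪ B ≡ ⊤ → ∀ v → v ∈ A ⊎ v ∈ B
  partition {A} {B} eq v = x∈p∪q⁻ A B (subst (v ∈_) (sym eq) ∈⊤)

  skew-cut : ∀ {A B} → SkewPartition G A B → ∃₂ λ S D → Cut G A B S D
  skew-cut {A} {B} ((A∪B , A∩B) , ¬cA , ¬cB) with C.conn-or-cut A | C̄.conn-or-cut B
  ... | inj₁ c | _ = contradiction (C.conn⇒connected c) ¬cA
  ... | inj₂ _ | inj₁ c = contradiction (C̄.conn⇒connected c) ¬cB
  ... | inj₂ (S , Sc , ne , out) | inj₂ (D , Dc , ne′ , out′) = S , D , record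
    { A∪B = partition A∪B ; A∩B = λ v → disjoint-⊥ A∩B ; S-closed = Sc ; D-closed = Dc
    ; S≢∅ = ne ; A≢S = out ; D≢∅ = ne′ ; B≢D = out′ }

  no-balanced-skew-partition : ∀ A B → SkewPartition G A B → ¬ Balanced G A B
  no-balanced-skew-partition A B skew (no-path , no-antipath) with skew-cut skew
  ... | S , D , cut = no-balanced-cut G mi cut
    ((λ (k , f , p , o , a , b , r) → no-path (k , f , p , o , proj₁ (Cut.D-closed cut) a , proj₁ (Cut.D-closed cut) b , r)) ,
     (λ (k , f , p , o , a , b , c , r) → no-antipath (k , f , p , o , a , b , c , λ i x y → proj₁ (Cut.D-closed cut) (r i x y))))

  -- All from maximality: a neighbour of `E` in `A` could be added to it, and since the empty set
  -- counts as connected, nonemptiness too comes from comparison with a single vertex.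
  component-cut : ∀ {A B S D E} → Cut G A B S D → ¬ Connected G A → IsComponent G A E →
    C.Closed A E × Nonempty E × ∃[ v ] v ∈ A × v ∉ E
  component-cut {A} {E = E} cut ¬cA (E⊆A , cE , maximal) = (E⊆A , closed) , nonempty , outside-E
    where
    nonempty : Nonempty E
    nonempty with nonempty? E
    ... | yes ne = ne
    ... | no empty = let v , v∈ , _ = Cut.A≢S cut in contradiction
          (v , subst (v ∈_) (maximal ⁅ v ⁆ (λ p → subst (_∈ A) (sym (x∈⁅y⁆⇒x≡y v p)) v∈) (C.conn⇒connected (C.conn-singleton v))
            (λ p → contradiction (_ , p) empty)) (x∈⁅x⁆ v)) empty
    outside-E : ∃[ v ] v ∈ A × v ∉ E
    outside-E with any? (λ v → (v ∈? A) ×-dec ¬? (v ∈? E))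
    ... | yes r = r
    ... | no none = contradiction (subst (Connected G) (⊆-antisym E⊆A λ {v} v∈ → decidable-stable (v ∈? E) λ v∉ → none (v , v∈ , v∉)) cE) ¬cA
    closed : ∀ a b → a ∈ E → b ∈ A → b ∉ E → ¬ Adj G a b
    closed a b a∈ b∈ b∉ ab = b∉ (subst (b ∈_) (maximal (E ∪ ⁅ b ⁆)
      (λ p → [ (λ r → E⊆A r) , (λ r → subst (_∈ A) (sym (x∈⁅y⁆⇒x≡y b r)) b∈) ]′ (x∈p∪q⁻ E ⁅ b ⁆ p))
      (C.conn⇒connected (C.conn-insert (C.connected⇒conn cE) a∈ ab)) (p⊆p∪q ⁅ b ⁆)) (q⊆p∪q E ⁅ b ⁆ (x∈⁅x⁆ b)))

  no-loose-component : ∀ A B → SkewPartition G A B → ∀ b → b ∈ B → ∀ E → IsComponent G A E → (∀ c → c ∈ E → ¬ Adj G b c) → 𝟘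
  no-loose-component A B skew@(_ , ¬cA , _) b b∈ E comp b-E with skew-cut skew
  ... | S , D , cut with component-cut cut ¬cA comp | C̄.cut-avoiding (Cut.D-closed cut) (Cut.D≢∅ cut) (Cut.B≢D cut) b b∈
  ...   | closed , ne , out | L , L-closed , L-ne , b∉L = by-neighbours (any? λ c → (c ∈? L) ×-dec ¬? (any? λ x → (x ∈? E) ×-dec adj? G c x))
    where
    cut′ : Cut G A B E L
    cut′ = record { A∪B = Cut.A∪B cut ; A∩B = Cut.A∩B cut ; S-closed = closed ; D-closed = L-closed
                  ; S≢∅ = ne ; A≢S = out ; D≢∅ = L-ne ; B≢D = b , b∈ , b∉L }
    open LooseCut G (proj₁ mi) cut′ b b∈ b∉L b-E
    by-neighbours : Dec (∃[ c ] c ∈ L × ¬ (∃[ x ] x ∈ E × Adj G c x)) → 𝟘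
    by-neighbours (yes (c , c∈ , isolated)) =
      no-balanced-cut (complement G) (minimumImperfect-co G mi) (cut-co cut′) (balanced-co c c∈ λ x x∈ e → isolated (x , x∈ , e))
    by-neighbours (no none) = no-balanced-cut G mi cut′ (balanced (C.connected⇒conn (proj₁ (proj₂ comp)))
      λ x x∈ → decidable-stable (any? λ c → (c ∈? E) ×-dec adj? G x c) λ ¬e → none (x , x∈ , ¬e))

skew-co : ∀ {n} (G : Graph n) {A B} → SkewPartition G A B → SkewPartition (complement G) B A
skew-co G {A} {B} ((A∪B , A∩B) , ¬cA , ¬cB) = (trans (∪-comm B A) A∪B , trans (∩-comm B A) A∩B) , ¬cB ,
  λ c → ¬cA λ u v u∈ v∈ → Star.map (λ (x∈ , y∈ , x≢y , ¬co) → x∈ , y∈ , adj-stable G (λ ¬xy → ¬co (x≢y , ¬xy))) (c u v u∈ v∈)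

theorem4p9 : ∀ (n : ℕ) (G : Graph n) → MinimumImperfect G →
    (¬ (∃₂ λ A B → SkewPartition G A B × Balanced G A B))
    × (∀ A B → SkewPartition G A B → ¬ Loose G A B)
theorem4p9 n G mi = (λ (A , B , skew , balanced) → no-balanced-skew-partition G mi A B skew balanced) , loose
  where
  loose : ∀ A B → SkewPartition G A B → ¬ Loose G A B
  loose A B skew (inj₁ (b , b∈ , C , comp , b-C)) = no-loose-component G mi A B skew b b∈ C comp b-C
  -- In the complement `a` has no neighbour in the component `D` of `B`.
  loose A B skew (inj₂ (a , a∈ , D , comp , a-D)) = no-loose-component (complement G) (minimumImperfect-co G mi) B A
    (skew-co G skew) a a∈ D comp λ d d∈ (_ , ¬ad) → ¬ad (a-D d d∈)
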